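{- Let $G$ be a complete graph with $\Delta(G)\ge 3$ and let $m,n$ be integers with $1<m<n$. Then $\chi(G^{\frac{m}{n}})=\omega(G^{\frac{m}{n}})$.
   Context: For a graph $G$ and positive integer $n$, the $n$-subdivision $G^{\frac{1}{n}}$ is obtained from $G$ by replacing each edge with a path of length $n$. For a graph $H$ and positive integer $m$, the $m$-th power $H^m$ is the graph on $V(H)$ in which two distinct vertices are adjacent iff their distance in $H$ is at most $m$. The fractional power is $G^{\frac{m}{n}}=(G^{\frac{1}{n}})^m$. $\chi$ denotes the chromatic number and $\omega$ the clique number. -}

module Defs where

open import Data.Nat using (ℕ; zero; suc; _≤_; _<_; _∸_)
open import Data.Fin using (Fin; toℕ)
import Data.Fin as F
open import Data.Bool using (Bool; true; false; T)
open import Data.List using (List; length; filterᵇ; allFin)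
open import Data.Product using (Σ; _×_; _,_; ∃)
open import Data.Sum using (_⊎_)
open import Relation.Nullary using (¬_)
open import Relation.Binary.PropositionalEquality using (_≡_; _≢_)
open import Function.Definitions using (Injective)

record SimpleGraph (N : ℕ) : Set where
  field
    adj   : Fin N → Fin N → Bool
    sym   : ∀ i j → adj i j ≡ adj j i
    irrefl : ∀ i → adj i i ≡ false
open SimpleGraph public

IsComplete : ∀ {N} → SimpleGraph N → Set
IsComplete G = ∀ i j → i ≢ j → T (adj G i j)

degree : ∀ {N} → SimpleGraph N → Fin N → ℕ
degree {N} G v = length (filterᵇ (adj G v) (allFin N))

MaxDegree≥ : ∀ {N} → SimpleGraph N → ℕ → Set
MaxDegree≥ G k = Σ _ λ v → k ≤ degree G v

record Graph : Set₁ where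
  field
    V : Set
    E : V → V → Set
open Graph public

data Walk (H : Graph) : V H → V H → ℕ → Set where
  nil  : ∀ {u} → Walk H u u 0
  cons : ∀ {u w v ℓ} → E H u w → Walk H w v ℓ → Walk H u v (suc ℓ)

Power : Graph → ℕ → Graph
Power H m = record
  { V = V H
  ; E = λ u v → (u ≢ v) × Σ ℕ (λ ℓ → (ℓ ≤ m) × Walk H u v ℓ) }

-- n-subdivision of a simple graph G on Fin N.
-- An edge is a pair i < j with adj i j; internal vertex t : Fin (n ∸ 1) on edge (i , j)
-- sits at distance toℕ t + 1 from i (and n - (toℕ t + 1) from j).
Edge : ∀ {N} → SimpleGraph N → Set
Edge {N} G = Σ (Fin N) λ i → Σ (Fin N) λ j → (i F.< j) × T (adj G i j)

SubV : ∀ {N} → SimpleGraph N → ℕ → Set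
SubV {N} G n = Fin N ⊎ (Edge G × Fin (n ∸ 1))

data SubArc {N} (G : SimpleGraph N) (n : ℕ) : SubV G n → SubV G n → Set where
  direct : ∀ i j (i<j : i F.< j) (a : T (adj G i j)) → n ≡ 1 →
           SubArc G n (Data.Sum.inj₁ i) (Data.Sum.inj₁ j)
  start  : ∀ i j (i<j : i F.< j) (a : T (adj G i j)) (t : Fin (n ∸ 1)) → toℕ t ≡ 0 →
           SubArc G n (Data.Sum.inj₁ i) (Data.Sum.inj₂ ((i , j , i<j , a) , t))
  step   : ∀ (e : Edge G) (t t' : Fin (n ∸ 1)) → toℕ t' ≡ suc (toℕ t) →
           SubArc G n (Data.Sum.inj₂ (e , t)) (Data.Sum.inj₂ (e , t'))
  end    : ∀ i j (i<j : i F.< j) (a : T (adj G i j)) (t : Fin (n ∸ 1)) → suc (toℕ t) ≡ n ∸ 1 →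
           SubArc G n (Data.Sum.inj₂ ((i , j , i<j , a) , t)) (Data.Sum.inj₁ j)

Subdivision : ∀ {N} → SimpleGraph N → ℕ → Graph
Subdivision G n = record
  { V = SubV G n
  ; E = λ u v → SubArc G n u v ⊎ SubArc G n v u }

FracPower : ∀ {N} → SimpleGraph N → ℕ → ℕ → Graph
FracPower G m n = Power (Subdivision G n) m

Colorable : Graph → ℕ → Set
Colorable H c = Σ (V H → Fin c) λ f → ∀ u v → E H u v → f u ≢ f v

HasClique : Graph → ℕ → Set
HasClique H c = Σ (Fin c → V H) λ f → Injective _≡_ _≡_ f × (∀ i j → i ≢ j → E H (f i) (f j))

IsChromaticNumber : Graph → ℕ → Set
IsChromaticNumber H c = Colorable H c × (∀ d → d < c → ¬ Colorable H d)

IsCliqueNumber : Graph → ℕ → Set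
IsCliqueNumber H c = HasClique H c × (∀ d → HasClique H d → d ≤ c)

-- Put m = 2k or m = 2k + 1 and D = N ∸ 1.  A branch vertex with the points at distance at most k, plus one
-- point at distance k + 1 when m is odd, is a clique with 1 + Dk, respectively 2 + Dk, points, so it is
-- enough to colour properly with that many colours.  A path of length at most m < n meets at most one
-- branch vertex; a colouring is therefore a family of strings of n + 1 colours, one per edge, with
-- conditions inside each string and between the strings at a common branch vertex.  Repeating the first
-- m + 1 colours of every string turns n into n + m + 1, which leaves m < n ≤ 2m + 1.
--
-- Every ball of radius k must see Dk + 1 colours.  For even m it sees all of them, and the middle of a
-- string reuses colours of other half-edges, outermost first.  For odd m each vertex misses one colour,
-- which has to follow its ball on every half-edge; for n > m + 1 these missing colours differ from vertex
-- to vertex, and the colour missing around v sits around u ≠ v in a place depending on n.  With D ≥ 4 each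
-- edge leaves two classes of colours unused at both of its ends; K₄ leaves only one, and is treated
-- separately by reversing the order of the colours of a class around suitable vertices.

module Submission where

open import Defs hiding (sym)
open import Data.Nat hiding (_≟_)
open import Data.Nat.Properties hiding (_≟_)
open import Data.Nat.DivMod using (_%_; _/_; _mod_; m%n<n; m≡m%n+[m/n]*n; m<n⇒m%n≡m; n%n≡0)
open import Algebra.Properties.CommutativeSemigroup +-commutativeSemigroup using (interchange)
open import Data.Integer as ℤ using (ℤ; -[1+_])
open import Data.Vec as Vec using (Vec; []; _∷_)
open import Data.Fin as Fin using (Fin; zero; suc; toℕ; fromℕ<; #_)
open import Data.Fin.Properties as Fin using (_≟_; toℕ-injective; toℕ<n; toℕ-fromℕ<; pigeonhole; any?; all?)
open import Data.Bool as Bool using (Bool; true; false; T; T?; not; _∧_; if_then_else_)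
open import Data.Bool.Properties using (T-irrelevant; T-∧)
open import Data.Maybe as Maybe using (Maybe; just; nothing)
open import Data.Maybe.Properties using (just-injective)
open import Data.List as List using (List; []; _∷_; length; lookup; allFin)
open import Data.List.Properties using (filter-notAll; length-tabulate)
open import Data.List.Relation.Unary.All as All using (All; []; _∷_)
import Data.List.Relation.Unary.All.Properties as All
open import Data.List.Relation.Unary.Any as Any using (Any; index)
open import Data.List.Relation.Unary.Any.Properties using (lookup-index)
open import Data.List.Membership.Propositional using (_∈_)
open import Data.List.Membership.Propositional.Properties using (∈-allFin)
open import Data.Product using (Σ; _×_; _,_; ∃; proj₁; proj₂)
open import Data.Product.Properties using (,-injective)
open import Data.Sum as Sum using (_⊎_; inj₁; inj₂)
open import Data.Sum.Properties using (inj₁-injective; inj₂-injective)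
open import Data.Empty using (⊥; ⊥-elim)
open import Data.Unit using (tt)
open import Function using (_∘_; id)
open import Function.Bundles using (_↣_; mk↣; module Injection; module Equivalence)
open import Function.Construct.Composition using (_↣-∘_)
open import Function.Construct.Identity using (↣-id)
open import Function.Properties.Inverse using (↔⇒↣; ↔-sym)
open import Data.Sum.Function.Propositional using (_⊎-↣_)
open import Function.Definitions using (Injective)
open import Relation.Nullary using (¬_; Dec; yes; no; contradiction; ¬?)
open import Relation.Nullary.Decidable using (True; toWitness; from-yes; _×-dec_; _→-dec_)
open import Relation.Binary.Definitions using (tri<; tri≈; tri>)
open import Relation.Binary.PropositionalEquality

-- Linear arithmetic over ℕ: a sequent is proved by a Farkas certificate, a linear combination of the
-- hypotheses and the negated conclusion whose left side exceeds its right side coefficientwise.  The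
-- certificate is searched for by elimination during type checking; only its check is verified.

-- For odd `m = 2k + 1` and `n > m + 1` the number of colours splits as
-- `2 + Dk = N + (1 + D(k ∸ 1))`: the vertices themselves serve as colours, `u` being the one
-- missing around `u`, and the rest paints a common centre and `k ∸ 1` layers. So one notion of
-- layers serves both parities, with `K = k` or `K = k ∸ 1`. Depth on a half-edge is counted from
-- its outer end; then the middle point with `j` middle points before it may reuse the colours of
-- depth at most `j` from another half-edge, whatever `k` is. What decides is the number `r` of
-- middle points against `K`. In K₄ with `r ≤ K` the two half-edges of an edge have different
-- classes, and the third class alone fills the middle from both ends. With `r > K` the half-edges
-- are far enough apart to share a class in opposite orders, which frees the other two. For odd `m`
-- this second way also puts vertex colours into the middle and starts only at `r = K + 2`; the gap
-- `r = K + 1` is the origin of the exceptional constructions and of the two tables.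

infixl 6 _⊕_
infix 4 _≼_ _≺_ _≋_
infixr 3 _⇒_

data Expr (n : ℕ) : Set where
  var : Fin n → Expr n
  con : ℕ → Expr n
  _⊕_ : Expr n → Expr n → Expr n

data Relation (n : ℕ) : Set where
  _≼_ _≋_ : Expr n → Expr n → Relation n

_≺_ : ∀ {n} → Expr n → Expr n → Relation n
a ≺ b = con 1 ⊕ a ≼ b

data Sequent (n : ℕ) : Set where
  ⊢_  : Relation n → Sequent n
  ⊢⊥  : Sequent n
  _⇒_ : Relation n → Sequent n → Sequent n

infix 3 ⊢_

module _ {n : ℕ} (ρ : Vec ℕ n) where

  ⟦_⟧ᵉ : Expr n → ℕ
  ⟦ var x ⟧ᵉ = Vec.lookup ρ x
  ⟦ con c ⟧ᵉ = c
  ⟦ a ⊕ b ⟧ᵉ = ⟦ a ⟧ᵉ + ⟦ b ⟧ᵉ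

  ⟦_⟧ʳ : Relation n → Set
  ⟦ a ≼ b ⟧ʳ = ⟦ a ⟧ᵉ ≤ ⟦ b ⟧ᵉ
  ⟦ a ≋ b ⟧ʳ = ⟦ a ⟧ᵉ ≡ ⟦ b ⟧ᵉ

  ⟦_⟧ˢ : Sequent n → Set
  ⟦ ⊢ r ⟧ˢ   = ⟦ r ⟧ʳ
  ⟦ ⊢⊥ ⟧ˢ    = ⊥
  ⟦ r ⇒ s ⟧ˢ = ⟦ r ⟧ʳ → ⟦ s ⟧ˢ

-- The constant term comes first.
Linear : ℕ → Set
Linear n = Vec ℕ (suc n)

dot : ∀ {n} → Vec ℕ n → Vec ℕ n → ℕ
dot [] [] = 0
dot (c ∷ cs) (x ∷ xs) = c * x + dot cs xs

⟦_⟧ˡ : ∀ {n} → Linear n → Vec ℕ n → ℕ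
⟦ c ⟧ˡ ρ = dot c (1 ∷ ρ)

zeroᵛ : ∀ {n} → Vec ℕ n
zeroᵛ = Vec.replicate _ 0

addᵛ : ∀ {n} → Vec ℕ n → Vec ℕ n → Vec ℕ n
addᵛ = Vec.zipWith _+_

scaleᵛ : ∀ {n} → ℕ → Vec ℕ n → Vec ℕ n
scaleᵛ k = Vec.map (k *_)

linear : ∀ {n} → Expr n → Linear n
linear (var x) = 0 ∷ Vec.updateAt zeroᵛ x (λ _ → 1)
linear (con c) = c ∷ zeroᵛ
linear (a ⊕ b) = addᵛ (linear a) (linear b)

dot-zero : ∀ {n} (ρ : Vec ℕ n) → dot zeroᵛ ρ ≡ 0
dot-zero [] = refl
dot-zero (x ∷ ρ) = dot-zero ρ

dot-unit : ∀ {n} x (ρ : Vec ℕ n) → dot (Vec.updateAt zeroᵛ x (λ _ → 1)) ρ ≡ Vec.lookup ρ x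
dot-unit zero (x ∷ ρ) = trans (cong (x + 0 +_) (dot-zero ρ)) (trans (+-identityʳ _) (+-identityʳ x))
dot-unit (suc i) (x ∷ ρ) = dot-unit i ρ

dot-add : ∀ {n} (c d ρ : Vec ℕ n) → dot (addᵛ c d) ρ ≡ dot c ρ + dot d ρ
dot-add [] [] [] = refl
dot-add (c ∷ cs) (d ∷ ds) (x ∷ ρ) =
  trans (cong₂ _+_ (*-distribʳ-+ x c d) (dot-add cs ds ρ)) (interchange (c * x) (d * x) (dot cs ρ) (dot ds ρ))

dot-scale : ∀ {n} k (c ρ : Vec ℕ n) → dot (scaleᵛ k c) ρ ≡ k * dot c ρ
dot-scale k [] [] = sym (*-zeroʳ k)
dot-scale k (c ∷ cs) (x ∷ ρ) =
  trans (cong₂ _+_ (*-assoc k c x) (dot-scale k cs ρ)) (sym (*-distribˡ-+ k (c * x) (dot cs ρ)))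

linear-sound : ∀ {n} (ρ : Vec ℕ n) e → ⟦ linear e ⟧ˡ ρ ≡ ⟦ ρ ⟧ᵉ e
linear-sound ρ (var x) = dot-unit x ρ
linear-sound ρ (con c) = trans (cong (c * 1 +_) (dot-zero ρ)) (trans (+-identityʳ _) (*-identityʳ c))
linear-sound ρ (a ⊕ b) = trans (dot-add (linear a) (linear b) (1 ∷ ρ)) (cong₂ _+_ (linear-sound ρ a) (linear-sound ρ b))

Inequality : ℕ → Set
Inequality n = Linear n × Linear n

Holds : ∀ {n} → Vec ℕ n → Inequality n → Set
Holds ρ (a , b) = ⟦ a ⟧ˡ ρ ≤ ⟦ b ⟧ˡ ρ

inequalities : ∀ {n} → Relation n → List (Inequality n)
inequalities (a ≼ b) = (linear a , linear b) ∷ []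
inequalities (a ≋ b) = (linear a , linear b) ∷ (linear b , linear a) ∷ []

inequalities-sound : ∀ {n} (ρ : Vec ℕ n) r → ⟦ ρ ⟧ʳ r → All (Holds ρ) (inequalities r)
inequalities-sound ρ (a ≼ b) h = subst₂ _≤_ (sym (linear-sound ρ a)) (sym (linear-sound ρ b)) h ∷ []
inequalities-sound ρ (a ≋ b) h =
  ≤-reflexive (trans (linear-sound ρ a) (trans h (sym (linear-sound ρ b)))) ∷
  ≤-reflexive (trans (linear-sound ρ b) (trans (sym h) (sym (linear-sound ρ a)))) ∷ []

combine : ∀ {n} → List ℕ → List (Inequality n) → Inequality n
combine (k ∷ ks) ((a , b) ∷ hs) = addᵛ (scaleᵛ k a) (proj₁ (combine ks hs)) , addᵛ (scaleᵛ k b) (proj₂ (combine ks hs))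
combine _ _ = zeroᵛ , zeroᵛ

combine-sound : ∀ {n} (ρ : Vec ℕ n) ks hs → All (Holds ρ) hs → Holds ρ (combine ks hs)
combine-sound ρ [] _ _ = ≤-refl
combine-sound ρ (_ ∷ _) [] _ = ≤-refl
combine-sound ρ (k ∷ ks) ((a , b) ∷ hs) (h ∷ all) = subst₂ _≤_ (sym (expand a _)) (sym (expand b _))
  (+-mono-≤ (*-monoʳ-≤ k h) (combine-sound ρ ks hs all))
  where
  expand : ∀ a c → dot (addᵛ (scaleᵛ k a) c) (1 ∷ ρ) ≡ k * dot a (1 ∷ ρ) + dot c (1 ∷ ρ)
  expand a c = trans (dot-add (scaleᵛ k a) c (1 ∷ ρ)) (cong (_+ dot c (1 ∷ ρ)) (dot-scale k a (1 ∷ ρ)))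

dominates : ∀ {n} → Vec ℕ n → Vec ℕ n → Bool
dominates [] [] = true
dominates (c ∷ cs) (d ∷ ds) = (d ≤ᵇ c) ∧ dominates cs ds

dominates-sound : ∀ {n} (c d ρ : Vec ℕ n) → T (dominates c d) → dot d ρ ≤ dot c ρ
dominates-sound [] [] [] _ = z≤n
dominates-sound (c ∷ cs) (d ∷ ds) (x ∷ ρ) ok =
  +-mono-≤ (*-monoˡ-≤ x (≤ᵇ⇒≤ d c (proj₁ oks))) (dominates-sound cs ds ρ (proj₂ oks))
  where oks = Equivalence.to T-∧ ok

-- Strictness has to come from the constant terms, since all variables may be 0.
inconsistent : ∀ {n} → Inequality n → Bool
inconsistent (a ∷ as , b ∷ bs) = (suc b ≤ᵇ a) ∧ dominates as bs

inconsistent-sound : ∀ {n} (ρ : Vec ℕ n) h → T (inconsistent h) → ¬ Holds ρ h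
inconsistent-sound ρ (a ∷ as , b ∷ bs) ok = <⇒≱ (+-mono-<-≤ (*-monoˡ-< 1 (≤ᵇ⇒≤ (suc b) a (proj₁ oks))) (dominates-sound as bs ρ (proj₂ oks)))
  where oks = Equivalence.to T-∧ ok

-- An intermediate consequence c₀ + Σ cᵢ xᵢ ≤ 0 together with the combination of inequalities giving it.
Consequence : Set
Consequence = List ℤ × List ℕ

zipLong : ∀ {A : Set} → (A → A → A) → List A → List A → List A
zipLong f [] ys = ys
zipLong f xs [] = xs
zipLong f (x ∷ xs) (y ∷ ys) = f x y ∷ zipLong f xs ys

coefficient : ℕ → Consequence → ℤ
coefficient i (cs , _) = go i cs
  where
  go : ℕ → List ℤ → ℤ
  go _ [] = ℤ.+ 0
  go zero (c ∷ _) = c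
  go (suc i) (_ ∷ cs) = go i cs

-- One step of Fourier-Motzkin elimination: for coefficients of opposite sign, crosswise scaling by
-- their absolute values cancels variable `i`, and the multipliers of the hypotheses are scaled
-- along.
resolve : ℕ → Consequence → Consequence → Consequence
resolve i p@(a , k) q@(b , l) =
  zipLong ℤ._+_ (List.map ((ℤ.+ ∣q∣) ℤ.*_) a) (List.map ((ℤ.+ ∣p∣) ℤ.*_) b) ,
  zipLong _+_ (List.map (∣q∣ *_) k) (List.map (∣p∣ *_) l)
  where
  ∣p∣ = ℤ.∣ coefficient i p ∣
  ∣q∣ = ℤ.∣ coefficient i q ∣

positive negative : ℤ → Bool
positive (ℤ.+ suc _) = true
positive _ = false
negative -[1+ _ ] = true
negative _ = false

eliminate : ℕ → List Consequence → List Consequence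
eliminate i cs = List.filterᵇ unaffected cs List.++ List.cartesianProductWith (resolve i) ups downs
  where
  unaffected : Consequence → Bool
  unaffected c = not (positive (coefficient i c)) ∧ not (negative (coefficient i c))
  ups   = List.filterᵇ (positive ∘ coefficient i) cs
  downs = List.filterᵇ (negative ∘ coefficient i) cs

difference : ∀ {n} → Vec ℕ n → Vec ℕ n → List ℤ
difference [] [] = []
difference (a ∷ as) (b ∷ bs) = a ℤ.⊖ b ∷ difference as bs

consequences : ∀ {n} → ℕ → List (Inequality n) → List Consequence
consequences i [] = []
consequences i ((a , b) ∷ hs) = (difference a b , List.replicate i 0 List.++ 1 ∷ []) ∷ consequences (suc i) hs

-- The fact `-xᵢ ≤ 0` carries no multipliers: `dominates` already pays for it, so it never enters a
-- certificate.
nonnegativity : ℕ → Consequence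
nonnegativity i = List.replicate i (ℤ.+ 0) List.++ -[1+ 0 ] ∷ [] , []

-- Once all variables are eliminated, a consequence reads `c₀ ≤ 0`, and one with `c₀ > 0` is the
-- contradiction sought. If there is none, the empty list is returned, which `inconsistent` rejects.
certificate : ∀ {n} → List (Inequality n) → List ℕ
certificate {n} hs = pick (search n (consequences 0 hs))
  where
  search : ℕ → List Consequence → List Consequence
  search zero cs = cs
  search (suc i) cs = search i (eliminate (suc i) (nonnegativity (suc i) ∷ cs))
  pick : List Consequence → List ℕ
  pick [] = []
  pick (c ∷ cs) = if positive (coefficient 0 c) then proj₂ c else pick cs

refutable : ∀ {n} → List (Inequality n) → Bool
refutable hs = inconsistent (combine (certificate hs) hs)

refute : ∀ {n} (ρ : Vec ℕ n) hs → T (refutable hs) → ¬ All (Holds ρ) hs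
refute ρ hs ok all = inconsistent-sound ρ (combine (certificate hs) hs) ok (combine-sound ρ (certificate hs) hs all)

valid : ∀ {n} → List (Inequality n) → Sequent n → Bool
valid hs (⊢ a ≼ b) = refutable (inequalities (b ≺ a) List.++ hs)
valid hs (⊢ a ≋ b) = refutable (inequalities (b ≺ a) List.++ hs) ∧ refutable (inequalities (a ≺ b) List.++ hs)
valid hs ⊢⊥        = refutable hs
valid hs (r ⇒ s)   = valid (inequalities r List.++ hs) s

valid-sound : ∀ {n} (ρ : Vec ℕ n) hs s → T (valid hs s) → All (Holds ρ) hs → ⟦ ρ ⟧ˢ s
valid-sound ρ hs (⊢ a ≼ b) ok all =
  ≮⇒≥ λ b<a → refute ρ _ ok (All.++⁺ (inequalities-sound ρ (b ≺ a) b<a) all)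
valid-sound ρ hs (⊢ a ≋ b) ok all = ≤-antisym
  (≮⇒≥ λ b<a → refute ρ _ (proj₁ oks) (All.++⁺ (inequalities-sound ρ (b ≺ a) b<a) all))
  (≮⇒≥ λ a<b → refute ρ _ (proj₂ oks) (All.++⁺ (inequalities-sound ρ (a ≺ b) a<b) all))
  where oks = Equivalence.to T-∧ ok
valid-sound ρ hs ⊢⊥ ok all = refute ρ hs ok all
valid-sound ρ hs (r ⇒ s) ok all = λ h → valid-sound ρ _ s ok (All.++⁺ (inequalities-sound ρ r h) all)

Curried : ∀ n → (Vec ℕ n → Set) → Set
Curried zero    P = P []
Curried (suc n) P = ∀ x → Curried n (P ∘ (x ∷_))

curried : ∀ n {P : Vec ℕ n → Set} → (∀ ρ → P ρ) → Curried n P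
curried zero    p = p []
curried (suc n) p = λ x → curried n (p ∘ (x ∷_))

-- Higher-order syntax, so that the variables of a sequent can be named where `arith` is called.
Template : ℕ → ℕ → Set
Template zero    n = Sequent n
Template (suc k) n = Expr n → Template k n

instantiate : ∀ {k n} → Template k n → Vec (Expr n) k → Sequent n
instantiate s [] = s
instantiate f (e ∷ es) = instantiate (f e) es

close : ∀ n → Template n n → Sequent n
close n f = instantiate f (Vec.tabulate var)

arith : ∀ n (f : Template n n) {ok : T (valid [] (close n f))} → Curried n λ ρ → ⟦ ρ ⟧ˢ (close n f)
arith n f {ok} = curried n λ ρ → valid-sound ρ [] (close n f) ok []

-- If every `y` occurred in `xs`, the positions would inject `Fin N` into a smaller set.
fresh : ∀ {N} (xs : List (Fin N)) → length xs < N → ∃ λ y → All (y ≢_) xs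
fresh {N} xs short with any? (λ y → All.all? (λ x → ¬? (y ≟ x)) xs)
... | yes found = found
... | no none = contradiction (trans (lookup-index (covered i)) (trans (cong (lookup xs) same) (sym (lookup-index (covered j))))) (λ eq → Fin.<⇒≢ i<j eq)
  where
  covered : ∀ y → y ∈ xs
  covered y with Any.any? (y ≟_) xs
  ... | yes y∈xs = y∈xs
  ... | no y∉xs = contradiction (y , All.tabulate λ {x} x∈xs y≡x → y∉xs (subst (_∈ xs) (sym y≡x) x∈xs)) none
  clash = pigeonhole short (λ y → index (covered y))
  i = proj₁ clash
  j = proj₁ (proj₂ clash)
  i<j = proj₁ (proj₂ (proj₂ clash))
  same = proj₂ (proj₂ (proj₂ clash))

-- Colourings of the subdivision.

-- A string is indexed by the distance from its first vertex. Distance 0 is left out of `across`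
-- because the branch vertex lies on both edges, which makes that case one of `along`.
record Strings (C : Set) (N m n : ℕ) : Set where
  field
    centre  : Fin N → C
    colour  : Fin N → Fin N → ℕ → C
    begins  : ∀ {u v} → u ≢ v → colour u v 0 ≡ centre u
    reverse : ∀ {u v i j} → u ≢ v → i + j ≡ n → colour u v i ≡ colour v u j
    along   : ∀ {u v i j} → u ≢ v → i < j → j ≤ n → j ≤ m + i → colour u v i ≢ colour u v j
    across  : ∀ {u v w i j} → u ≢ v → u ≢ w → v ≢ w → 0 < i → 0 < j → i + j ≤ m →
              colour u v i ≢ colour u w j

module _ {N : ℕ} (G : SimpleGraph N) (n : ℕ) where

  -- A relation rather than a function: a branch vertex has a position on every edge at it, and an
  -- inner vertex has one in each direction. That the colour is the same for all of them is
  -- `paint-at`.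
  data At : SubV G n → Fin N → Fin N → ℕ → Set where
    source   : ∀ {u v i} → u ≢ v → i ≡ 0 → At (inj₁ u) u v i
    target   : ∀ {u v i} → u ≢ v → i ≡ n → At (inj₁ v) u v i
    forward  : ∀ {u v u<v a t i} → i ≡ suc (toℕ t) → At (inj₂ ((u , v , u<v , a) , t)) u v i
    backward : ∀ {u v u<v a t i} → i + suc (toℕ t) ≡ n → At (inj₂ ((u , v , u<v , a) , t)) v u i

  At⇒≢ : ∀ {x u v i} → At x u v i → u ≢ v
  At⇒≢ (source u≢v _) = u≢v
  At⇒≢ (target u≢v _) = u≢v
  At⇒≢ (forward {u<v = u<v} _) refl = Fin.<-irrefl refl u<v
  At⇒≢ (backward {u<v = u<v} _) refl = Fin.<-irrefl refl u<v

  interior<n : (t : Fin (n ∸ 1)) → suc (toℕ t) < n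
  interior<n t = helper n t
    where
    helper : ∀ n (t : Fin (n ∸ 1)) → suc (toℕ t) < n
    helper (suc n) t = s≤s (toℕ<n t)

  At⇒≤ : ∀ {x u v i} → At x u v i → i ≤ n
  At⇒≤ (source _ refl) = z≤n
  At⇒≤ (target _ refl) = ≤-refl
  At⇒≤ (forward {t = t} refl) = <⇒≤ (interior<n t)
  At⇒≤ (backward {i = i} eq) = ≤-trans (m≤m+n i _) (≤-reflexive eq)

  At-reverse : ∀ {x u v i j} → i + j ≡ n → At x u v i → At x v u j
  At-reverse eq (source u≢v refl) = target (≢-sym u≢v) eq
  At-reverse {i = i} {j} eq (target u≢v i≡n) =
    source (≢-sym u≢v) (+-cancelˡ-≡ i j 0 (trans eq (trans (sym i≡n) (sym (+-identityʳ i)))))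
  At-reverse {i = i} {j} eq (forward i≡t) = backward (trans (cong (j +_) (sym i≡t)) (trans (+-comm j i) eq))
  At-reverse {i = i} eq (backward eq′) = forward (+-cancelˡ-≡ i _ _ (trans eq (sym eq′)))

  data Consecutive (x y : SubV G n) : Set where
    consecutive : ∀ {u v i} → At x u v i → At y u v (suc i) → Consecutive x y

  Consecutive-sym : ∀ {x y} → Consecutive x y → Consecutive y x
  Consecutive-sym (consecutive {i = i} x y) =
    consecutive (At-reverse (m+[n∸m]≡n (At⇒≤ y)) y)
                (At-reverse (trans (+-suc i _) (m+[n∸m]≡n (At⇒≤ y))) x)

  arc : ∀ {x y} → 1 < n → SubArc G n x y → Consecutive x y
  arc 1<n (direct i j i<j a n≡1) = contradiction (sym n≡1) (<⇒≢ 1<n)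
  arc 1<n (start i j i<j a t t≡0) =
    consecutive (source (λ i≡j → Fin.<-irrefl i≡j i<j) refl) (forward (cong suc (sym t≡0)))
  arc 1<n (step e t t′ eq) = consecutive (forward refl) (forward (cong suc (sym eq)))
  arc 1<n (end i j i<j a t eq) =
    consecutive (forward refl)
      (target (λ i≡j → Fin.<-irrefl i≡j i<j) (trans (cong suc eq) (m+[n∸m]≡n (<⇒≤ 1<n))))

  -- The invariant for walks of length `ℓ < n`: they stay within one edge or turn at a single branch
  -- vertex `u`.
  data Near (ℓ : ℕ) (x y : SubV G n) : Set where
    same    : x ≡ y → Near ℓ x y
    onEdge  : ∀ {u v i j} → At x u v i → At y u v j → i ≤ ℓ + j → j ≤ ℓ + i → Near ℓ x y
    through : ∀ {u v w i j} → v ≢ w → At x u v i → At y u w j → i + j ≤ ℓ → Near ℓ x y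

  leave-branch : ∀ {x z v y w j ℓ} → At x z v 1 → At y z w j → j ≤ ℓ → Near (suc ℓ) x y
  leave-branch {v = v} {w = w} x y j≤ℓ with v ≟ w
  ... | yes refl = onEdge x y (s≤s z≤n) (≤-trans j≤ℓ (≤-trans (n≤1+n _) (m≤m+n _ 1)))
  ... | no v≢w   = through v≢w x y (s≤s j≤ℓ)

  -- The edge `u v` is fixed by the invariant for `x′`. A neighbour `x` stays on it unless `x′` is a
  -- branch vertex, where it may lie on any other edge.
  data Aligned (x x′ : SubV G n) (u v : Fin N) (i : ℕ) : Set where
    beside : ∀ {a} → At x u v a → a ≤ suc i → i ≤ suc a → Aligned x x′ u v i
    branch : ∀ {z w} → x′ ≡ inj₁ z → At x z w 1 → Aligned x x′ u v i

  align : ∀ {x x′ u v i} → Consecutive x x′ → At x′ u v i → Aligned x x′ u v i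
  align (consecutive x (source _ ())) _
  align (consecutive {i = i} x (target _ i+1≡n)) _ = branch refl (At-reverse (trans (+-comm i 1) i+1≡n) x)
  align (consecutive x (forward refl)) (forward refl) = beside x (m≤n+m _ 2) ≤-refl
  align (consecutive {i = i} x (forward refl)) (backward {i = j} eq) =
    beside (At-reverse (trans (+-suc i j) (trans (cong suc (+-comm i j)) (trans (sym (+-suc j i)) eq))) x) ≤-refl (m≤n+m j 2)
  align (consecutive {i = i} x (backward eq)) (forward refl) =
    beside (At-reverse (trans (+-suc i _) eq) x) ≤-refl (m≤n+m _ 2)
  align (consecutive {i = i} x (backward {t = t} eq)) (backward {i = j} eq′) =
    beside x (≤-trans (m≤n+m i 2) (≤-reflexive (cong suc (sym j≡1+i)))) (≤-reflexive j≡1+i)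
    where
    j≡1+i : j ≡ suc i
    j≡1+i = +-cancelʳ-≡ (suc (toℕ t)) j (suc i) (trans eq′ (sym eq))

  prepend : ∀ {x x′ y ℓ} → ℓ < n → Consecutive x x′ → Near ℓ x′ y → Near (suc ℓ) x y
  prepend {ℓ = ℓ} ℓ<n (consecutive {i = i} x x′) (same refl) =
    onEdge x x′ (≤-trans (n≤1+n i) (m≤n+m _ (suc ℓ))) (s≤s (m≤n+m i ℓ))
  prepend {ℓ = ℓ} ℓ<n xx′ (onEdge {i = i} {j} x′ y i≤ j≤) with align xx′ x′
  ... | beside x a≤ ≤a = onEdge x y (≤-trans a≤ (s≤s i≤))
                           (≤-trans j≤ (≤-trans (+-monoʳ-≤ ℓ ≤a) (≤-reflexive (+-suc ℓ _))))
  ... | branch refl x with x′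
  ...   | source _ refl = leave-branch x y (≤-trans j≤ (≤-reflexive (+-identityʳ ℓ)))
  -- At the far end the edge is turned round, which makes the branch vertex its source.
  ...   | target _ refl = leave-branch x (At-reverse (m+[n∸m]≡n (At⇒≤ y)) y)
                            (m≤n+o⇒m∸n≤o n j (≤-trans i≤ (≤-reflexive (+-comm ℓ j))))
  prepend ℓ<n xx′ (through {i = i} {j} v≢w x′ y i+j≤) with align xx′ x′
  ... | beside x a≤ ≤a = through v≢w x y (≤-trans (+-monoˡ-≤ j a≤) (s≤s i+j≤))
  ... | branch refl x with x′
  ...   | source _ refl = leave-branch x y i+j≤
  -- A second branch vertex is out of reach: here `i = n`, but `i ≤ ℓ < n`.
  ...   | target _ refl = contradiction (≤-trans (m≤m+n i j) i+j≤) (<⇒≱ ℓ<n)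

  walk⇒near : ∀ {x y ℓ} → 1 < n → ℓ < n → Walk (Subdivision G n) x y ℓ → Near ℓ x y
  walk⇒near 1<n ℓ<n nil = same refl
  walk⇒near 1<n ℓ<n (cons (inj₁ e) walk) =
    prepend (<⇒≤ ℓ<n) (arc 1<n e) (walk⇒near 1<n (<⇒≤ ℓ<n) walk)
  walk⇒near 1<n ℓ<n (cons (inj₂ e) walk) =
    prepend (<⇒≤ ℓ<n) (Consecutive-sym (arc 1<n e)) (walk⇒near 1<n (<⇒≤ ℓ<n) walk)

module _ {N m n : ℕ} (G : SimpleGraph N) {C : Set} (S : Strings C N m n) where
  open Strings S

  paint : SubV G n → C
  paint (inj₁ u)                   = centre u
  paint (inj₂ ((u , v , _ , _) , t)) = colour u v (suc (toℕ t))

  paint-at : ∀ {x u v i} → At G n x u v i → paint x ≡ colour u v i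
  paint-at (source u≢v refl) = sym (begins u≢v)
  paint-at (target u≢v refl) = trans (sym (begins (≢-sym u≢v))) (reverse (≢-sym u≢v) refl)
  paint-at (forward refl) = refl
  paint-at at@(backward {i = i} eq) = sym (reverse (At⇒≢ G n at) eq)

  At-unique : ∀ {x y u v i} → 0 < n → At G n x u v i → At G n y u v i → x ≡ y
  At-unique 0<n (source _ _) (source _ _) = refl
  At-unique 0<n (source _ refl) (target _ 0≡n) = contradiction 0≡n (<⇒≢ 0<n)
  At-unique 0<n (source _ refl) (forward ())
  At-unique 0<n (source _ refl) (backward {t = t} eq) = contradiction eq (<⇒≢ (interior<n G n t))
  At-unique 0<n (target _ i≡n) (source _ refl) = contradiction i≡n (<⇒≢ 0<n)
  At-unique 0<n (target _ _) (target _ _) = refl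
  At-unique 0<n (target _ refl) (forward {t = t} eq) = contradiction (sym eq) (<⇒≢ (interior<n G n t))
  At-unique 0<n (target _ refl) (backward {t = t} eq) = contradiction (trans (sym (+-suc _ _)) eq) (m+1+n≢m n ∘ trans (+-suc _ _))
  At-unique 0<n (forward {t = t} eq) (target _ refl) = contradiction (sym eq) (<⇒≢ (interior<n G n t))
  At-unique 0<n (forward {u<v = p} {a} {t} refl) (forward {u<v = q} {b} {t′} eq)
    with refl ← Fin.<-irrelevant p q | refl ← T-irrelevant {x = adj G _ _} a b | refl ← toℕ-injective (suc-injective eq) = refl
  At-unique 0<n (forward ()) (source _ refl)
  At-unique 0<n (forward {u<v = p} _) (backward {u<v = q} _) = contradiction p (Fin.<-asym q)
  At-unique 0<n (backward {t = t} eq) (source _ refl) = contradiction eq (<⇒≢ (interior<n G n t))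
  At-unique 0<n (backward eq) (target _ refl) = contradiction eq (m+1+n≢m n)
  At-unique 0<n (backward {u<v = p} _) (forward {u<v = q} _) = contradiction p (Fin.<-asym q)
  At-unique 0<n (backward {u<v = p} {a} {t} {i} eq) (backward {u<v = q} {b} {t′} eq′)
    with refl ← Fin.<-irrelevant p q | refl ← T-irrelevant {x = adj G _ _} a b
       | refl ← toℕ-injective (suc-injective (+-cancelˡ-≡ i _ _ (trans eq (sym eq′)))) = refl

  onEdge-≢ : ∀ {x y u v i j} → 0 < n → x ≢ y → At G n x u v i → At G n y u v j → i ≤ m + j → j ≤ m + i →
             paint x ≢ paint y
  onEdge-≢ {u = u} {v} {i} {j} 0<n x≢y x y i≤ j≤ eq with <-cmp i j
  ... | tri< i<j _ _ = along (At⇒≢ G n x) i<j (At⇒≤ G n y) j≤ (trans (sym (paint-at x)) (trans eq (paint-at y)))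
  ... | tri≈ _ refl _ = x≢y (At-unique 0<n x y)
  ... | tri> _ _ j<i = along (At⇒≢ G n x) j<i (At⇒≤ G n x) i≤ (trans (sym (paint-at y)) (trans (sym eq) (paint-at x)))

  near-≢ : ∀ {x y} → 0 < n → x ≢ y → Near G n m x y → paint x ≢ paint y
  near-≢ 0<n x≢y (same x≡y) = contradiction x≡y x≢y
  near-≢ 0<n x≢y (onEdge x y i≤ j≤) = onEdge-≢ 0<n x≢y x y i≤ j≤
  near-≢ 0<n x≢y (through {i = zero} {zero} _ (source _ _) (source _ _) _) = contradiction refl x≢y
  near-≢ 0<n x≢y (through {i = zero} _ (target _ 0≡n) _ _) = contradiction 0≡n (<⇒≢ 0<n)
  near-≢ 0<n x≢y (through {i = zero} _ (backward {t = t} eq) _ _) = contradiction eq (<⇒≢ (interior<n G n t))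
  near-≢ 0<n x≢y (through {i = zero} _ (source _ _) y j≤) =
    onEdge-≢ 0<n x≢y (source (At⇒≢ G n y) refl) y z≤n (≤-trans j≤ (≤-reflexive (sym (+-identityʳ m))))
  near-≢ 0<n x≢y (through {j = zero} _ _ (target _ 0≡n) _) = contradiction 0≡n (<⇒≢ 0<n)
  near-≢ 0<n x≢y (through {j = zero} _ _ (backward {t = t} eq) _) = contradiction eq (<⇒≢ (interior<n G n t))
  near-≢ 0<n x≢y (through {i = suc i} {zero} _ x (source _ _) i≤) =
    onEdge-≢ 0<n x≢y x (source (At⇒≢ G n x) refl)
      (≤-trans (≤-reflexive (sym (+-identityʳ (suc i)))) (≤-trans i≤ (m≤m+n m 0))) z≤n
  near-≢ 0<n x≢y (through {i = suc i} {suc j} v≢w x y i+j≤) eq =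
    across (At⇒≢ G n x) (At⇒≢ G n y) v≢w (s≤s z≤n) (s≤s z≤n) i+j≤ (trans (sym (paint-at x)) (trans eq (paint-at y)))

  weaken : ∀ {x y ℓ ℓ′} → ℓ ≤ ℓ′ → Near G n ℓ x y → Near G n ℓ′ x y
  weaken ℓ≤ (same x≡y) = same x≡y
  weaken ℓ≤ (onEdge x y i≤ j≤) = onEdge x y (≤-trans i≤ (+-monoˡ-≤ _ ℓ≤)) (≤-trans j≤ (+-monoˡ-≤ _ ℓ≤))
  weaken ℓ≤ (through v≢w x y i+j≤) = through v≢w x y (≤-trans i+j≤ ℓ≤)

  colorable : ∀ {c} → C ↣ Fin c → 1 < n → m < n → Colorable (FracPower G m n) c
  colorable C↣c 1<n m<n = Injection.to C↣c ∘ paint , λ x y (x≢y , ℓ , ℓ≤m , walk) eq →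
    near-≢ (<⇒≤ 1<n) x≢y (weaken ℓ≤m (walk⇒near G n 1<n (<-≤-trans (s≤s ℓ≤m) m<n) walk)) (Injection.injective C↣c eq)

-- Cliques.

_++ʷ_ : ∀ {H x y z k ℓ} → Walk H x y k → Walk H y z ℓ → Walk H x z (k + ℓ)
nil ++ʷ q = q
cons e p ++ʷ q = cons e (p ++ʷ q)

reverseʷ : ∀ {H x y ℓ} → (∀ {a b} → E H a b → E H b a) → Walk H x y ℓ → Walk H y x ℓ
reverseʷ swap nil = nil
reverseʷ {ℓ = suc ℓ} swap (cons e p) =
  subst (Walk _ _ _) (+-comm ℓ 1) (reverseʷ swap p ++ʷ cons (swap e) nil)

-- Two points are joined by a walk through `z`, so only sums of two different radii matter; this
-- allows one point to lie further out when `m` is odd.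
star-clique : ∀ {N} (G : SimpleGraph N) {m n c} {z : SubV G n} (f : Fin c → SubV G n) (r : Fin c → ℕ) →
              Injective _≡_ _≡_ f → (∀ i → Walk (Subdivision G n) (f i) z (r i)) →
              (∀ i j → i ≢ j → r i + r j ≤ m) → HasClique (FracPower G m n) c
star-clique G f r f-injective reach bound = f , f-injective , λ i j i≢j →
  i≢j ∘ f-injective , r i + r j , bound i j i≢j , reach i ++ʷ reverseʷ Sum.swap (reach j)

module _ {D : ℕ} (G : SimpleGraph (suc D)) (complete : IsComplete G) (n : ℕ) where

  -- The centre of the clique is the smallest vertex, so all its edges are stored in the direction
  -- leaving it.
  spoke : Fin D → Edge G
  spoke v = zero , suc v , s≤s z≤n , complete zero (suc v) λ ()

  spoke-walk : ∀ v t (t<n-1 : t < n ∸ 1) →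
               Walk (Subdivision G n) (inj₂ (spoke v , fromℕ< t<n-1)) (inj₁ zero) (suc t)
  spoke-walk v zero t<n-1 = cons (inj₂ (start zero (suc v) _ _ _ (Fin.toℕ-fromℕ< t<n-1))) nil
  spoke-walk v (suc t) t+1<n-1 =
    cons (inj₂ (step _ _ _ (trans (Fin.toℕ-fromℕ< t+1<n-1) (cong suc (sym (Fin.toℕ-fromℕ< t<n-1))))))
         (spoke-walk v t t<n-1)
    where t<n-1 = <⇒≤ t+1<n-1

  in-range : ∀ k → k < n → (t : Fin k) → toℕ t < n ∸ 1
  in-range k k<n t = ≤-trans (toℕ<n t) (∸-monoˡ-≤ 1 k<n)

  on-spoke : ∀ k → k < n → Fin (D * k) → SubV G n
  on-spoke k k<n q = inj₂ (spoke (proj₁ (Fin.remQuot {D} k q)) , fromℕ< (in-range k k<n (proj₂ (Fin.remQuot {D} k q))))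

  ball : ∀ k → k < n → Fin (suc (D * k)) → SubV G n
  ball k k<n zero    = inj₁ zero
  ball k k<n (suc q) = on-spoke k k<n q

  ball-radius : ∀ k → Fin (suc (D * k)) → ℕ
  ball-radius k zero    = 0
  ball-radius k (suc q) = suc (toℕ (proj₂ (Fin.remQuot {D} k q)))

  ball-radius≤ : ∀ k q → ball-radius k q ≤ k
  ball-radius≤ k zero    = z≤n
  ball-radius≤ k (suc q) = toℕ<n (proj₂ (Fin.remQuot {D} k q))

  ball-walk : ∀ k k<n q → Walk (Subdivision G n) (ball k k<n q) (inj₁ zero) (ball-radius k q)
  ball-walk k k<n zero    = nil
  ball-walk k k<n (suc q) = spoke-walk _ _ (in-range k k<n (proj₂ (Fin.remQuot {D} k q)))

  spoke-injective : ∀ {v w t s} → _≡_ {A = SubV G n} (inj₂ (spoke v , t)) (inj₂ (spoke w , s)) → v ≡ w × t ≡ s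
  spoke-injective eq = Fin.suc-injective (cong (proj₁ ∘ proj₂ ∘ proj₁) (inj₂-injective eq)) , cong proj₂ (inj₂-injective eq)

  ball-injective : ∀ k k<n → Injective _≡_ _≡_ (ball k k<n)
  ball-injective k k<n {zero} {zero} _ = refl
  ball-injective k k<n {zero} {suc q} ()
  ball-injective k k<n {suc p} {zero} ()
  ball-injective k k<n {suc p} {suc q} eq = cong suc
    (trans (sym (Fin.combine-remQuot {D} k p))
      (trans (cong₂ Fin.combine (proj₁ vs) (toℕ-injective
               (trans (sym (Fin.toℕ-fromℕ< _)) (trans (cong toℕ (proj₂ vs)) (Fin.toℕ-fromℕ< _)))))
             (Fin.combine-remQuot {D} k q)))
    where vs = spoke-injective eq

  even-clique : ∀ {m} k → k + k ≤ m → k < n → HasClique (FracPower G m n) (suc (D * k))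
  even-clique k 2k≤m k<n = star-clique G (ball k k<n) (ball-radius k) (ball-injective k k<n) (ball-walk k k<n)
    λ i j _ → ≤-trans (+-mono-≤ (ball-radius≤ k i) (ball-radius≤ k j)) 2k≤m

  odd-clique : ∀ {m} k → k + suc k ≤ m → suc k < n → Fin D → HasClique (FracPower G m n) (2 + D * k)
  odd-clique {m} k 2k<m k+1<n v = star-clique G f r f-injective reach bound
    where
    k<n = <⇒≤ k+1<n
    k<n-1 : k < n ∸ 1
    k<n-1 = ∸-monoˡ-≤ 1 k+1<n
    f : Fin (2 + D * k) → SubV G n
    f zero    = inj₂ (spoke v , fromℕ< k<n-1)
    f (suc q) = ball k k<n q
    r : Fin (2 + D * k) → ℕ
    r zero    = suc k
    r (suc q) = ball-radius k q
    outside : ∀ q → f zero ≢ ball k k<n q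
    outside zero ()
    outside (suc q) eq = <-irrefl (trans (sym (Fin.toℕ-fromℕ< _)) (trans (cong toℕ (sym (proj₂ (spoke-injective eq)))) (Fin.toℕ-fromℕ< _)))
                                  (toℕ<n (proj₂ (Fin.remQuot {D} k q)))
    f-injective : Injective _≡_ _≡_ f
    f-injective {zero}  {zero}  _  = refl
    f-injective {zero}  {suc q} eq = contradiction eq (outside q)
    f-injective {suc p} {zero}  eq = contradiction (sym eq) (outside p)
    f-injective {suc p} {suc q} eq = cong suc (ball-injective k k<n eq)
    reach : ∀ q → Walk (Subdivision G n) (f q) (inj₁ zero) (r q)
    reach zero    = spoke-walk v k k<n-1
    reach (suc q) = ball-walk k k<n q
    bound : ∀ p q → p ≢ q → r p + r q ≤ m
    bound zero    zero    p≢q = contradiction refl p≢q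
    bound zero    (suc q) _ = ≤-trans (≤-reflexive (+-comm (suc k) _)) (≤-trans (+-monoˡ-≤ (suc k) (ball-radius≤ k q)) 2k<m)
    bound (suc p) zero    _ = ≤-trans (+-monoˡ-≤ (suc k) (ball-radius≤ k p)) 2k<m
    bound (suc p) (suc q) _ = ≤-trans (+-mono-≤ (ball-radius≤ k p) (≤-trans (ball-radius≤ k q) (n≤1+n k))) 2k<m

clique≤colours : ∀ {H c d} → Colorable H c → HasClique H d → d ≤ c
clique≤colours (f , proper) (g , _ , adjacent) = ≮⇒≥ λ c<d →
  let i , j , i<j , clash = pigeonhole c<d (f ∘ g)
  in proper (g i) (g j) (adjacent i j (Fin.<⇒≢ i<j)) clash

-- No clique outnumbers the colours, so a colouring and a clique of the same size prove each other
-- optimal.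
equal-numbers : ∀ {H c} → Colorable H c → HasClique H c → IsChromaticNumber H c × IsCliqueNumber H c
equal-numbers colours clique =
  (colours , λ d d<c few → <⇒≱ d<c (clique≤colours few clique)) , (clique , λ d → clique≤colours colours)

degree<order : ∀ {N} (G : SimpleGraph N) v → degree G v < N
degree<order {N} G v = <-≤-trans
  (filter-notAll (λ w → T? (adj G v w)) (allFin N) (Any.map (λ { refl → subst T (irrefl G v) }) (∈-allFin v)))
  (≤-reflexive (length-tabulate id))

-- Lengthening the strings by `m + 1`.

module _ {A : Set} (f : ℕ → A) (m θ : ℕ) where

  repeat : ℕ → A
  repeat i with i ≤? θ
  ... | yes _ = f i
  ... | no  _ = f (i ∸ suc m)

  repeat-≤ : ∀ {i} → i ≤ θ → repeat i ≡ f i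
  repeat-≤ {i} i≤θ with i ≤? θ
  ... | yes _  = refl
  ... | no i≰θ = contradiction i≤θ i≰θ

  repeat-> : ∀ {i j} → θ < i → i ≡ suc m + j → repeat i ≡ f j
  repeat-> {i} {j} θ<i eq with i ≤? θ
  ... | yes i≤θ = contradiction i≤θ (<⇒≱ θ<i)
  ... | no _    = cong f (trans (cong (_∸ suc m) eq) (m+n∸m≡n (suc m) j))

module _ {C : Set} {N m n : ℕ} (m<n : m < n) (S : Strings C N m n) where
  open Strings S

  private
    -- The last position before the jump back by `m + 1`. The jump follows position `m` as seen from
    -- the smaller end; in the new length `n + m + 1` the same gap follows position `n` as seen from
    -- the other end.
    θ : Fin N → Fin N → ℕ
    θ u v with u Fin.<? v
    ... | yes _ = m
    ... | no _  = n

    m≤θ : ∀ u v → m ≤ θ u v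
    m≤θ u v with u Fin.<? v
    ... | yes _ = ≤-refl
    ... | no _  = <⇒≤ m<n

    θ≤n : ∀ u v → θ u v ≤ n
    θ≤n u v with u Fin.<? v
    ... | yes _ = <⇒≤ m<n
    ... | no _  = ≤-refl

    θ-sym : ∀ {u v} → u ≢ v → θ u v + θ v u ≡ m + n
    θ-sym {u} {v} u≢v with u Fin.<? v | v Fin.<? u
    ... | yes u<v | yes v<u = contradiction v<u (Fin.<-asym u<v)
    ... | yes _   | no _    = refl
    ... | no _    | yes _   = +-comm n m
    ... | no u≮v  | no v≮u  = contradiction (Fin.≤-antisym (≮⇒≥ v≮u) (≮⇒≥ u≮v)) u≢v

    split : ∀ {i} u v → θ u v < i → ∃ λ j → i ≡ suc m + j
    split u v θ<i = _ , sym (m+[n∸m]≡n (≤-trans (s≤s (m≤θ u v)) θ<i))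

    colour′ : Fin N → Fin N → ℕ → C
    colour′ u v = repeat (colour u v) m (θ u v)

    reverse-low : ∀ {u v i j} → u ≢ v → i + j ≡ n + suc m → i ≤ θ u v → colour′ u v i ≡ colour′ v u j
    reverse-low {u} {v} {i} {j} u≢v eq i≤θ =
      trans (repeat-≤ _ m _ i≤θ) (trans (reverse u≢v i+k≡n) (sym (repeat-> _ m _ θ<j j≡)))
      where
      θ<j : θ v u < j
      θ<j = arith 6 (λ i j a b m n → i ⊕ j ≋ n ⊕ (con 1 ⊕ m) ⇒ i ≼ a ⇒ a ⊕ b ≋ m ⊕ n ⇒ ⊢ b ≺ j)
              i j (θ u v) (θ v u) m n eq i≤θ (θ-sym u≢v)
      k = proj₁ (split v u θ<j)
      j≡ = proj₂ (split v u θ<j)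
      i+k≡n : i + k ≡ n
      i+k≡n = arith 5 (λ i j k m n → i ⊕ j ≋ n ⊕ (con 1 ⊕ m) ⇒ j ≋ con 1 ⊕ m ⊕ k ⇒ ⊢ i ⊕ k ≋ n) i j k m n eq j≡

    reverse′ : ∀ {u v i j} → u ≢ v → i + j ≡ n + suc m → colour′ u v i ≡ colour′ v u j
    reverse′ {u} {v} {i} {j} u≢v eq with ≤-<-connex i (θ u v)
    ... | inj₁ i≤θ = reverse-low u≢v eq i≤θ
    ... | inj₂ θ<i = sym (reverse-low (≢-sym u≢v) (trans (+-comm j i) eq) j≤θ)
      where
      j≤θ : j ≤ θ v u
      j≤θ = arith 6 (λ i j a b m n → i ⊕ j ≋ n ⊕ (con 1 ⊕ m) ⇒ a ≺ i ⇒ a ⊕ b ≋ m ⊕ n ⇒ ⊢ j ≼ b)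
              i j (θ u v) (θ v u) m n eq θ<i (θ-sym u≢v)

    along′ : ∀ {u v i j} → u ≢ v → i < j → j ≤ n + suc m → j ≤ m + i → colour′ u v i ≢ colour′ u v j
    along′ {u} {v} {i} {j} u≢v i<j j≤ j≤m+i eq with ≤-<-connex i (θ u v) | ≤-<-connex j (θ u v)
    ... | inj₂ θ<i | inj₁ j≤θ = <⇒≱ (<-trans θ<i i<j) j≤θ
    ... | inj₁ i≤θ | inj₁ j≤θ = along u≢v i<j (≤-trans j≤θ (θ≤n u v)) j≤m+i
      (trans (sym (repeat-≤ _ m _ i≤θ)) (trans eq (repeat-≤ _ m _ j≤θ)))
    -- Position `j` carries the colour of `k = j ∸ (m + 1)`, which precedes `i`; the gap `j ∸ i`,
    -- between 1 and `m`, becomes `m + 1 ∸ (j ∸ i)`, again between 1 and `m`.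
    ... | inj₁ i≤θ | inj₂ θ<j = along u≢v k<i (≤-trans i≤θ (θ≤n u v)) i≤m+k
      (trans (sym (repeat-> _ m _ θ<j j≡)) (trans (sym eq) (repeat-≤ _ m _ i≤θ)))
      where
      k = proj₁ (split u v θ<j)
      j≡ = proj₂ (split u v θ<j)
      k<i : k < i
      k<i = arith 4 (λ i j k m → j ≋ con 1 ⊕ m ⊕ k ⇒ j ≼ m ⊕ i ⇒ ⊢ k ≺ i) i j k m j≡ j≤m+i
      i≤m+k : i ≤ m + k
      i≤m+k = arith 4 (λ i j k m → j ≋ con 1 ⊕ m ⊕ k ⇒ i ≺ j ⇒ ⊢ i ≼ m ⊕ k) i j k m j≡ i<j
    ... | inj₂ θ<i | inj₂ θ<j = along u≢v
      (arith 5 (λ i j k l m → i ≋ con 1 ⊕ m ⊕ k ⇒ j ≋ con 1 ⊕ m ⊕ l ⇒ i ≺ j ⇒ ⊢ k ≺ l) i j k l m i≡ j≡ i<j)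
      (arith 4 (λ j l m n → j ≋ con 1 ⊕ m ⊕ l ⇒ j ≼ n ⊕ (con 1 ⊕ m) ⇒ ⊢ l ≼ n) j l m n j≡ j≤)
      (arith 5 (λ i j k l m → i ≋ con 1 ⊕ m ⊕ k ⇒ j ≋ con 1 ⊕ m ⊕ l ⇒ j ≼ m ⊕ i ⇒ ⊢ l ≼ m ⊕ k) i j k l m i≡ j≡ j≤m+i)
      (trans (sym (repeat-> _ m _ θ<i i≡)) (trans eq (repeat-> _ m _ θ<j j≡)))
      where
      k = proj₁ (split u v θ<i)
      i≡ = proj₂ (split u v θ<i)
      l = proj₁ (split u v θ<j)
      j≡ = proj₂ (split u v θ<j)

  -- On every edge u < v the first m + 1 colours are repeated once; the m + 1 colours before and after
  -- any position inside the repetition stay distinct, and the neighbourhoods of u and v are unchanged.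
  lengthen : Strings C N m (n + suc m)
  lengthen = record
    { centre  = centre
    ; colour  = colour′
    ; begins  = λ {u} {v} u≢v → trans (repeat-≤ (colour u v) m (θ u v) z≤n) (begins u≢v)
    ; reverse = λ {_} {_} {i} u≢v → reverse′ {i = i} u≢v
    ; along   = λ {_} {_} {i} u≢v → along′ {i = i} u≢v
    ; across  = λ {u} {v} {w} {i} {j} u≢v u≢w v≢w 0<i 0<j i+j≤m eq → across u≢v u≢w v≢w 0<i 0<j i+j≤m
        (trans (sym (repeat-≤ _ m _ (≤-trans (≤-trans (m≤m+n i j) i+j≤m) (m≤θ u v))))
               (trans eq (repeat-≤ _ m _ (≤-trans (≤-trans (m≤n+m j i) i+j≤m) (m≤θ u w)))))
    }

-- Layouts of the strings.

module _ {C : Set} {N : ℕ} (m p : ℕ) (A : Fin N → Fin N → ℕ → C) where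

  -- The middle point with `j` middle points before it is `p + 1 + j` away from `u`, hence
  -- `j + t + 1` away from depth `t` on its own half-edge and `2p + 1 + j ∸ t` away on another one.
  Fits : Fin N → Fin N → ℕ → C → Set
  Fits u v j c = (∀ {t} → t ≤ p → suc (j + t) ≤ m → c ≢ A u v t) ×
                 (∀ {w t} → u ≢ w → w ≢ v → t < p → suc (p + p + j) ≤ m + t → c ≢ A u w t)

-- Each edge carries 2p + 1 + r colours from branch vertex to branch vertex: A u v t is the colour at
-- distance p ∸ t from u, and Y u v j j′ is the middle colour with j middle colours before it, j′ after it.
record Layout (C : Set) (N m p r : ℕ) : Set where
  field
    m≤2p+1   : m ≤ suc (p + p)
    centre   : Fin N → C
    A        : Fin N → Fin N → ℕ → C
    Y        : Fin N → Fin N → ℕ → ℕ → C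
    A-centre : ∀ {u v} → u ≢ v → A u v p ≡ centre u
    A-own    : ∀ {u v t t′} → u ≢ v → t < t′ → t′ ≤ p → A u v t ≢ A u v t′
    A-cross  : ∀ {u v w t t′} → u ≢ v → u ≢ w → v ≢ w → t < p → t′ < p → p + p ≤ m + (t + t′) →
               A u v t ≢ A u w t′
    A-facing : ∀ {u v t t′} → u ≢ v → t ≤ p → t′ ≤ p → suc (t + t′ + r) ≤ m → A u v t ≢ A v u t′
    A-far    : ∀ {u v w t t′} → u ≢ v → u ≢ w → v ≢ w → t < p → t′ < p → suc (p + p + r + t′) ≤ m + t →
               A u v t ≢ A w u t′
    Y-fits   : ∀ {u v j j′} → u ≢ v → suc (j + j′) ≡ r →
               Fits m p A u v j (Y u v j j′) × Fits m p A v u j′ (Y u v j j′)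
    Y-own    : ∀ {u v i i′ j j′} → u ≢ v → suc (i + i′) ≡ r → suc (j + j′) ≡ r → i < j → Y u v i i′ ≢ Y u v j j′

module _ {C : Set} {N m p r : ℕ} (L : Layout C N m p r) where
  open Layout L

  private
    n : ℕ
    n = suc (p + p + r)

    -- `Y` is read from the smaller end only, so a layout need not make it symmetric.
    Y′ : Fin N → Fin N → ℕ → ℕ → C
    Y′ u v j j′ with u Fin.<? v
    ... | yes _ = Y u v j j′
    ... | no _  = Y v u j′ j

    Y′-sym : ∀ {u v} j j′ → u ≢ v → Y′ u v j j′ ≡ Y′ v u j′ j
    Y′-sym {u} {v} j j′ u≢v with u Fin.<? v | v Fin.<? u
    ... | yes u<v | yes v<u = contradiction v<u (Fin.<-asym u<v)
    ... | yes _   | no _    = refl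
    ... | no _    | yes _   = refl
    ... | no u≮v  | no v≮u  = contradiction (Fin.≤-antisym (≮⇒≥ v≮u) (≮⇒≥ u≮v)) u≢v

    Y′-fits : ∀ {u v j j′} → u ≢ v → suc (j + j′) ≡ r → Fits m p A u v j (Y′ u v j j′)
    Y′-fits {u} {v} {j} {j′} u≢v eq with u Fin.<? v
    ... | yes _ = proj₁ (Y-fits u≢v eq)
    ... | no _  = proj₂ (Y-fits (≢-sym u≢v) (trans (cong suc (+-comm j′ j)) eq))

    Y′-own : ∀ {u v i i′ j j′} → u ≢ v → suc (i + i′) ≡ r → suc (j + j′) ≡ r → i < j → Y′ u v i i′ ≢ Y′ u v j j′
    Y′-own {u} {v} {i} {i′} {j} {j′} u≢v i+i′ j+j′ i<j with u Fin.<? v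
    ... | yes _ = Y-own u≢v i+i′ j+j′ i<j
    ... | no _  = ≢-sym (Y-own (≢-sym u≢v) (trans (cong suc (+-comm j′ j)) j+j′) (trans (cong suc (+-comm i′ i)) i+i′)
      (arith 5 (λ i i′ j j′ r → con 1 ⊕ (i ⊕ i′) ≋ r ⇒ con 1 ⊕ (j ⊕ j′) ≋ r ⇒ i ≺ j ⇒ ⊢ j′ ≺ i′) i i′ j j′ r i+i′ j+j′ i<j))

    data Place (i : ℕ) : Set where
      near   : ∀ t → i + t ≡ p → Place i
      middle : ∀ j j′ → i ≡ suc (p + j) → suc (j + j′) ≡ r → Place i
      far    : ∀ t → i ≡ suc (p + r + t) → Place i

    place : ∀ i → Place i
    place i with i ≤? p | i ≤? p + r
    ... | yes i≤p | _ = near (p ∸ i) (m+[n∸m]≡n i≤p)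
    ... | no i≰p | no i≰p+r = far (i ∸ suc (p + r)) (sym (m+[n∸m]≡n (≰⇒> i≰p+r)))
    ... | no i≰p | yes i≤p+r = middle (i ∸ suc p) (p + r ∸ i) (sym (m+[n∸m]≡n (≰⇒> i≰p)))
      (arith 5 (λ i j j′ p r → con 1 ⊕ p ⊕ j ≋ i ⇒ i ⊕ j′ ≋ p ⊕ r ⇒ ⊢ con 1 ⊕ (j ⊕ j′) ≋ r)
        i (i ∸ suc p) (p + r ∸ i) p r (m+[n∸m]≡n (≰⇒> i≰p)) (m+[n∸m]≡n i≤p+r))

    value : ∀ {i} → Fin N → Fin N → Place i → C
    value u v (near t _)        = A u v t
    value u v (middle j j′ _ _) = Y′ u v j j′
    value u v (far t _)         = A v u t

    value-reverse : ∀ {u v i j} (a : Place i) (b : Place j) → u ≢ v → i + j ≡ n → value u v a ≡ value v u b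
    value-reverse {u} {v} {i} {j} (near t i+t) (far t′ j≡) u≢v i+j = cong (A u v)
      (arith 6 (λ i j t t′ p r → i ⊕ t ≋ p ⇒ j ≋ con 1 ⊕ (p ⊕ r ⊕ t′) ⇒ i ⊕ j ≋ con 1 ⊕ (p ⊕ p ⊕ r) ⇒ ⊢ t ≋ t′)
        i j t t′ p r i+t j≡ i+j)
    value-reverse {u} {v} {i} {j} (far t i≡) (near t′ j+t′) u≢v i+j = cong (A v u)
      (arith 6 (λ i j t t′ p r → i ⊕ t ≋ p ⇒ j ≋ con 1 ⊕ (p ⊕ r ⊕ t′) ⇒ i ⊕ j ≋ con 1 ⊕ (p ⊕ p ⊕ r) ⇒ ⊢ t′ ≋ t)
        j i t′ t p r j+t′ i≡ (trans (+-comm j i) i+j))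
    value-reverse {u} {v} {i} {j} (middle a a′ i≡ a+a′) (middle b b′ j≡ b+b′) u≢v i+j =
      trans (Y′-sym a a′ u≢v) (cong₂ (Y′ v u)
        (arith 8 (λ i j a a′ b b′ p r → i ≋ con 1 ⊕ (p ⊕ a) ⇒ j ≋ con 1 ⊕ (p ⊕ b) ⇒ con 1 ⊕ (a ⊕ a′) ≋ r ⇒ con 1 ⊕ (b ⊕ b′) ≋ r ⇒
                    i ⊕ j ≋ con 1 ⊕ (p ⊕ p ⊕ r) ⇒ ⊢ a′ ≋ b) i j a a′ b b′ p r i≡ j≡ a+a′ b+b′ i+j)
        (arith 8 (λ i j a a′ b b′ p r → i ≋ con 1 ⊕ (p ⊕ a) ⇒ j ≋ con 1 ⊕ (p ⊕ b) ⇒ con 1 ⊕ (a ⊕ a′) ≋ r ⇒ con 1 ⊕ (b ⊕ b′) ≋ r ⇒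
                    i ⊕ j ≋ con 1 ⊕ (p ⊕ p ⊕ r) ⇒ ⊢ a ≋ b′) i j a a′ b b′ p r i≡ j≡ a+a′ b+b′ i+j))
    value-reverse {i = i} {j} (near t i+t) (near t′ j+t′) u≢v i+j = ⊥-elim
      (arith 6 (λ i j t t′ p r → i ⊕ t ≋ p ⇒ j ⊕ t′ ≋ p ⇒ i ⊕ j ≋ con 1 ⊕ (p ⊕ p ⊕ r) ⇒ ⊢⊥) i j t t′ p r i+t j+t′ i+j)
    value-reverse {i = i} {j} (near t i+t) (middle b b′ j≡ b+b′) u≢v i+j = ⊥-elim
      (arith 7 (λ i j t b b′ p r → i ⊕ t ≋ p ⇒ j ≋ con 1 ⊕ (p ⊕ b) ⇒ con 1 ⊕ (b ⊕ b′) ≋ r ⇒ i ⊕ j ≋ con 1 ⊕ (p ⊕ p ⊕ r) ⇒ ⊢⊥)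
        i j t b b′ p r i+t j≡ b+b′ i+j)
    value-reverse {i = i} {j} (middle b b′ i≡ b+b′) (near t j+t) u≢v i+j = ⊥-elim
      (arith 7 (λ i j t b b′ p r → i ⊕ t ≋ p ⇒ j ≋ con 1 ⊕ (p ⊕ b) ⇒ con 1 ⊕ (b ⊕ b′) ≋ r ⇒ j ⊕ i ≋ con 1 ⊕ (p ⊕ p ⊕ r) ⇒ ⊢⊥)
        j i t b b′ p r j+t i≡ b+b′ i+j)
    value-reverse {i = i} {j} (middle b b′ i≡ b+b′) (far t j≡) u≢v i+j = ⊥-elim
      (arith 7 (λ i j t b b′ p r → i ≋ con 1 ⊕ (p ⊕ b) ⇒ j ≋ con 1 ⊕ (p ⊕ r ⊕ t) ⇒ i ⊕ j ≋ con 1 ⊕ (p ⊕ p ⊕ r) ⇒ ⊢⊥)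
        i j t b b′ p r i≡ j≡ i+j)
    value-reverse {i = i} {j} (far t i≡) (middle b b′ j≡ b+b′) u≢v i+j = ⊥-elim
      (arith 7 (λ i j t b b′ p r → i ≋ con 1 ⊕ (p ⊕ b) ⇒ j ≋ con 1 ⊕ (p ⊕ r ⊕ t) ⇒ j ⊕ i ≋ con 1 ⊕ (p ⊕ p ⊕ r) ⇒ ⊢⊥)
        j i t b b′ p r j≡ i≡ i+j)
    value-reverse {i = i} {j} (far t i≡) (far t′ j≡) u≢v i+j = ⊥-elim
      (arith 6 (λ i j t t′ p r → i ≋ con 1 ⊕ (p ⊕ r ⊕ t) ⇒ j ≋ con 1 ⊕ (p ⊕ r ⊕ t′) ⇒ i ⊕ j ≋ con 1 ⊕ (p ⊕ p ⊕ r) ⇒ ⊢⊥)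
        i j t t′ p r i≡ j≡ i+j)

    value-along : ∀ {u v i j} (a : Place i) (b : Place j) → u ≢ v → i < j → j ≤ n → j ≤ m + i → value u v a ≢ value u v b
    value-along {i = i} {j} (near t i+t) (near t′ j+t′) u≢v i<j j≤n j≤m+i = ≢-sym (A-own u≢v
      (arith 5 (λ i j t t′ p → i ⊕ t ≋ p ⇒ j ⊕ t′ ≋ p ⇒ i ≺ j ⇒ ⊢ t′ ≺ t) i j t t′ p i+t j+t′ i<j)
      (m+n≤o⇒n≤o i (≤-reflexive i+t)))
    value-along {i = i} {j} (near t i+t) (middle b b′ j≡ b+b′) u≢v i<j j≤n j≤m+i = ≢-sym (proj₁ (Y′-fits u≢v b+b′)
      (m+n≤o⇒n≤o i (≤-reflexive i+t))
      (arith 6 (λ i j t b p m → i ⊕ t ≋ p ⇒ j ≋ con 1 ⊕ (p ⊕ b) ⇒ j ≼ m ⊕ i ⇒ ⊢ con 1 ⊕ (b ⊕ t) ≼ m) i j t b p m i+t j≡ j≤m+i))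
    value-along {i = i} {j} (near t i+t) (far t′ j≡) u≢v i<j j≤n j≤m+i = A-facing u≢v (m+n≤o⇒n≤o i (≤-reflexive i+t))
      (arith 4 (λ j t p r → j ≋ con 1 ⊕ (p ⊕ r ⊕ t) ⇒ j ≼ con 1 ⊕ (p ⊕ p ⊕ r) ⇒ ⊢ t ≼ p) j t′ p r j≡ j≤n)
      (arith 7 (λ i j t t′ p m r → i ⊕ t ≋ p ⇒ j ≋ con 1 ⊕ (p ⊕ r ⊕ t′) ⇒ j ≼ m ⊕ i ⇒ ⊢ con 1 ⊕ (t ⊕ t′ ⊕ r) ≼ m)
        i j t t′ p m r i+t j≡ j≤m+i)
    value-along {i = i} {j} (middle a a′ i≡ a+a′) (near t j+t) u≢v i<j j≤n j≤m+i = ⊥-elim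
      (arith 5 (λ i j t a p → i ≋ con 1 ⊕ (p ⊕ a) ⇒ j ⊕ t ≋ p ⇒ i ≺ j ⇒ ⊢⊥) i j t a p i≡ j+t i<j)
    value-along {i = i} {j} (middle a a′ i≡ a+a′) (middle b b′ j≡ b+b′) u≢v i<j j≤n j≤m+i = Y′-own u≢v a+a′ b+b′
      (arith 5 (λ i j a b p → i ≋ con 1 ⊕ (p ⊕ a) ⇒ j ≋ con 1 ⊕ (p ⊕ b) ⇒ i ≺ j ⇒ ⊢ a ≺ b) i j a b p i≡ j≡ i<j)
    value-along {u} {v} {i} {j} (middle a a′ i≡ a+a′) (far t j≡) u≢v i<j j≤n j≤m+i eq =
      proj₁ (Y′-fits (≢-sym u≢v) (trans (cong suc (+-comm a′ a)) a+a′))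
        (arith 4 (λ j t p r → j ≋ con 1 ⊕ (p ⊕ r ⊕ t) ⇒ j ≼ con 1 ⊕ (p ⊕ p ⊕ r) ⇒ ⊢ t ≼ p) j t p r j≡ j≤n)
        (arith 8 (λ i j a a′ t p m r → i ≋ con 1 ⊕ (p ⊕ a) ⇒ con 1 ⊕ (a ⊕ a′) ≋ r ⇒ j ≋ con 1 ⊕ (p ⊕ r ⊕ t) ⇒ j ≼ m ⊕ i ⇒
          ⊢ con 1 ⊕ (a′ ⊕ t) ≼ m) i j a a′ t p m r i≡ a+a′ j≡ j≤m+i)
        (trans (Y′-sym a′ a (≢-sym u≢v)) eq)
    value-along {i = i} {j} (far t i≡) (near t′ j+t′) u≢v i<j j≤n j≤m+i = ⊥-elim
      (arith 6 (λ i j t t′ p r → i ≋ con 1 ⊕ (p ⊕ r ⊕ t) ⇒ j ⊕ t′ ≋ p ⇒ i ≺ j ⇒ ⊢⊥) i j t t′ p r i≡ j+t′ i<j)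
    value-along {i = i} {j} (far t i≡) (middle b b′ j≡ b+b′) u≢v i<j j≤n j≤m+i = ⊥-elim
      (arith 7 (λ i j t b b′ p r → i ≋ con 1 ⊕ (p ⊕ r ⊕ t) ⇒ j ≋ con 1 ⊕ (p ⊕ b) ⇒ con 1 ⊕ (b ⊕ b′) ≋ r ⇒ i ≺ j ⇒ ⊢⊥)
        i j t b b′ p r i≡ j≡ b+b′ i<j)
    value-along {i = i} {j} (far t i≡) (far t′ j≡) u≢v i<j j≤n j≤m+i = A-own (≢-sym u≢v)
      (arith 6 (λ i j t t′ p r → i ≋ con 1 ⊕ (p ⊕ r ⊕ t) ⇒ j ≋ con 1 ⊕ (p ⊕ r ⊕ t′) ⇒ i ≺ j ⇒ ⊢ t ≺ t′) i j t t′ p r i≡ j≡ i<j)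
      (arith 4 (λ j t p r → j ≋ con 1 ⊕ (p ⊕ r ⊕ t) ⇒ j ≼ con 1 ⊕ (p ⊕ p ⊕ r) ⇒ ⊢ t ≼ p) j t′ p r j≡ j≤n)

    -- Leaving the near part on both sides of a branch vertex takes at least `2p + 2 > m` steps.
    too-far : ∀ {i j} → p ≤ i → p ≤ j → suc i + suc j ≤ m → ⊥
    too-far {i} {j} p≤i p≤j i+j = arith 4 (λ i j m p → p ≼ i ⇒ p ≼ j ⇒ con 1 ⊕ i ⊕ (con 1 ⊕ j) ≼ m ⇒ m ≼ con 1 ⊕ (p ⊕ p) ⇒ ⊢⊥)
      i j m p p≤i p≤j i+j m≤2p+1

    value-across : ∀ {u v w i j} (a : Place i) (b : Place j) → u ≢ v → u ≢ w → v ≢ w → 0 < i → 0 < j → i + j ≤ m →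
                   value u v a ≢ value u w b
    value-across {i = i} {j} (near t i+t) (near t′ j+t′) u≢v u≢w v≢w 0<i 0<j i+j = A-cross u≢v u≢w v≢w
      (arith 3 (λ i t p → i ⊕ t ≋ p ⇒ con 0 ≺ i ⇒ ⊢ t ≺ p) i t p i+t 0<i)
      (arith 3 (λ i t p → i ⊕ t ≋ p ⇒ con 0 ≺ i ⇒ ⊢ t ≺ p) j t′ p j+t′ 0<j)
      (arith 6 (λ i j t t′ p m → i ⊕ t ≋ p ⇒ j ⊕ t′ ≋ p ⇒ i ⊕ j ≼ m ⇒ ⊢ p ⊕ p ≼ m ⊕ (t ⊕ t′)) i j t t′ p m i+t j+t′ i+j)
    value-across {i = i} {j} (near t i+t) (middle b b′ j≡ b+b′) u≢v u≢w v≢w 0<i 0<j i+j = ≢-sym (proj₂ (Y′-fits u≢w b+b′) u≢v v≢w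
      (arith 3 (λ i t p → i ⊕ t ≋ p ⇒ con 0 ≺ i ⇒ ⊢ t ≺ p) i t p i+t 0<i)
      (arith 6 (λ i j t b p m → i ⊕ t ≋ p ⇒ j ≋ con 1 ⊕ (p ⊕ b) ⇒ i ⊕ j ≼ m ⇒ ⊢ con 1 ⊕ (p ⊕ p ⊕ b) ≼ m ⊕ t) i j t b p m i+t j≡ i+j))
    value-across {i = i} {j} (near t i+t) (far t′ j≡) u≢v u≢w v≢w 0<i 0<j i+j = A-far u≢v u≢w v≢w
      (arith 3 (λ i t p → i ⊕ t ≋ p ⇒ con 0 ≺ i ⇒ ⊢ t ≺ p) i t p i+t 0<i)
      (arith 6 (λ i j t p m r → j ≋ con 1 ⊕ (p ⊕ r ⊕ t) ⇒ i ⊕ j ≼ m ⇒ con 0 ≺ i ⇒ m ≼ con 1 ⊕ (p ⊕ p) ⇒ ⊢ t ≺ p)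
        i j t′ p m r j≡ i+j 0<i m≤2p+1)
      (arith 7 (λ i j t t′ p m r → i ⊕ t ≋ p ⇒ j ≋ con 1 ⊕ (p ⊕ r ⊕ t′) ⇒ i ⊕ j ≼ m ⇒ ⊢ con 1 ⊕ (p ⊕ p ⊕ r ⊕ t′) ≼ m ⊕ t)
        i j t t′ p m r i+t j≡ i+j)
    value-across {i = i} {j} a@(middle _ _ _ _) b@(near _ _) u≢v u≢w v≢w 0<i 0<j i+j =
      ≢-sym (value-across b a u≢w u≢v (≢-sym v≢w) 0<j 0<i (≤-trans (≤-reflexive (+-comm j i)) i+j))
    value-across {i = i} {j} a@(far _ _) b@(near _ _) u≢v u≢w v≢w 0<i 0<j i+j =
      ≢-sym (value-across b a u≢w u≢v (≢-sym v≢w) 0<j 0<i (≤-trans (≤-reflexive (+-comm j i)) i+j))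
    value-across (middle a _ refl _) (middle b _ refl _) u≢v u≢w v≢w 0<i 0<j i+j = ⊥-elim (too-far (m≤m+n p a) (m≤m+n p b) i+j)
    value-across (middle a _ refl _) (far t refl) u≢v u≢w v≢w 0<i 0<j i+j = ⊥-elim (too-far (m≤m+n p a) (m≤n⇒m≤n+o t (m≤m+n p r)) i+j)
    value-across (far t refl) (middle a _ refl _) u≢v u≢w v≢w 0<i 0<j i+j = ⊥-elim (too-far (m≤n⇒m≤n+o t (m≤m+n p r)) (m≤m+n p a) i+j)
    value-across (far t refl) (far t′ refl) u≢v u≢w v≢w 0<i 0<j i+j = ⊥-elim (too-far (m≤n⇒m≤n+o t (m≤m+n p r)) (m≤n⇒m≤n+o t′ (m≤m+n p r)) i+j)

  strings : Strings C N m (suc (p + p + r))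
  strings = record
    { centre  = centre
    ; colour  = λ u v i → value u v (place i)
    ; begins  = λ u≢v → trans (value-start (place 0)) (A-centre u≢v)
    ; reverse = λ {_} {_} {i} {j} → value-reverse (place i) (place j)
    ; along   = λ {_} {_} {i} {j} → value-along (place i) (place j)
    ; across  = λ {_} {_} {_} {i} {j} → value-across (place i) (place j)
    }
    where
    value-start : ∀ {u v} (a : Place 0) → value u v a ≡ A u v p
    value-start (near t refl) = refl
    value-start (middle _ _ () _)
    value-start (far _ ())

-- Layers, and the layouts built from them.

module _ {C : Set} {N : ℕ} (K : ℕ) (a : Fin N → Fin N → ℕ → C) where

  -- This is `Fits` for `m = 2p`, where the condition at other half-edges shrinks to `j < t`; the
  -- colours of the own half-edge are avoided at every distance.
  Free : Fin N → Fin N → ℕ → C → Set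
  Free u v j c = (∀ {t} → t ≤ K → c ≢ a u v t) × (∀ {w t} → u ≢ w → w ≢ v → t < K → j < t → c ≢ a u w t)

-- The part of a layout that uses K colours of every half-edge, at depths 0, …, K ∸ 1, and the centre.
record Layers (C : Set) (N K r B : ℕ) : Set where
  field
    centre   : C
    a        : Fin N → Fin N → ℕ → C
    y        : Fin N → Fin N → ℕ → ℕ → C
    a-centre : ∀ u v → a u v K ≡ centre
    a-own    : ∀ {u v t t′} → u ≢ v → t < t′ → t′ ≤ K → a u v t ≢ a u v t′
    a-cross  : ∀ {u v w t t′} → u ≢ v → u ≢ w → v ≢ w → t < K → t′ < K → a u v t ≢ a u w t′
    a-facing : ∀ {u v t t′} → u ≢ v → t < K → t′ ≤ K → suc (t + t′ + r) ≤ B → a u v t ≢ a v u t′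
    a-far    : ∀ {u v w t t′} → u ≢ v → u ≢ w → v ≢ w → t < K → t′ < K → suc (r + t′) ≤ t → a u v t ≢ a w u t′
    y-free   : ∀ {u v j j′} → u ≢ v → suc (j + j′) ≡ r → Free K a u v j (y u v j j′) × Free K a v u j′ (y u v j j′)
    y-own    : ∀ {u v i i′ j j′} → u ≢ v → suc (i + i′) ≡ r → suc (j + j′) ≡ r → i < j → y u v i i′ ≢ y u v j j′

even-layout : ∀ {C N k r} → Layers C N k r (k + k) → Layout C N (k + k) k r
even-layout {k = k} {r} L = record
  { m≤2p+1   = n≤1+n (k + k)
  ; centre   = λ _ → centre
  ; A        = a
  ; Y        = y
  ; A-centre = λ {u} {v} _ → a-centre u v
  ; A-own    = a-own
  ; A-cross  = λ u≢v u≢w v≢w t<k t′<k _ → a-cross u≢v u≢w v≢w t<k t′<k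
  ; A-facing = facing
  ; A-far    = λ {t = t} {t′} u≢v u≢w v≢w t<k t′<k far → a-far u≢v u≢w v≢w t<k t′<k
      (arith 4 (λ k r t t′ → con 1 ⊕ (k ⊕ k ⊕ r ⊕ t′) ≼ k ⊕ k ⊕ t ⇒ ⊢ con 1 ⊕ (r ⊕ t′) ≼ t) k r t t′ far)
  ; Y-fits   = λ u≢v eq → fits (proj₁ (y-free u≢v eq)) , fits (proj₂ (y-free u≢v eq))
  ; Y-own    = y-own
  }
  where
  open Layers L
  facing : ∀ {u v t t′} → u ≢ v → t ≤ k → t′ ≤ k → suc (t + t′ + r) ≤ k + k → a u v t ≢ a v u t′
  facing {t = t} {t′} u≢v t≤k t′≤k close with m≤n⇒m<n∨m≡n t≤k | m≤n⇒m<n∨m≡n t′≤k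
  ... | inj₁ t<k  | _         = a-facing u≢v t<k t′≤k close
  ... | inj₂ _    | inj₁ t′<k = ≢-sym (a-facing (≢-sym u≢v) t′<k t≤k (subst (λ s → suc (s + r) ≤ k + k) (+-comm t t′) close))
  -- Both points are branch vertices: they share the centre colour and are `n > m` apart.
  ... | inj₂ refl | inj₂ refl = contradiction close (<⇒≱ (s≤s (m≤m+n (k + k) r)))
  fits : ∀ {u v j c} → Free k a u v j c → Fits (k + k) k a u v j c
  fits {j = j} (own , cross) = (λ t≤k _ → own t≤k) , λ {w} {t} u≢w w≢v t<k close → cross u≢w w≢v t<k
    (arith 3 (λ j k t → con 1 ⊕ (k ⊕ k ⊕ j) ≼ k ⊕ k ⊕ t ⇒ ⊢ j ≺ t) j k t close)

-- Here `n = m + 1`, and every edge has a single middle point. Two of these are at least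
-- `2k + 2 > m` apart, so one colour, missing around every vertex, serves them all.
tight-odd-layout : ∀ {C N k} → Layers C N k 0 (k + k) → Layout (Maybe C) N (suc (k + k)) k 1
tight-odd-layout {k = k} L = record
  { m≤2p+1   = ≤-refl
  ; centre   = λ _ → just centre
  ; A        = λ u v t → just (a u v t)
  ; Y        = λ _ _ _ _ → nothing
  ; A-centre = λ {u} {v} _ → cong just (a-centre u v)
  ; A-own    = λ u≢v t<t′ t′≤k → a-own u≢v t<t′ t′≤k ∘ just-injective
  ; A-cross  = λ u≢v u≢w v≢w t<k t′<k _ → a-cross u≢v u≢w v≢w t<k t′<k ∘ just-injective
  ; A-facing = λ u≢v t≤k t′≤k close → facing u≢v t≤k t′≤k close ∘ just-injective
  ; A-far    = λ {t = t} {t′} u≢v u≢w v≢w t<k t′<k far → a-far u≢v u≢w v≢w t<k t′<k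
      (arith 3 (λ k t t′ → con 1 ⊕ (k ⊕ k ⊕ con 1 ⊕ t′) ≼ con 1 ⊕ (k ⊕ k) ⊕ t ⇒ ⊢ con 1 ⊕ t′ ≼ t) k t t′ far) ∘ just-injective
  ; Y-fits   = λ _ _ → ((λ _ _ ()) , λ _ _ _ _ ()) , ((λ _ _ ()) , λ _ _ _ _ ())
  ; Y-own    = λ {i = i} {i′} {j} {j′} _ _ eq i<j _ →
      arith 3 (λ i j j′ → con 1 ⊕ (j ⊕ j′) ≋ con 1 ⇒ i ≺ j ⇒ ⊢⊥) i j j′ eq i<j
  }
  where
  open Layers L
  facing : ∀ {u v t t′} → u ≢ v → t ≤ k → t′ ≤ k → suc (t + t′ + 1) ≤ suc (k + k) → a u v t ≢ a v u t′
  facing {t = t} {t′} u≢v t≤k t′≤k close with m≤n⇒m<n∨m≡n t≤k | m≤n⇒m<n∨m≡n t′≤k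
  ... | inj₁ t<k  | _         = a-facing u≢v t<k t′≤k
    (arith 3 (λ k t t′ → con 1 ⊕ (t ⊕ t′ ⊕ con 1) ≼ con 1 ⊕ (k ⊕ k) ⇒ ⊢ con 1 ⊕ (t ⊕ t′ ⊕ con 0) ≼ k ⊕ k) k t t′ close)
  ... | inj₂ _    | inj₁ t′<k = ≢-sym (a-facing (≢-sym u≢v) t′<k t≤k
    (arith 3 (λ k t t′ → con 1 ⊕ (t ⊕ t′ ⊕ con 1) ≼ con 1 ⊕ (k ⊕ k) ⇒ ⊢ con 1 ⊕ (t′ ⊕ t ⊕ con 0) ≼ k ⊕ k) k t t′ close))
  ... | inj₂ refl | inj₂ refl = ⊥-elim (arith 1 (λ k → con 1 ⊕ (k ⊕ k ⊕ con 1) ≼ con 1 ⊕ (k ⊕ k) ⇒ ⊢⊥) k close)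

-- `P u v` is the vertex whose colour is put on the half-edge from `u` to `v`, so a row lists all
-- vertices but `u`. It must not be `v` there, since the opposite half-edge has the colour `v` at
-- its outer end.
record Twist (N : ℕ) : Set where
  field
    P       : Fin N → Fin N → Fin N
    P≢u     : ∀ {u v} → u ≢ v → P u v ≢ u
    P≢v     : ∀ {u v} → u ≢ v → P u v ≢ v
    P-row   : ∀ {u v w} → u ≢ v → u ≢ w → v ≢ w → P u v ≢ P u w
    P-anti  : ∀ {u v} → u ≢ v → P u v ≢ P v u

-- For odd m the colour missing around u is shared by all vertices at depth 0; it reappears around the
-- other vertices at depth e + 1, between layers e ∸ 1 and e of the given system.
module _ {C : Set} {N K r : ℕ} (L : Layers C N K r (suc (K + K))) (twist : Twist N)
         (e : ℕ) (e≤r : e ≤ r) (e≤K : e ≤ K) (below : ∀ {t} → e ≤ t → t < K → r ≤ t) where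
  open Layers L
  open Twist twist

  private
    p m : ℕ
    p = suc (suc K)
    m = suc K + suc (suc K)

    shift : ℕ → ℕ
    shift t with t <? e
    ... | yes _ = suc t
    ... | no _  = suc (suc t)

    shift-≥ : ∀ {s} t → s ≡ shift t → suc t ≤ s
    shift-≥ t refl with t <? e
    ... | yes _ = ≤-refl
    ... | no _  = n≤1+n (suc t)

    shift-above : ∀ {t} → e ≤ t → shift t ≡ suc (suc t)
    shift-above {t} e≤t with t <? e
    ... | yes t<e = contradiction e≤t (<⇒≱ t<e)
    ... | no _    = refl

    shift-≤ : ∀ t → shift t ≤ suc (suc t)
    shift-≤ t with t <? e
    ... | yes _ = n≤1+n (suc t)
    ... | no _  = ≤-refl

    shift-≤⁻¹ : ∀ {t s} → e ≤ s → shift t ≤ suc (suc s) → t ≤ s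
    shift-≤⁻¹ {t} e≤s le with t <? e
    ... | yes t<e = ≤-trans (<⇒≤ t<e) e≤s
    ... | no _    = s≤s⁻¹ (s≤s⁻¹ le)

    -- Layers from `e` on move by two depths, which alone gives only `j ≤ t`; there `below` supplies
    -- `j < r ≤ t`.
    shift-clears : ∀ {t j} → t < K → j < r → suc (suc j) ≤ shift t → j < t
    shift-clears {t} t<K j<r le with t <? e
    ... | yes _  = s≤s⁻¹ le
    ... | no t≮e = <-≤-trans j<r (below (≮⇒≥ t≮e) t<K)

    data Slot (t : ℕ) : Set where
      missing : t ≡ 0 → Slot t
      twisted : t ≡ suc e → Slot t
      layer   : ∀ s → t ≡ shift s → Slot t

    slot : ∀ t → Slot t
    slot zero = missing refl
    slot (suc t) with <-cmp t e
    ... | tri< t<e _ _ = layer t (sym lower)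
      where
      lower : shift t ≡ suc t
      lower with t <? e
      ... | yes _  = refl
      ... | no t≮e = contradiction t<e t≮e
    ... | tri≈ _ t≡e _ = twisted (cong suc t≡e)
    ... | tri> _ _ (s≤s {n = s} e≤s) = layer s (sym (shift-above e≤s))

    value : ∀ {t} → Fin N → Fin N → Slot t → Fin N ⊎ C
    value u v (missing _) = inj₁ u
    value u v (twisted _) = inj₁ (P u v)
    value u v (layer s _) = inj₂ (a u v s)

    value-centre : ∀ {u v} (x : Slot p) → value u v x ≡ inj₂ centre
    value-centre (twisted eq) = contradiction (suc-injective eq) (≢-sym (<⇒≢ (s≤s e≤K)))
    value-centre {u} {v} (layer s eq) = cong inj₂ (trans (cong (a u v) (≤-antisym (shift-≤⁻¹ e≤K (≤-reflexive (sym eq)))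
      (s≤s⁻¹ (s≤s⁻¹ (≤-trans (≤-reflexive eq) (shift-≤ s)))))) (a-centre u v))

    layer-≤ : ∀ {t s} → t ≡ shift s → t ≤ p → s ≤ K
    layer-≤ refl = shift-≤⁻¹ e≤K

    layer-< : ∀ {t s} → t ≡ shift s → t < p → s < K
    layer-< {s = s} refl t<p with m≤n⇒m<n∨m≡n (shift-≤⁻¹ e≤K (<⇒≤ t<p))
    ... | inj₁ s<K  = s<K
    ... | inj₂ refl = contradiction t<p (≤⇒≯ (≤-reflexive (sym (shift-above e≤K))))

    value-own : ∀ {u v t t′} (x : Slot t) (x′ : Slot t′) → u ≢ v → t < t′ → t′ ≤ p → value u v x ≢ value u v x′
    value-own (missing refl) (missing refl) u≢v () _
    value-own (missing _) (twisted _) u≢v _ _ = ≢-sym (P≢u u≢v) ∘ inj₁-injective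
    value-own (missing _) (layer _ _) _ _ _ ()
    value-own (twisted _) (missing refl) u≢v () _
    value-own (twisted refl) (twisted refl) u≢v t<t′ _ = contradiction t<t′ (<-irrefl refl)
    value-own (twisted _) (layer _ _) _ _ _ ()
    value-own (layer _ _) (missing _) _ _ _ ()
    value-own (layer _ _) (twisted _) _ _ _ ()
    value-own (layer s refl) (layer s′ refl) u≢v t<t′ t′≤p eq with <-cmp s s′
    ... | tri< s<s′ _ _ = a-own u≢v s<s′ (layer-≤ refl t′≤p) (inj₂-injective eq)
    ... | tri≈ _ refl _ = <-irrefl refl t<t′
    ... | tri> _ _ s′<s = a-own u≢v s′<s (layer-≤ refl (≤-trans (<⇒≤ t<t′) t′≤p)) (sym (inj₂-injective eq))

    value-cross : ∀ {u v w t t′} (x : Slot t) (x′ : Slot t′) → u ≢ v → u ≢ w → v ≢ w → t < p → t′ < p →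
                  p + p ≤ m + (t + t′) → value u v x ≢ value u w x′
    value-cross (missing refl) (missing refl) u≢v u≢w v≢w _ _ le =
      ⊥-elim (arith 1 (λ K → con 2 ⊕ K ⊕ (con 2 ⊕ K) ≼ con 1 ⊕ K ⊕ (con 2 ⊕ K) ⊕ con 0 ⇒ ⊢⊥) K le)
    value-cross (missing _) (twisted _) u≢v u≢w v≢w _ _ _ = ≢-sym (P≢u u≢w) ∘ inj₁-injective
    value-cross (missing _) (layer _ _) _ _ _ _ _ _ ()
    value-cross (twisted _) (missing _) u≢v u≢w v≢w _ _ _ = P≢u u≢v ∘ inj₁-injective
    value-cross (twisted _) (twisted _) u≢v u≢w v≢w _ _ _ = P-row u≢v u≢w v≢w ∘ inj₁-injective
    value-cross (twisted _) (layer _ _) _ _ _ _ _ _ ()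
    value-cross (layer _ _) (missing _) _ _ _ _ _ _ ()
    value-cross (layer _ _) (twisted _) _ _ _ _ _ _ ()
    value-cross (layer s eq) (layer s′ eq′) u≢v u≢w v≢w t<p t′<p _ =
      a-cross u≢v u≢w v≢w (layer-< eq t<p) (layer-< eq′ t′<p) ∘ inj₂-injective

    value-facing : ∀ {u v t t′} (x : Slot t) (x′ : Slot t′) → u ≢ v → t ≤ p → t′ ≤ p → suc (t + t′ + r) ≤ m →
                   value u v x ≢ value v u x′
    value-facing (missing _) (missing _) u≢v _ _ _ = u≢v ∘ inj₁-injective
    value-facing (missing _) (twisted _) u≢v _ _ _ = ≢-sym (P≢v (≢-sym u≢v)) ∘ inj₁-injective
    value-facing (missing _) (layer _ _) _ _ _ _ ()
    value-facing (twisted _) (missing _) u≢v _ _ _ = P≢v u≢v ∘ inj₁-injective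
    value-facing (twisted _) (twisted _) u≢v _ _ _ = P-anti u≢v ∘ inj₁-injective
    value-facing (twisted _) (layer _ _) _ _ _ _ ()
    value-facing (layer _ _) (missing _) _ _ _ _ ()
    value-facing (layer _ _) (twisted _) _ _ _ _ ()
    value-facing {t = t} {t′} (layer s eq) (layer s′ eq′) u≢v t≤p t′≤p close
      with m≤n⇒m<n∨m≡n (layer-≤ eq t≤p) | m≤n⇒m<n∨m≡n (layer-≤ eq′ t′≤p)
    ... | inj₁ s<K | _ = a-facing u≢v s<K (layer-≤ eq′ t′≤p)
      (arith 6 (λ t t′ s s′ r K → con 1 ⊕ s ≼ t ⇒ con 1 ⊕ s′ ≼ t′ ⇒ con 1 ⊕ (t ⊕ t′ ⊕ r) ≼ con 1 ⊕ K ⊕ (con 2 ⊕ K) ⇒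
        ⊢ con 1 ⊕ (s ⊕ s′ ⊕ r) ≼ con 1 ⊕ (K ⊕ K)) t t′ s s′ r K (shift-≥ s eq) (shift-≥ s′ eq′) close) ∘ inj₂-injective
    ... | inj₂ _ | inj₁ s′<K = ≢-sym (a-facing (≢-sym u≢v) s′<K (layer-≤ eq t≤p)
      (arith 6 (λ t t′ s s′ r K → con 1 ⊕ s ≼ t ⇒ con 1 ⊕ s′ ≼ t′ ⇒ con 1 ⊕ (t ⊕ t′ ⊕ r) ≼ con 1 ⊕ K ⊕ (con 2 ⊕ K) ⇒
        ⊢ con 1 ⊕ (s′ ⊕ s ⊕ r) ≼ con 1 ⊕ (K ⊕ K)) t t′ s s′ r K (shift-≥ s eq) (shift-≥ s′ eq′) close)) ∘ inj₂-injective
    ... | inj₂ refl | inj₂ refl = ⊥-elim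
      (arith 4 (λ t t′ r K → t ≋ con 2 ⊕ K ⇒ t′ ≋ con 2 ⊕ K ⇒ con 1 ⊕ (t ⊕ t′ ⊕ r) ≼ con 1 ⊕ K ⊕ (con 2 ⊕ K) ⇒ ⊢⊥)
        t t′ r K (trans eq (shift-above e≤K)) (trans eq′ (shift-above e≤K)) close)

    value-far : ∀ {u v w t t′} (x : Slot t) (x′ : Slot t′) → u ≢ v → u ≢ w → v ≢ w → t < p → t′ < p →
                suc (p + p + r + t′) ≤ m + t → value u v x ≢ value w u x′
    value-far {t′ = t′} (missing refl) _ u≢v u≢w v≢w _ _ far = ⊥-elim
      (arith 3 (λ K r t′ → con 1 ⊕ (con 2 ⊕ K ⊕ (con 2 ⊕ K) ⊕ r ⊕ t′) ≼ con 1 ⊕ K ⊕ (con 2 ⊕ K) ⊕ con 0 ⇒ ⊢⊥) K r t′ far)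
    -- A conflict would need `r + t′ + 2 ≤ e + 1`, so `e ≤ r` keeps the vertex colours far enough
    -- out.
    value-far {t′ = t′} (twisted refl) _ u≢v u≢w v≢w _ _ far = ⊥-elim
      (arith 4 (λ K r e t′ → e ≼ r ⇒ con 1 ⊕ (con 2 ⊕ K ⊕ (con 2 ⊕ K) ⊕ r ⊕ t′) ≼ con 1 ⊕ K ⊕ (con 2 ⊕ K) ⊕ (con 1 ⊕ e) ⇒ ⊢⊥)
        K r e t′ e≤r far)
    value-far (layer _ _) (missing _) _ _ _ _ _ _ ()
    value-far (layer _ _) (twisted _) _ _ _ _ _ _ ()
    value-far {t = t} {t′} (layer s eq) (layer s′ eq′) u≢v u≢w v≢w t<p t′<p far =
      a-far u≢v u≢w v≢w (layer-< eq t<p) (layer-< eq′ t′<p)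
        (arith 6 (λ t t′ s s′ r K → t ≼ con 2 ⊕ s ⇒ con 1 ⊕ s′ ≼ t′ ⇒
            con 1 ⊕ (con 2 ⊕ K ⊕ (con 2 ⊕ K) ⊕ r ⊕ t′) ≼ con 1 ⊕ K ⊕ (con 2 ⊕ K) ⊕ t ⇒ ⊢ con 1 ⊕ (r ⊕ s′) ≼ s)
          t t′ s s′ r K (≤-trans (≤-reflexive eq) (shift-≤ s)) (shift-≥ s′ eq′) far) ∘ inj₂-injective

    value-fits : ∀ {u v j c} → j < r → Free K a u v j c → Fits m p (λ u v t → value u v (slot t)) u v j (inj₂ c)
    value-fits {u} {v} {j} {c} j<r (own , cross) = (λ {t} t≤p _ → fits-own (slot t) t≤p) , λ {w} {t} → fits-cross (slot t)
      where
      fits-own : ∀ {t} (x : Slot t) → t ≤ p → inj₂ c ≢ value u v x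
      fits-own (missing _) _ ()
      fits-own (twisted _) _ ()
      fits-own (layer s eq) t≤p = own (layer-≤ eq t≤p) ∘ inj₂-injective
      fits-cross : ∀ {w t} (x : Slot t) → u ≢ w → w ≢ v → t < p → suc (p + p + j) ≤ m + t → inj₂ c ≢ value u w x
      fits-cross (missing _) _ _ _ _ ()
      fits-cross (twisted _) _ _ _ _ ()
      fits-cross {t = t} (layer s eq) u≢w w≢v t<p close = cross u≢w w≢v (layer-< eq t<p)
        (shift-clears (layer-< eq t<p) j<r (≤-trans
          (arith 3 (λ j t K → con 1 ⊕ (con 2 ⊕ K ⊕ (con 2 ⊕ K) ⊕ j) ≼ con 1 ⊕ K ⊕ (con 2 ⊕ K) ⊕ t ⇒ ⊢ con 2 ⊕ j ≼ t) j t K close)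
          (≤-reflexive eq))) ∘ inj₂-injective

  odd-layout : Layout (Fin N ⊎ C) N (suc K + suc (suc K)) (suc (suc K)) r
  odd-layout = record
    { m≤2p+1   = arith 1 (λ K → ⊢ con 1 ⊕ K ⊕ (con 2 ⊕ K) ≼ con 1 ⊕ (con 2 ⊕ K ⊕ (con 2 ⊕ K))) K
    ; centre   = λ _ → inj₂ centre
    ; A        = λ u v t → value u v (slot t)
    ; Y        = λ u v j j′ → inj₂ (y u v j j′)
    ; A-centre = λ _ → value-centre (slot p)
    ; A-own    = λ {_} {_} {t} {t′} → value-own (slot t) (slot t′)
    ; A-cross  = λ {_} {_} {_} {t} {t′} → value-cross (slot t) (slot t′)
    ; A-facing = λ {_} {_} {t} {t′} → value-facing (slot t) (slot t′)
    ; A-far    = λ {_} {_} {_} {t} {t′} → value-far (slot t) (slot t′)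
    ; Y-fits   = λ {u} {v} {j} {j′} u≢v eq →
        value-fits (≤-trans (s≤s (m≤m+n j j′)) (≤-reflexive eq)) (proj₁ (y-free u≢v eq)) ,
        value-fits (≤-trans (s≤s (m≤n+m j′ j)) (≤-reflexive eq)) (proj₂ (y-free u≢v eq))
    ; Y-own    = λ u≢v eq eq′ i<j → y-own u≢v eq eq′ i<j ∘ inj₂-injective
    }

-- Filling the middle of an edge from both ends.

module _ {C : Set} {N : ℕ} (h : Fin N → Fin N → ℕ → C) where

  -- Each half of the middle is filled from the end closer to it; a central point, `j = j′`, is
  -- given to `u`.
  mirror : Fin N → Fin N → ℕ → ℕ → C
  mirror u v j j′ with j ≤? j′
  ... | yes _ = h u v j
  ... | no _  = h v u j′

  mirror-fits : ∀ {r : ℕ} {Q : Fin N → Fin N → ℕ → C → Set} →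
                (∀ {u v j j′} → u ≢ v → suc (j + j′) ≡ r → j ≤ j′ → Q u v j (h u v j) × Q v u j′ (h u v j)) →
                ∀ {u v j j′} → u ≢ v → suc (j + j′) ≡ r → Q u v j (mirror u v j j′) × Q v u j′ (mirror u v j j′)
  mirror-fits fits {u} {v} {j} {j′} u≢v eq with j ≤? j′
  ... | yes j≤j′ = fits u≢v eq j≤j′
  ... | no j≰j′  = let q , q′ = fits (≢-sym u≢v) (trans (cong suc (+-comm j′ j)) eq) (<⇒≤ (≰⇒> j≰j′)) in q′ , q

  mirror-own : ∀ {r : ℕ} → (∀ {u v i j} → u ≢ v → i < j → suc (j + j) ≤ r → h u v i ≢ h u v j) →
               (∀ {u v i j} → u ≢ v → suc (i + i) ≤ r → suc (j + j) ≤ r → h u v i ≢ h v u j) →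
               ∀ {u v i i′ j j′} → u ≢ v → suc (i + i′) ≡ r → suc (j + j′) ≡ r → i < j →
               mirror u v i i′ ≢ mirror u v j j′
  mirror-own {r} along opposite {u} {v} {i} {i′} {j} {j′} u≢v i+i′ j+j′ i<j with i ≤? i′ | j ≤? j′
  ... | yes _    | yes j≤j′ = along u≢v i<j (low j+j′ j≤j′)
    where
    low : ∀ {a b} → suc (a + b) ≡ r → a ≤ b → suc (a + a) ≤ r
    low {a} eq a≤b = ≤-trans (s≤s (+-monoʳ-≤ a a≤b)) (≤-reflexive eq)
  ... | yes i≤i′ | no j≰j′ = opposite u≢v
    (arith 3 (λ i i′ r → con 1 ⊕ (i ⊕ i′) ≋ r ⇒ i ≼ i′ ⇒ ⊢ con 1 ⊕ (i ⊕ i) ≼ r) i i′ r i+i′ i≤i′)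
    (arith 3 (λ j j′ r → con 1 ⊕ (j ⊕ j′) ≋ r ⇒ j′ ≺ j ⇒ ⊢ con 1 ⊕ (j′ ⊕ j′) ≼ r) j j′ r j+j′ (≰⇒> j≰j′))
  ... | no i≰i′  | yes j≤j′ = ⊥-elim
    (arith 5 (λ i i′ j j′ r → con 1 ⊕ (i ⊕ i′) ≋ r ⇒ con 1 ⊕ (j ⊕ j′) ≋ r ⇒ i ≺ j ⇒ i′ ≺ i ⇒ j ≼ j′ ⇒ ⊢⊥)
      i i′ j j′ r i+i′ j+j′ i<j (≰⇒> i≰i′) j≤j′)
  ... | no i≰i′  | no j≰j′ = ≢-sym (along (≢-sym u≢v)
    (arith 5 (λ i i′ j j′ r → con 1 ⊕ (i ⊕ i′) ≋ r ⇒ con 1 ⊕ (j ⊕ j′) ≋ r ⇒ i ≺ j ⇒ ⊢ j′ ≺ i′) i i′ j j′ r i+i′ j+j′ i<j)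
    (arith 3 (λ i i′ r → con 1 ⊕ (i ⊕ i′) ≋ r ⇒ i′ ≺ i ⇒ ⊢ con 1 ⊕ (i′ ⊕ i′) ≼ r) i i′ r i+i′ (≰⇒> i≰i′)))

-- Layers whose middle colours come from two spare rays, g u v starting at u and g v u starting at v.
record Rays (C : Set) (N K r B : ℕ) : Set where
  field
    centre   : C
    a g      : Fin N → Fin N → ℕ → C
    a-centre : ∀ u v → a u v K ≡ centre
    a-own    : ∀ {u v t t′} → u ≢ v → t < t′ → t′ ≤ K → a u v t ≢ a u v t′
    a-cross  : ∀ {u v w t t′} → u ≢ v → u ≢ w → v ≢ w → t < K → t′ < K → a u v t ≢ a u w t′
    a-facing : ∀ {u v t t′} → u ≢ v → t < K → t′ ≤ K → suc (t + t′ + r) ≤ B → a u v t ≢ a v u t′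
    a-far    : ∀ {u v w t t′} → u ≢ v → u ≢ w → v ≢ w → t < K → t′ < t → a u v t ≢ a w u t′
    g-own    : ∀ {u v j t} → u ≢ v → j < K → t ≤ K → g u v j ≢ a u v t
    g-facing : ∀ {u v j t} → u ≢ v → j < K → t ≤ K → g u v j ≢ a v u t
    g-cross  : ∀ {u v w j t} → u ≢ v → u ≢ w → w ≢ v → t < K → j < t → g u v j ≢ a u w t
    g-far    : ∀ {u v w j j′ t} → u ≢ v → u ≢ w → w ≢ v → t < K → j < t → j′ < t → r ≤ suc (j + j′) →
               g v u j′ ≢ a u w t
    g-along  : ∀ {u v j j′} → u ≢ v → j < j′ → j′ < K → g u v j ≢ g u v j′
    g-across : ∀ {u v j j′} → u ≢ v → j < K → j′ < K → g u v j ≢ g v u j′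

-- A ray covers only half of the middle, so `r ≤ 2K` keeps its indices below `K`.
rays⇒layers : ∀ {C N K r B} → r ≤ K + K → Rays C N K r B → Layers C N K r B
rays⇒layers {K = K} {r} r≤2K R = record
  { centre   = centre
  ; a        = a
  ; y        = mirror g
  ; a-centre = a-centre
  ; a-own    = a-own
  ; a-cross  = a-cross
  ; a-facing = a-facing
  ; a-far    = λ {_} {_} {_} {t} {t′} u≢v u≢w v≢w t<K _ far → a-far u≢v u≢w v≢w t<K (m+n≤o⇒n≤o r (≤-trans (≤-reflexive (+-suc r t′)) far))
  ; y-free   = mirror-fits g {Q = Free K a} λ u≢v eq j≤j′ → free u≢v eq j≤j′
  ; y-own    = mirror-own g (λ u≢v i<j 2j<r → g-along u≢v i<j (low 2j<r))
                            (λ u≢v 2i<r 2j<r → g-across u≢v (low 2i<r) (low 2j<r))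
  }
  where
  open Rays R
  low : ∀ {j} → suc (j + j) ≤ r → j < K
  low {j} 2j<r = arith 3 (λ j K r → con 1 ⊕ (j ⊕ j) ≼ r ⇒ r ≼ K ⊕ K ⇒ ⊢ j ≺ K) j K r 2j<r r≤2K
  free : ∀ {u v j j′} → u ≢ v → suc (j + j′) ≡ r → j ≤ j′ → Free K a u v j (g u v j) × Free K a v u j′ (g u v j)
  free {j = j} {j′} u≢v eq j≤j′ =
    (g-own u≢v j<K , λ u≢w w≢v t<K j<t → g-cross u≢v u≢w w≢v t<K j<t) ,
    (g-facing u≢v j<K , λ v≢w w≢u t<K j′<t → g-far (≢-sym u≢v) v≢w w≢u t<K j′<t (≤-<-trans j≤j′ j′<t)
                                                (≤-reflexive (trans (sym eq) (cong suc (+-comm j j′)))))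
    where
    j<K : j < K
    j<K = low (≤-trans (s≤s (+-monoʳ-≤ j j≤j′)) (≤-reflexive eq))

-- In `long-odd-layout` the half-edges of `uv` carry no vertex colours except `u` and `v`; a third
-- vertex colour can therefore extend a ray by one point, and the two rays of an edge need different
-- ones.
record Spare (N : ℕ) : Set where
  field
    spare      : Fin N → Fin N → Fin N
    spare≢u    : ∀ {u v} → u ≢ v → spare u v ≢ u
    spare≢v    : ∀ {u v} → u ≢ v → spare u v ≢ v
    spare-anti : ∀ {u v} → u ≢ v → spare u v ≢ spare v u

-- Around u the colour missing around v stands next to u, towards v.
module _ {C : Set} {N K r : ℕ} (R : Rays C N K r (K + K)) (K<r : K < r) (r≤2K+1 : r ≤ suc (K + K)) (S : Spare N) where
  open Rays R
  open Spare S

  private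
    p m : ℕ
    p = suc (suc K)
    m = suc K + suc (suc K)

    data Slot (t : ℕ) : Set where
      missing : t ≡ 0 → Slot t
      layer   : ∀ s → t ≡ suc s → s < K → Slot t
      last    : t ≡ suc K → Slot t
      hub     : suc K < t → Slot t

    slot : ∀ t → Slot t
    slot zero = missing refl
    slot (suc t) with <-cmp t K
    ... | tri< t<K _ _ = layer t refl t<K
    ... | tri≈ _ t≡K _ = last (cong suc t≡K)
    ... | tri> _ _ K<t = hub (s≤s K<t)

    value : ∀ {t} → Fin N → Fin N → Slot t → Fin N ⊎ C
    value u v (missing _)   = inj₁ u
    value u v (layer s _ _) = inj₂ (a u v s)
    value u v (last _)      = inj₁ v
    value u v (hub _)       = inj₂ (a u v K)

    ray : Fin N → Fin N → ℕ → Fin N ⊎ C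
    ray u v j with j <? K
    ... | yes _ = inj₂ (g u v j)
    ... | no _  = inj₁ (spare u v)

    value-own : ∀ {u v t t′} (x : Slot t) (x′ : Slot t′) → u ≢ v → t < t′ → t′ ≤ p → value u v x ≢ value u v x′
    value-own (missing refl) (missing refl) u≢v () _
    value-own (missing _) (layer _ _ _) _ _ _ ()
    value-own (missing _) (last _) u≢v _ _ = u≢v ∘ inj₁-injective
    value-own (missing _) (hub _) _ _ _ ()
    value-own (layer _ _ _) (missing _) _ _ _ ()
    value-own (layer _ refl _) (layer _ refl s′<K) u≢v t<t′ _ = a-own u≢v (s≤s⁻¹ t<t′) (<⇒≤ s′<K) ∘ inj₂-injective
    value-own (layer _ _ _) (last _) _ _ _ ()
    value-own (layer _ _ s<K) (hub _) u≢v _ _ = a-own u≢v s<K ≤-refl ∘ inj₂-injective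
    value-own (last _) (missing refl) _ () _
    value-own (last _) (layer _ _ _) _ _ _ ()
    value-own (last refl) (last refl) _ t<t′ _ = contradiction t<t′ (<-irrefl refl)
    value-own (last _) (hub _) _ _ _ ()
    value-own (hub K<t) _ _ t<t′ t′≤p = contradiction t′≤p (<⇒≱ (≤-<-trans K<t t<t′))

    value-cross : ∀ {u v w t t′} (x : Slot t) (x′ : Slot t′) → u ≢ v → u ≢ w → v ≢ w → t < p → t′ < p →
                  p + p ≤ m + (t + t′) → value u v x ≢ value u w x′
    value-cross (hub K<t) _ _ _ _ t<p _ _ = contradiction t<p (≤⇒≯ K<t)
    value-cross _ (hub K<t) _ _ _ _ t<p _ = contradiction t<p (≤⇒≯ K<t)
    value-cross (missing refl) (missing refl) _ _ _ _ _ le =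
      ⊥-elim (arith 1 (λ K → con 2 ⊕ K ⊕ (con 2 ⊕ K) ≼ con 1 ⊕ K ⊕ (con 2 ⊕ K) ⊕ con 0 ⇒ ⊢⊥) K le)
    value-cross (missing _) (layer _ _ _) _ _ _ _ _ _ ()
    value-cross (missing _) (last _) _ u≢w _ _ _ _ = u≢w ∘ inj₁-injective
    value-cross (layer _ _ _) (missing _) _ _ _ _ _ _ ()
    value-cross (layer _ _ s<K) (layer _ _ s′<K) u≢v u≢w v≢w _ _ _ = a-cross u≢v u≢w v≢w s<K s′<K ∘ inj₂-injective
    value-cross (layer _ _ _) (last _) _ _ _ _ _ _ ()
    value-cross (last _) (missing _) u≢v _ _ _ _ _ = ≢-sym u≢v ∘ inj₁-injective
    value-cross (last _) (layer _ _ _) _ _ _ _ _ _ ()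
    value-cross (last _) (last _) _ _ v≢w _ _ _ = v≢w ∘ inj₁-injective

    value-facing : ∀ {u v t t′} (x : Slot t) (x′ : Slot t′) → u ≢ v → suc (t + t′ + suc r) ≤ m → value u v x ≢ value v u x′
    value-facing {t = t} {t′} x x′ u≢v close = go x x′
      where
      -- This is what `K < r` is for: the colour `v` next to `u` and the colour `v` at depth 0 of
      -- the opposite half-edge are then `K + r + 3 > m` apart.
      t+t′≤K : t + t′ ≤ K
      t+t′≤K = arith 4 (λ t t′ r K → con 1 ⊕ (t ⊕ t′ ⊕ (con 1 ⊕ r)) ≼ con 1 ⊕ K ⊕ (con 2 ⊕ K) ⇒ K ≺ r ⇒ ⊢ t ⊕ t′ ≼ K) t t′ r K close K<r
      go : (x : Slot t) (x′ : Slot t′) → value _ _ x ≢ value _ _ x′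
      go (last refl) _ = contradiction (m+n≤o⇒m≤o (suc K) t+t′≤K) (<-irrefl refl)
      go (hub K<t) _ = contradiction (≤-trans (<⇒≤ K<t) (m+n≤o⇒m≤o t t+t′≤K)) (<-irrefl refl)
      go _ (last refl) = contradiction (m+n≤o⇒n≤o t t+t′≤K) (<-irrefl refl)
      go _ (hub K<t′) = contradiction (≤-trans (<⇒≤ K<t′) (m+n≤o⇒n≤o t t+t′≤K)) (<-irrefl refl)
      go (missing _) (missing _) = u≢v ∘ inj₁-injective
      go (missing _) (layer _ _ _) ()
      go (layer _ _ _) (missing _) ()
      go (layer s refl s<K) (layer s′ refl s′<K) = a-facing u≢v s<K (<⇒≤ s′<K)
        (arith 4 (λ s s′ r K → con 1 ⊕ (con 1 ⊕ s ⊕ (con 1 ⊕ s′) ⊕ (con 1 ⊕ r)) ≼ con 1 ⊕ K ⊕ (con 2 ⊕ K) ⇒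
          ⊢ con 1 ⊕ (s ⊕ s′ ⊕ r) ≼ K ⊕ K) s s′ r K close) ∘ inj₂-injective

    clear : ∀ {j t} → suc (p + p + j) ≤ m + t → suc (suc j) ≤ t
    clear {j} {t} close =
      arith 3 (λ j t K → con 1 ⊕ (con 2 ⊕ K ⊕ (con 2 ⊕ K) ⊕ j) ≼ con 1 ⊕ K ⊕ (con 2 ⊕ K) ⊕ t ⇒ ⊢ con 2 ⊕ j ≼ t) j t K close

    ray-fits : ∀ {u v j j′} → u ≢ v → suc (j + j′) ≡ suc r → j ≤ j′ →
               Fits m p (λ u v t → value u v (slot t)) u v j (ray u v j) × Fits m p (λ u v t → value u v (slot t)) v u j′ (ray u v j)
    ray-fits {u} {v} {j} {j′} u≢v eq j≤j′ with j <? K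
    ... | yes j<K = ((λ {t} _ _ → own (slot t)) , λ {_} {t} u≢w w≢v t<p close → cross (slot t) u≢w w≢v t<p (clear close)) ,
                    ((λ {t} _ _ → facing (slot t)) , λ {_} {t} v≢w w≢u t<p close → far (slot t) v≢w w≢u t<p (clear close))
      where
      own : ∀ {t} (x : Slot t) → inj₂ (g u v j) ≢ value u v x
      own (missing _) ()
      own (layer _ _ s<K) = g-own u≢v j<K (<⇒≤ s<K) ∘ inj₂-injective
      own (last _) ()
      own (hub _) = g-own u≢v j<K ≤-refl ∘ inj₂-injective
      facing : ∀ {t} (x : Slot t) → inj₂ (g u v j) ≢ value v u x
      facing (missing _) ()
      facing (layer _ _ s<K) = g-facing u≢v j<K (<⇒≤ s<K) ∘ inj₂-injective
      facing (last _) ()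
      facing (hub _) = g-facing u≢v j<K ≤-refl ∘ inj₂-injective
      cross : ∀ {w t} (x : Slot t) → u ≢ w → w ≢ v → t < p → suc (suc j) ≤ t → inj₂ (g u v j) ≢ value u w x
      cross (missing _) _ _ _ _ ()
      cross (layer _ refl s<K) u≢w w≢v _ j<s = g-cross u≢v u≢w w≢v s<K (s≤s⁻¹ j<s) ∘ inj₂-injective
      cross (last _) _ _ _ _ ()
      cross (hub K<t) _ _ t<p _ = contradiction t<p (≤⇒≯ K<t)
      far : ∀ {w t} (x : Slot t) → v ≢ w → w ≢ u → t < p → suc (suc j′) ≤ t → inj₂ (g u v j) ≢ value v w x
      far (missing _) _ _ _ _ ()
      far (layer _ refl s<K) v≢w w≢u _ j′<s = g-far (≢-sym u≢v) v≢w w≢u s<K (s≤s⁻¹ j′<s) (≤-<-trans j≤j′ (s≤s⁻¹ j′<s))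
        (arith 3 (λ j j′ r → con 1 ⊕ (j ⊕ j′) ≋ con 1 ⊕ r ⇒ ⊢ r ≼ con 1 ⊕ (j′ ⊕ j)) j j′ r eq) ∘ inj₂-injective
      far (last _) _ _ _ _ ()
      far (hub K<t) _ _ t<p _ = contradiction t<p (≤⇒≯ K<t)
    ... | no j≮K = ((λ {t} _ _ → own (slot t)) , λ {_} {t} _ _ t<p close → beyond (slot t) (≮⇒≥ j≮K) t<p (clear close)) ,
                   ((λ {t} _ _ → facing (slot t)) , λ {_} {t} _ _ t<p close → beyond (slot t) (≤-trans (≮⇒≥ j≮K) j≤j′) t<p (clear close))
      where
      own : ∀ {t} (x : Slot t) → inj₁ (spare u v) ≢ value u v x
      own (missing _) = spare≢u u≢v ∘ inj₁-injective
      own (layer _ _ _) ()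
      own (last _) = spare≢v u≢v ∘ inj₁-injective
      own (hub _) ()
      facing : ∀ {t} (x : Slot t) → inj₁ (spare u v) ≢ value v u x
      facing (missing _) = spare≢v u≢v ∘ inj₁-injective
      facing (layer _ _ _) ()
      facing (last _) = spare≢u u≢v ∘ inj₁-injective
      facing (hub _) ()
      beyond : ∀ {a b t i} (x : Slot t) → K ≤ i → t < p → suc (suc i) ≤ t → inj₁ (spare u v) ≢ value a b x
      beyond _ K≤i t<p i<t = contradiction (≤-trans (s≤s (s≤s K≤i)) i<t) (<⇒≱ t<p)

    ray-along : ∀ {u v i j} → u ≢ v → i < j → suc (j + j) ≤ suc r → ray u v i ≢ ray u v j
    ray-along {i = i} {j} u≢v i<j 2j<r with i <? K | j <? K
    ... | yes _  | yes j<K = g-along u≢v i<j j<K ∘ inj₂-injective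
    ... | yes _  | no _    = λ ()
    ... | no i≮K | _       = ⊥-elim
      (arith 4 (λ i j K r → i ≺ j ⇒ con 1 ⊕ (j ⊕ j) ≼ con 1 ⊕ r ⇒ r ≼ con 1 ⊕ (K ⊕ K) ⇒ K ≼ i ⇒ ⊢⊥) i j K r i<j 2j<r r≤2K+1 (≮⇒≥ i≮K))

    ray-opposite : ∀ {u v i j} → u ≢ v → ray u v i ≢ ray v u j
    ray-opposite {i = i} {j} u≢v with i <? K | j <? K
    ... | yes i<K | yes j<K = g-across u≢v i<K j<K ∘ inj₂-injective
    ... | yes _   | no _    = λ ()
    ... | no _    | yes _   = λ ()
    ... | no _    | no _    = spare-anti u≢v ∘ inj₁-injective

  long-odd-layout : Layout (Fin N ⊎ C) N (suc K + suc (suc K)) (suc (suc K)) (suc r)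
  long-odd-layout = record
    { m≤2p+1   = arith 1 (λ K → ⊢ con 1 ⊕ K ⊕ (con 2 ⊕ K) ≼ con 1 ⊕ (con 2 ⊕ K ⊕ (con 2 ⊕ K))) K
    ; centre   = λ _ → inj₂ centre
    ; A        = λ u v t → value u v (slot t)
    ; Y        = mirror ray
    ; A-centre = λ _ → value-centre (slot p)
    ; A-own    = λ {_} {_} {t} {t′} → value-own (slot t) (slot t′)
    ; A-cross  = λ {_} {_} {_} {t} {t′} → value-cross (slot t) (slot t′)
    ; A-facing = λ {_} {_} {t} {t′} u≢v _ _ → value-facing (slot t) (slot t′) u≢v
    ; A-far    = λ {_} {_} {_} {t} {t′} _ _ _ t<p _ far → ⊥-elim
        (arith 4 (λ K r t t′ → con 1 ⊕ (con 2 ⊕ K ⊕ (con 2 ⊕ K) ⊕ (con 1 ⊕ r) ⊕ t′) ≼ con 1 ⊕ K ⊕ (con 2 ⊕ K) ⊕ t ⇒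
          t ≺ con 2 ⊕ K ⇒ K ≺ r ⇒ ⊢⊥) K r t t′ far t<p K<r)
    ; Y-fits   = mirror-fits ray {Q = Fits m p (λ u v t → value u v (slot t))} ray-fits
    ; Y-own    = mirror-own ray ray-along (λ u≢v _ _ → ray-opposite u≢v)
    }
    where
    value-centre : ∀ {u v} (x : Slot p) → value u v x ≡ inj₂ centre
    value-centre (layer _ refl s<K) = contradiction s<K (≤⇒≯ (n≤1+n _))
    value-centre (last ())
    value-centre {u} {v} (hub _) = cong inj₂ (a-centre u v)

-- Without layers the middle colour has to be the colour missing around a fifth vertex.
module _ {N : ℕ} (twist : Twist N) (spare : ∀ u v → ∃ λ w → All (w ≢_) (u ∷ v ∷ Twist.P twist u v ∷ Twist.P twist v u ∷ [])) where
  open Twist twist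

  private
    A : Fin N → Fin N → ℕ → Maybe (Fin N)
    A u v 0 = just u
    A u v 1 = just (P u v)
    A u v _ = nothing

    fits : ∀ {u v j w} → w ≢ u → w ≢ P u v → Fits 3 2 A u v j (just w)
    fits w≢u w≢P = (λ { {0} _ _ → w≢u ∘ just-injective
                      ; {1} _ _ → w≢P ∘ just-injective
                      ; {suc (suc _)} _ _ () }) ,
                   (λ { {_} {0} _ _ _ (s≤s (s≤s (s≤s ())))
                      ; {_} {1} _ _ _ (s≤s (s≤s (s≤s (s≤s ()))))
                      ; {_} {suc (suc _)} _ _ (s≤s (s≤s ())) })

  short-odd-layout : Layout (Maybe (Fin N)) N 3 2 1
  short-odd-layout = record
    { m≤2p+1   = s≤s (s≤s (s≤s z≤n))
    ; centre   = λ _ → nothing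
    ; A        = A
    ; Y        = λ u v _ _ → just (proj₁ (spare u v))
    ; A-centre = λ _ → refl
    ; A-own    = own
    ; A-cross  = cross
    ; A-facing = facing
    ; A-far    = λ {_} {_} {_} {t} {t′} _ _ _ t<2 _ far → ⊥-elim
        (arith 2 (λ t t′ → con 1 ⊕ (con 5 ⊕ t′) ≼ con 3 ⊕ t ⇒ t ≺ con 2 ⇒ ⊢⊥) t t′ far t<2)
    ; Y-fits   = λ {u} {v} _ _ → both (proj₂ (spare u v))
    ; Y-own    = λ {i = i} {i′} {j} {j′} _ _ eq i<j _ →
        arith 3 (λ i j j′ → con 1 ⊕ (j ⊕ j′) ≋ con 1 ⇒ i ≺ j ⇒ ⊢⊥) i j j′ eq i<j
    }
    where
    both : ∀ {u v j j′ w} → All (w ≢_) (u ∷ v ∷ P u v ∷ P v u ∷ []) → Fits 3 2 A u v j (just w) × Fits 3 2 A v u j′ (just w)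
    both (w≢u ∷ w≢v ∷ w≢P ∷ w≢P′ ∷ []) = fits w≢u w≢P , fits w≢v w≢P′
    own : ∀ {u v t t′} → u ≢ v → t < t′ → t′ ≤ 2 → A u v t ≢ A u v t′
    own {t = 0} {1} u≢v _ _ = ≢-sym (P≢u u≢v) ∘ just-injective
    own {t = 0} {2} _ _ _ ()
    own {t = 1} {2} _ _ _ ()
    own {t = suc _} {1} _ (s≤s ()) _
    own {t = suc (suc _)} {2} _ (s≤s (s≤s ())) _
    own {t′ = suc (suc (suc _))} _ _ (s≤s (s≤s ()))
    cross : ∀ {u v w t t′} → u ≢ v → u ≢ w → v ≢ w → t < 2 → t′ < 2 → 4 ≤ 3 + (t + t′) → A u v t ≢ A u w t′
    cross {t = 0} {0} _ _ _ _ _ (s≤s (s≤s (s≤s ())))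
    cross {t = 0} {1} _ u≢w _ _ _ _ = ≢-sym (P≢u u≢w) ∘ just-injective
    cross {t = 1} {0} u≢v _ _ _ _ _ = P≢u u≢v ∘ just-injective
    cross {t = 1} {1} u≢v u≢w v≢w _ _ _ = P-row u≢v u≢w v≢w ∘ just-injective
    cross {t = suc (suc _)} _ _ _ (s≤s (s≤s ()))
    cross {t′ = suc (suc _)} _ _ _ _ (s≤s (s≤s ()))
    facing : ∀ {u v t t′} → u ≢ v → t ≤ 2 → t′ ≤ 2 → suc (t + t′ + 1) ≤ 3 → A u v t ≢ A v u t′
    facing {t = 0} {0} u≢v _ _ _ = u≢v ∘ just-injective
    facing {t = 0} {1} u≢v _ _ _ = ≢-sym (P≢v (≢-sym u≢v)) ∘ just-injective
    facing {t = 1} {0} u≢v _ _ _ = P≢v u≢v ∘ just-injective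
    facing {t = 1} {suc t′} _ _ _ (s≤s (s≤s (s≤s le))) = contradiction (≤-trans (m≤n+m 1 t′) le) λ ()
    facing {t = 0} {suc (suc t′)} _ _ _ (s≤s (s≤s (s≤s le))) = contradiction (≤-trans (m≤n+m 1 t′) le) λ ()
    facing {t = suc (suc t)} {t′} _ _ _ (s≤s (s≤s (s≤s le))) = contradiction (≤-trans (m≤n+m 1 (t + t′)) le) λ ()

-- Labellings of the half-edges.

-- With equal remainders the quotients must differ, and then `y` is at least `x + D`.
%-≢ : ∀ {x y D} .⦃ _ : NonZero D ⦄ → x < y → y < x + D → x % D ≢ y % D
%-≢ {x} {y} {D} x<y y<x+D eq = <⇒≱ y<x+D (begin
  x + D                     ≡⟨ cong (_+ D) (m≡m%n+[m/n]*n x D) ⟩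
  x % D + x / D * D + D     ≡⟨ +-assoc (x % D) _ D ⟩
  x % D + (x / D * D + D)   ≡⟨ cong (x % D +_) (+-comm (x / D * D) D) ⟩
  x % D + suc (x / D) * D   ≤⟨ +-monoʳ-≤ (x % D) (*-monoˡ-≤ D q<q′) ⟩
  x % D + y / D * D         ≡⟨ cong (_+ y / D * D) eq ⟩
  y % D + y / D * D         ≡⟨ m≡m%n+[m/n]*n y D ⟨
  y ∎)
  where
  open ≤-Reasoning
  q<q′ : x / D < y / D
  q<q′ = *-cancelʳ-< D (x / D) (y / D) (+-cancelˡ-< (x % D) _ _
    (subst₂ _<_ (m≡m%n+[m/n]*n x D) (trans (m≡m%n+[m/n]*n y D) (cong (_+ y / D * D) (sym eq))) x<y))

mod-≢ : ∀ {x y D} .⦃ _ : NonZero D ⦄ → x < y → y < x + D → x mod D ≢ y mod D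
mod-≢ {x} {y} {D} x<y y<x+D eq = %-≢ x<y y<x+D
  (trans (sym (Fin.toℕ-fromℕ< (m%n<n x D))) (trans (cong toℕ eq) (Fin.toℕ-fromℕ< (m%n<n y D))))

module _ {M : ℕ} where

  private
    N : ℕ
    N = 3 + M

  next : Fin N → Fin N
  next u = suc (toℕ u) mod N

  next-injective : ∀ {u v} → next u ≡ next v → u ≡ v
  next-injective {u} {v} eq with Fin.<-cmp u v
  ... | tri< u<v _ _ = contradiction eq (mod-≢ (s≤s u<v) (<-≤-trans (s≤s (toℕ<n v)) (s≤s (m≤n+m N (toℕ u)))))
  ... | tri≈ _ u≡v _ = u≡v
  ... | tri> _ _ v<u = contradiction (sym eq) (mod-≢ (s≤s v<u) (<-≤-trans (s≤s (toℕ<n u)) (s≤s (m≤n+m N (toℕ v)))))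

  next-cases : ∀ u → toℕ (next u) ≡ suc (toℕ u) ⊎ (suc (toℕ u) ≡ N × toℕ (next u) ≡ 0)
  next-cases u with m≤n⇒m<n∨m≡n (toℕ<n u)
  ... | inj₁ u+1<N = inj₁ (trans (Fin.toℕ-fromℕ< _) (m<n⇒m%n≡m u+1<N))
  ... | inj₂ u+1≡N = inj₂ (u+1≡N , trans (Fin.toℕ-fromℕ< (m%n<n (suc (toℕ u)) N)) (trans (cong (_% N) u+1≡N) (n%n≡0 N)))

  next≢ : ∀ u → next u ≢ u
  next≢ u eq with next-cases u | cong toℕ eq
  ... | inj₁ up | eq′ = arith 2 (λ a b → a ≋ con 1 ⊕ b ⇒ a ≋ b ⇒ ⊢⊥) (toℕ (next u)) (toℕ u) up eq′
  ... | inj₂ (top , bottom) | eq′ =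
    arith 3 (λ a b M → con 1 ⊕ b ≋ con 3 ⊕ M ⇒ a ≋ con 0 ⇒ a ≋ b ⇒ ⊢⊥) (toℕ (next u)) (toℕ u) M top bottom eq′

  -- A cycle of length at least three has no two vertices that follow each other. In `twist-suc`
  -- this keeps the new vertex from being the value at both `u v` and `v u`.
  next²≢ : ∀ {u v} → v ≡ next u → u ≢ next v
  next²≢ {u} {v} v≡ u≡ with next-cases u | next-cases v | cong toℕ v≡ | cong toℕ u≡
  ... | inj₁ up | inj₁ up′ | eq | eq′ =
    arith 4 (λ u v a b → a ≋ con 1 ⊕ u ⇒ b ≋ con 1 ⊕ v ⇒ v ≋ a ⇒ u ≋ b ⇒ ⊢⊥) (toℕ u) (toℕ v) _ _ up up′ eq eq′
  ... | inj₁ up | inj₂ (top , bottom) | eq | eq′ =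
    arith 5 (λ u v a b M → a ≋ con 1 ⊕ u ⇒ con 1 ⊕ v ≋ con 3 ⊕ M ⇒ b ≋ con 0 ⇒ v ≋ a ⇒ u ≋ b ⇒ ⊢⊥) (toℕ u) (toℕ v) _ _ M up top bottom eq eq′
  ... | inj₂ (top , bottom) | inj₁ up | eq | eq′ =
    arith 5 (λ u v a b M → a ≋ con 1 ⊕ u ⇒ con 1 ⊕ v ≋ con 3 ⊕ M ⇒ b ≋ con 0 ⇒ v ≋ a ⇒ u ≋ b ⇒ ⊢⊥) (toℕ v) (toℕ u) _ _ M up top bottom eq′ eq
  ... | inj₂ (top , bottom) | inj₂ (top′ , bottom′) | eq | eq′ =
    arith 4 (λ u v a M → a ≋ con 0 ⇒ con 1 ⊕ v ≋ con 3 ⊕ M ⇒ v ≋ a ⇒ ⊢⊥) (toℕ u) (toℕ v) _ M bottom top′ eq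

  -- The new vertex replaces next u in row u, and next u moves to the column of the new vertex.
  twist-suc : Twist N → Twist (suc N)
  twist-suc twist = record
    { P = Q ; P≢u = Q≢u ; P≢v = Q≢v ; P-row = Q-row ; P-anti = Q-anti }
    where
    open Twist twist

    Q : Fin (suc N) → Fin (suc N) → Fin (suc N)
    Q zero zero = zero
    Q zero (suc v) = suc (next v)
    Q (suc u) zero = suc (P u (next u))
    Q (suc u) (suc v) with v ≟ next u
    ... | yes _ = zero
    ... | no _  = suc (P u v)

    Q≢u : ∀ {u v} → u ≢ v → Q u v ≢ u
    Q≢u {zero} {zero} u≢v _ = u≢v refl
    Q≢u {zero} {suc v} _ ()
    Q≢u {suc u} {zero} _ = P≢u (≢-sym (next≢ u)) ∘ Fin.suc-injective
    Q≢u {suc u} {suc v} u≢v with v ≟ next u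
    ... | yes _ = λ ()
    ... | no _  = P≢u (u≢v ∘ cong suc) ∘ Fin.suc-injective

    Q≢v : ∀ {u v} → u ≢ v → Q u v ≢ v
    Q≢v {zero} {zero} u≢v _ = u≢v refl
    Q≢v {zero} {suc v} _ = next≢ v ∘ Fin.suc-injective
    Q≢v {suc u} {zero} _ ()
    Q≢v {suc u} {suc v} u≢v with v ≟ next u
    ... | yes _ = λ ()
    ... | no _  = P≢v (u≢v ∘ cong suc) ∘ Fin.suc-injective

    Q-row : ∀ {u v w} → u ≢ v → u ≢ w → v ≢ w → Q u v ≢ Q u w
    Q-row {zero} {zero} u≢v _ _ = contradiction refl u≢v
    Q-row {zero} {suc v} {zero} _ u≢w _ = contradiction refl u≢w
    Q-row {zero} {suc v} {suc w} _ _ v≢w = v≢w ∘ cong suc ∘ next-injective ∘ Fin.suc-injective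
    Q-row {suc u} {zero} {zero} _ _ v≢w = contradiction refl v≢w
    Q-row {suc u} {zero} {suc w} _ u≢w _ with w ≟ next u
    ... | yes _ = λ ()
    ... | no w≢ = P-row (≢-sym (next≢ u)) (u≢w ∘ cong suc) (≢-sym w≢) ∘ Fin.suc-injective
    Q-row {suc u} {suc v} {zero} u≢v _ _ with v ≟ next u
    ... | yes _ = λ ()
    ... | no v≢ = P-row (u≢v ∘ cong suc) (≢-sym (next≢ u)) v≢ ∘ Fin.suc-injective
    Q-row {suc u} {suc v} {suc w} u≢v u≢w v≢w with v ≟ next u | w ≟ next u
    ... | yes v≡ | yes w≡ = contradiction (cong suc (trans v≡ (sym w≡))) v≢w
    ... | yes _  | no _   = λ ()
    ... | no _   | yes _  = λ ()
    ... | no _   | no _   = P-row (u≢v ∘ cong suc) (u≢w ∘ cong suc) (v≢w ∘ cong suc) ∘ Fin.suc-injective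

    Q-anti : ∀ {u v} → u ≢ v → Q u v ≢ Q v u
    Q-anti {zero} {zero} u≢v _ = u≢v refl
    Q-anti {zero} {suc v} _ = ≢-sym (P≢v (≢-sym (next≢ v))) ∘ Fin.suc-injective
    Q-anti {suc u} {zero} _ = P≢v (≢-sym (next≢ u)) ∘ Fin.suc-injective
    Q-anti {suc u} {suc v} u≢v with v ≟ next u | u ≟ next v
    ... | yes v≡ | yes u≡ = contradiction u≡ (next²≢ v≡)
    ... | yes _  | no _   = λ ()
    ... | no _   | yes _  = λ ()
    ... | no _   | no _   = P-anti (u≢v ∘ cong suc) ∘ Fin.suc-injective

table : ∀ {A : Set} {m n} → Vec (Vec A n) m → Fin m → Fin n → A
table rows u v = Vec.lookup (Vec.lookup rows u) v

-- Row u is the 3-cycle on the other three vertices for which u, v, rotate u v, … is an even arrangement.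
rotate : Fin 4 → Fin 4 → Fin 4
rotate = table
  ( (# 0 ∷ # 2 ∷ # 3 ∷ # 1 ∷ [])
  ∷ (# 3 ∷ # 1 ∷ # 0 ∷ # 2 ∷ [])
  ∷ (# 1 ∷ # 3 ∷ # 2 ∷ # 0 ∷ [])
  ∷ (# 2 ∷ # 0 ∷ # 1 ∷ # 3 ∷ [])
  ∷ [])

twist₄ : Twist 4
twist₄ = record
  { P      = rotate
  ; P≢u    = λ {u} {v} → from-yes (all? λ u → all? λ v → ¬? (u ≟ v) →-dec ¬? (rotate u v ≟ u)) u v
  ; P≢v    = λ {u} {v} → from-yes (all? λ u → all? λ v → ¬? (u ≟ v) →-dec ¬? (rotate u v ≟ v)) u v
  ; P-row  = λ {u} {v} {w} → from-yes (all? λ u → all? λ v → all? λ w →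
      ¬? (u ≟ v) →-dec ¬? (u ≟ w) →-dec ¬? (v ≟ w) →-dec ¬? (rotate u v ≟ rotate u w)) u v w
  ; P-anti = λ {u} {v} → from-yes (all? λ u → all? λ v → ¬? (u ≟ v) →-dec ¬? (rotate u v ≟ rotate v u)) u v
  }

twist : ∀ n → Twist (4 + n)
twist zero    = twist₄
twist (suc n) = twist-suc (twist n)

module _ {D′ : ℕ} where

  private
    D : ℕ
    D = 2 + D′

  -- The index of `v` among the vertices other than `u`.
  rank : Fin (suc D) → Fin (suc D) → ℕ
  rank u v with v Fin.<? u
  ... | yes _ = toℕ v
  ... | no _  = pred (toℕ v)

  label : Fin (suc D) → Fin (suc D) → Fin D
  label u v = (toℕ u + rank u v) mod D

  rank< : ∀ {u v} → u ≢ v → rank u v < D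
  rank< {u} {v} u≢v with v Fin.<? u
  ... | yes v<u = <-≤-trans v<u (s≤s⁻¹ (toℕ<n u))
  rank< {zero} {zero} u≢v | no _ = contradiction refl u≢v
  rank< {suc u} {zero} u≢v | no z≮s = contradiction (s≤s z≤n) z≮s
  rank< {u} {suc v} u≢v | no _ = toℕ<n v

  rank-mono : ∀ {u v w} → u ≢ v → u ≢ w → v Fin.< w → rank u v < rank u w
  rank-mono {u} {v} {w} u≢v u≢w v<w with v Fin.<? u | w Fin.<? u
  ... | yes _   | yes _   = v<w
  ... | no v≮u  | yes w<u = contradiction (<-trans v<w w<u) v≮u
  ... | yes v<u | no w≮u  = <-≤-trans v<u (pred-mono-≤ (≤∧≢⇒< (≮⇒≥ w≮u) (u≢w ∘ toℕ-injective)))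
  ... | no v≮u  | no w≮u  = <-≤-trans (pred<self (≤-<-trans z≤n (≤∧≢⇒< (≮⇒≥ v≮u) (u≢v ∘ toℕ-injective)))) (pred-mono-≤ v<w)
    where
    pred<self : ∀ {a} → 0 < a → pred a < a
    pred<self {suc a} _ = ≤-refl

  label-row-< : ∀ {u v w} → u ≢ v → u ≢ w → v Fin.< w → label u v ≢ label u w
  label-row-< {u} {v} {w} u≢v u≢w v<w = mod-≢ (+-monoʳ-< (toℕ u) (rank-mono u≢v u≢w v<w))
    (arith 4 (λ u a b D → b ≺ D ⇒ ⊢ u ⊕ b ≺ u ⊕ a ⊕ D) (toℕ u) (rank u v) (rank u w) D (rank< u≢w))

  label-row : ∀ {u v w} → u ≢ v → u ≢ w → v ≢ w → label u v ≢ label u w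
  label-row {u} {v} {w} u≢v u≢w v≢w with Fin.<-cmp v w
  ... | tri< v<w _ _ = label-row-< u≢v u≢w v<w
  ... | tri≈ _ v≡w _ = contradiction v≡w v≢w
  ... | tri> _ _ w<v = ≢-sym (label-row-< u≢w u≢v w<v)

  -- The two sums are `u + (v ∸ 1)` and `v + u`, consecutive numbers, hence different modulo
  -- `D ≥ 2`.
  label-anti-< : ∀ {u v} → u Fin.< v → label u v ≢ label v u
  label-anti-< {u} {v} u<v with v Fin.<? u | u Fin.<? v
  ... | yes v<u | _ = contradiction v<u (<-asym u<v)
  ... | no _ | no u≮v = contradiction u<v u≮v
  label-anti-< {u} {suc v} u<v | no _ | yes _ = mod-≢
    (arith 2 (λ u v → ⊢ u ⊕ v ≺ con 1 ⊕ v ⊕ u) (toℕ u) (toℕ v))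
    (arith 3 (λ u v D → ⊢ con 1 ⊕ v ⊕ u ≺ u ⊕ v ⊕ (con 2 ⊕ D)) (toℕ u) (toℕ v) D′)

  label-anti : ∀ {u v} → u ≢ v → label u v ≢ label v u
  label-anti {u} {v} u≢v with Fin.<-cmp u v
  ... | tri< u<v _ _ = label-anti-< u<v
  ... | tri≈ _ u≡v _ = contradiction u≡v u≢v
  ... | tri> _ _ v<u = ≢-sym (label-anti-< v<u)

record TwoMore {N M : ℕ} (f : Fin N → Fin N → Fin M) : Set where
  field
    more        : Fin N → Fin N → Fin M
    more≢       : ∀ {u v} → u ≢ v → more u v ≢ f u v
    more≢-other : ∀ {u v} → u ≢ v → more u v ≢ f v u
    more-anti   : ∀ {u v} → u ≢ v → more u v ≢ more v u

-- Each pair gets two values outside `f u v` and `f v u`, which takes four values in all; the order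
-- of `u` and `v` decides which end receives which.
two-more : ∀ {N M} (f : Fin N → Fin N → Fin M) → 4 ≤ M → TwoMore f
two-more {N} {M} f 4≤M = record { more = more ; more≢ = more≢ ; more≢-other = more≢-other ; more-anti = more-anti }
  where
  first : ∀ a b → ∃ λ c → All (c ≢_) (a ∷ b ∷ [])
  first a b = fresh (a ∷ b ∷ []) (≤-trans (n≤1+n 3) 4≤M)
  second : ∀ a b → ∃ λ d → All (d ≢_) (proj₁ (first a b) ∷ a ∷ b ∷ [])
  second a b = fresh (proj₁ (first a b) ∷ a ∷ b ∷ []) 4≤M
  more : Fin N → Fin N → Fin M
  more u v with u Fin.<? v
  ... | yes _ = proj₁ (first (f u v) (f v u))
  ... | no _  = proj₁ (second (f v u) (f u v))
  more≢ : ∀ {u v} → u ≢ v → more u v ≢ f u v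
  more≢ {u} {v} _ with u Fin.<? v
  ... | yes _ = All.head (proj₂ (first (f u v) (f v u)))
  ... | no _  = All.head (All.tail (All.tail (proj₂ (second (f v u) (f u v)))))
  more≢-other : ∀ {u v} → u ≢ v → more u v ≢ f v u
  more≢-other {u} {v} _ with u Fin.<? v
  ... | yes _ = All.head (All.tail (proj₂ (first (f u v) (f v u))))
  ... | no _  = All.head (All.tail (proj₂ (second (f v u) (f u v))))
  more-anti : ∀ {u v} → u ≢ v → more u v ≢ more v u
  more-anti {u} {v} u≢v with u Fin.<? v | v Fin.<? u
  ... | yes u<v | yes v<u = contradiction v<u (Fin.<-asym u<v)
  ... | yes _   | no _    = ≢-sym (All.head (proj₂ (second (f u v) (f v u))))
  ... | no _    | yes _   = All.head (proj₂ (second (f v u) (f u v)))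
  ... | no u≮v  | no v≮u  = contradiction (Fin.≤-antisym (≮⇒≥ v≮u) (≮⇒≥ u≮v)) u≢v

-- Classes of colours and their orders.

level : ∀ K → ℕ → Maybe (Fin K)
level K t with t <? K
... | yes t<K = just (fromℕ< t<K)
... | no _    = nothing

-- A colour is a class and a level; from depth `K` on only the common centre `nothing` is left.
tint : ∀ {D} K → Fin D → ℕ → Maybe (Fin D × Fin K)
tint K ℓ = Maybe.map (ℓ ,_) ∘ level K

tint-injective : ∀ {D K} {ℓ ℓ′ : Fin D} {t t′} → t < K → tint K ℓ t ≡ tint K ℓ′ t′ → ℓ ≡ ℓ′ × t ≡ t′
tint-injective {K = K} {t = t} {t′} t<K eq with t <? K | t′ <? K
... | no t≮K  | _        = contradiction t<K t≮K
... | yes _   | no _     = contradiction eq λ ()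
... | yes t<K | yes t′<K with refl , eq′ ← ,-injective (just-injective eq) =
  refl , trans (sym (Fin.toℕ-fromℕ< t<K)) (trans (cong toℕ eq′) (Fin.toℕ-fromℕ< t′<K))

tint-centre : ∀ {D} K (ℓ : Fin D) → tint K ℓ K ≡ nothing
tint-centre K ℓ with K <? K
... | yes K<K = contradiction K<K (<-irrefl refl)
... | no _    = refl

reflect : Bool → ℕ → ℕ → ℕ
reflect false R t = t
reflect true  R t with t <? R
... | yes _ = R ∸ suc t
... | no _  = t

reflect-≥ : ∀ b {R t} → R ≤ t → reflect b R t ≡ t
reflect-≥ false R≤t = refl
reflect-≥ true {R} {t} R≤t with t <? R
... | yes t<R = contradiction R≤t (<⇒≱ t<R)
... | no _    = refl

reflect-< : ∀ b {R t} → t < R → reflect b R t < R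
reflect-< false t<R = t<R
reflect-< true {R} {t} t<R with t <? R
... | yes _  = ≤-trans (≤-reflexive (sym (+-∸-assoc 1 t<R))) (m∸n≤m R t)
... | no t≮R = contradiction t<R t≮R

reflect-sum : ∀ {R t} → t < R → suc (t + reflect true R t) ≡ R
reflect-sum {R} {t} t<R with t <? R
... | yes _  = m+[n∸m]≡n t<R
... | no t≮R = contradiction t<R t≮R

reflect-<-K : ∀ b {R K t} → R ≤ K → t < K → reflect b R t < K
reflect-<-K b {R} {K} {t} R≤K t<K with ≤-<-connex R t
... | inj₁ R≤t = subst (_< K) (sym (reflect-≥ b R≤t)) t<K
... | inj₂ t<R = <-≤-trans (reflect-< b t<R) R≤K

reflect-injective : ∀ b {R t t′} → reflect b R t ≡ reflect b R t′ → t ≡ t′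
reflect-injective false eq = eq
reflect-injective true {R} {t} {t′} eq with ≤-<-connex R t | ≤-<-connex R t′
... | inj₁ R≤t | inj₁ R≤t′ = trans (sym (reflect-≥ true R≤t)) (trans eq (reflect-≥ true R≤t′))
... | inj₁ R≤t | inj₂ t′<R = contradiction (trans (sym (reflect-≥ true R≤t)) eq) (≢-sym (<⇒≢ (<-≤-trans (reflect-< true t′<R) R≤t)))
... | inj₂ t<R | inj₁ R≤t′ = contradiction (trans eq (reflect-≥ true R≤t′)) (<⇒≢ (<-≤-trans (reflect-< true t<R) R≤t′))
... | inj₂ t<R | inj₂ t′<R =
  arith 5 (λ t t′ a b R → con 1 ⊕ (t ⊕ a) ≋ R ⇒ con 1 ⊕ (t′ ⊕ b) ≋ R ⇒ a ≋ b ⇒ ⊢ t ≋ t′)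
    t t′ (reflect true R t) (reflect true R t′) R (reflect-sum t<R) (reflect-sum t′<R) eq

reflect-opposite : ∀ {b b′ R t t′} → b ≢ b′ → suc (t + t′) ≡ R → reflect b R t ≡ reflect b′ R t′
reflect-opposite {false} {false} b≢b′ _ = contradiction refl b≢b′
reflect-opposite {true}  {true}  b≢b′ _ = contradiction refl b≢b′
reflect-opposite {false} {true} {R} {t} {t′} _ eq =
  arith 4 (λ t t′ a R → con 1 ⊕ (t ⊕ t′) ≋ R ⇒ con 1 ⊕ (t′ ⊕ a) ≋ R ⇒ ⊢ t ≋ a) t t′ (reflect true R t′) R eq
    (reflect-sum (≤-trans (s≤s (m≤n+m t′ t)) (≤-reflexive eq)))
reflect-opposite {true} {false} {R} {t} {t′} _ eq =
  arith 4 (λ t t′ a R → con 1 ⊕ (t ⊕ t′) ≋ R ⇒ con 1 ⊕ (t ⊕ a) ≋ R ⇒ ⊢ a ≋ t′) t t′ (reflect true R t) R eq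
    (reflect-sum (≤-trans (s≤s (m≤m+n t t′)) (≤-reflexive eq)))

-- Reversal pairs `t` with `R ∸ 1 ∸ t`, so two orders of a class can agree only at equal or at
-- paired indices.
reflect-meet : ∀ b b′ {R t t′} → t < R → reflect b R t ≡ reflect b′ R t′ → t ≡ t′ ⊎ suc (t + t′) ≡ R
reflect-meet false false _ eq = inj₁ eq
reflect-meet true  true  {R} _ eq = inj₁ (reflect-injective true {R} eq)
reflect-meet true false {R} {t} t<R refl = inj₂ (reflect-sum t<R)
reflect-meet false true {R} {t} {t′} t<R eq with ≤-<-connex R t′
... | inj₁ R≤t′ = contradiction (trans eq (reflect-≥ true R≤t′)) (<⇒≢ (<-≤-trans t<R R≤t′))
... | inj₂ t′<R = inj₂ (trans (cong suc (trans (+-comm t t′) (cong (t′ +_) eq))) (reflect-sum t′<R))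

reflect-meet-opposite : ∀ {b b′ R t t′} → b ≢ b′ → t < R → reflect b R t ≡ reflect b′ R t′ → suc (t + t′) ≡ R
reflect-meet-opposite {false} {false} b≢b′ = contradiction refl b≢b′
reflect-meet-opposite {true}  {true}  b≢b′ = contradiction refl b≢b′
reflect-meet-opposite {true}  {false} _ t<R refl = reflect-sum t<R
reflect-meet-opposite {false} {true} {R} {t} {t′} _ t<R eq with ≤-<-connex R t′
... | inj₁ R≤t′ = contradiction (trans eq (reflect-≥ true R≤t′)) (<⇒≢ (<-≤-trans t<R R≤t′))
... | inj₂ t′<R = trans (cong suc (trans (+-comm t t′) (cong (t′ +_) eq))) (reflect-sum t′<R)

-- The half-edge from u to v gets the colours (lab u v , s), s < K, the first R of them in reverse order
-- if o says so.
module Painted {N D : ℕ} (lab : Fin N → Fin N → Fin D) (o : Fin D → Fin N → Bool)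
               (lab-row : ∀ {u v w} → u ≢ v → u ≢ w → v ≢ w → lab u v ≢ lab u w) (K R : ℕ) (R≤K : R ≤ K) where

  shade : Fin N → Fin D → ℕ → Maybe (Fin D × Fin K)
  shade u ℓ t = tint K ℓ (reflect (o ℓ u) R t)

  shade-label : ∀ {u v ℓ ℓ′ t t′} → t < K → ℓ ≢ ℓ′ → shade u ℓ t ≢ shade v ℓ′ t′
  shade-label {u} {ℓ = ℓ} t<K ℓ≢ℓ′ = ℓ≢ℓ′ ∘ proj₁ ∘ tint-injective (reflect-<-K (o ℓ u) R≤K t<K)

  shade-depth : ∀ {u ℓ ℓ′ t t′} → t < K → t ≢ t′ → shade u ℓ t ≢ shade u ℓ′ t′
  shade-depth {u} {ℓ} t<K t≢t′ eq with tint-injective (reflect-<-K (o ℓ u) R≤K t<K) eq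
  ... | refl , eq′ = t≢t′ (reflect-injective (o ℓ u) eq′)

  shade-meet : ∀ {u v ℓ ℓ′ t t′} → t < K → shade u ℓ t ≡ shade v ℓ′ t′ → ℓ ≡ ℓ′ × reflect (o ℓ u) R t ≡ reflect (o ℓ′ v) R t′
  shade-meet {u} {ℓ = ℓ} t<K = tint-injective (reflect-<-K (o ℓ u) R≤K t<K)

  a : Fin N → Fin N → ℕ → Maybe (Fin D × Fin K)
  a u v = shade u (lab u v)

  a-centre : ∀ u v → a u v K ≡ nothing
  a-centre u v = trans (cong (tint K (lab u v)) (reflect-≥ (o (lab u v) u) R≤K)) (tint-centre K (lab u v))

  a-own : ∀ {u v t t′} → u ≢ v → t < t′ → t′ ≤ K → a u v t ≢ a u v t′
  a-own {u} {v} {t} _ t<t′ t′≤K = shade-depth {u} {lab u v} {lab u v} {t} (<-≤-trans t<t′ t′≤K) (<⇒≢ t<t′)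

  a-cross : ∀ {u v w t t′} → u ≢ v → u ≢ w → v ≢ w → t < K → t′ < K → a u v t ≢ a u w t′
  a-cross {u} {v} {w} {t} {t′} u≢v u≢w v≢w t<K _ = shade-label {u} {u} {lab u v} {lab u w} {t} {t′} t<K (lab-row u≢v u≢w v≢w)

-- No order is reversed. The two half-edges and the two rays of one edge have four different
-- classes, which takes `D ≥ 4`; against the other edges at its ends, a ray or the far half-edge is
-- told apart by the level.
rays : ∀ {D} → 4 ≤ D → ∀ K r B → Rays (Maybe (Fin D × Fin K)) (suc D) K r B
rays {suc zero} (s≤s ())
rays {suc (suc D′)} 4≤D K r B = record
  { centre   = nothing
  ; a        = a
  ; g        = λ u v → tint K (more u v)
  ; a-centre = a-centre
  ; a-own    = a-own
  ; a-cross  = a-cross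
  ; a-facing = λ u≢v t<K _ _ → label-anti u≢v ∘ proj₁ ∘ tint-injective t<K
  ; a-far    = λ _ _ _ t<K t′<t → ≢-sym (<⇒≢ t′<t) ∘ proj₂ ∘ tint-injective t<K
  ; g-own    = λ u≢v j<K _ → more≢ u≢v ∘ proj₁ ∘ tint-injective j<K
  ; g-facing = λ u≢v j<K _ → more≢-other u≢v ∘ proj₁ ∘ tint-injective j<K
  ; g-cross  = λ _ _ _ t<K j<t → <⇒≢ j<t ∘ proj₂ ∘ tint-injective (<-trans j<t t<K)
  ; g-far    = λ _ _ _ t<K _ j′<t _ → <⇒≢ j′<t ∘ proj₂ ∘ tint-injective (<-trans j′<t t<K)
  ; g-along  = λ _ j<j′ j′<K → <⇒≢ j<j′ ∘ proj₂ ∘ tint-injective (<-trans j<j′ j′<K)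
  ; g-across = λ u≢v j<K _ → more-anti u≢v ∘ proj₁ ∘ tint-injective j<K
  }
  where
  open Painted label (λ _ _ → false) label-row K 0 z≤n
  open TwoMore (two-more label 4≤D)

-- The three classes of K₄.

-- K₄: the label of an edge is its class in the 1-factorisation, and its two ends are ordered oppositely.
module _ where

  private
    lab cl : Fin 4 → Fin 4 → Fin 3
    lab = table
      ( (# 0 ∷ # 0 ∷ # 1 ∷ # 2 ∷ [])
      ∷ (# 0 ∷ # 0 ∷ # 2 ∷ # 1 ∷ [])
      ∷ (# 1 ∷ # 2 ∷ # 0 ∷ # 0 ∷ [])
      ∷ (# 2 ∷ # 1 ∷ # 0 ∷ # 0 ∷ [])
      ∷ [])
    -- `cl u v` and `cl v u` are the two classes that the half-edges of `uv` leave free.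
    cl = table
      ( (# 0 ∷ # 1 ∷ # 2 ∷ # 0 ∷ [])
      ∷ (# 2 ∷ # 0 ∷ # 0 ∷ # 2 ∷ [])
      ∷ (# 0 ∷ # 1 ∷ # 0 ∷ # 1 ∷ [])
      ∷ (# 1 ∷ # 0 ∷ # 2 ∷ # 0 ∷ [])
      ∷ [])
    o : Fin 3 → Fin 4 → Bool
    o = table
      ( (true ∷ false ∷ true  ∷ false ∷ [])
      ∷ (true ∷ true  ∷ false ∷ false ∷ [])
      ∷ (true ∷ true  ∷ false ∷ false ∷ [])
      ∷ [])

    lab-row : ∀ {u v w} → u ≢ v → u ≢ w → v ≢ w → lab u v ≢ lab u w
    lab-row {u} {v} {w} = from-yes (all? λ u → all? λ v → all? λ w →
      ¬? (u ≟ v) →-dec ¬? (u ≟ w) →-dec ¬? (v ≟ w) →-dec ¬? (lab u v ≟ lab u w)) u v w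

    lab-sym : ∀ u v → lab u v ≡ lab v u
    lab-sym = from-yes (all? λ u → all? λ v → lab u v ≟ lab v u)

    o-ends : ∀ {u v} → u ≢ v → o (lab u v) u ≢ o (lab v u) v
    o-ends {u} {v} = from-yes (all? λ u → all? λ v → ¬? (u ≟ v) →-dec ¬? (o (lab u v) u Bool.≟ o (lab v u) v)) u v

    cl≢lab : ∀ {u v} → u ≢ v → cl u v ≢ lab u v
    cl≢lab {u} {v} = from-yes (all? λ u → all? λ v → ¬? (u ≟ v) →-dec ¬? (cl u v ≟ lab u v)) u v

    cl-anti : ∀ {u v} → u ≢ v → cl u v ≢ cl v u
    cl-anti {u} {v} = from-yes (all? λ u → all? λ v → ¬? (u ≟ v) →-dec ¬? (cl u v ≟ cl v u)) u v

  rays₄ : ∀ {K r} → K < r → Rays (Maybe (Fin 3 × Fin K)) 4 K r (K + K)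
  rays₄ {K} {r} K<r = record
    { centre   = nothing
    ; a        = a
    ; g        = λ u v → shade u (cl u v)
    ; a-centre = a-centre
    ; a-own    = a-own
    ; a-cross  = a-cross
    ; a-facing = facing
    ; a-far    = λ {u} {v} {w} {t} {t′} u≢v u≢w v≢w t<K _ eq →
        lab-row u≢v u≢w v≢w (trans (proj₁ (shade-meet {u} {w} {t = t} {t′} t<K eq)) (lab-sym w u))
    ; g-own    = λ {u} {v} {j} {t} u≢v j<K _ → shade-label {u} {u} {t = j} {t} j<K (cl≢lab u≢v)
    ; g-facing = λ {u} {v} {j} {t} u≢v j<K _ → shade-label {u} {v} {t = j} {t} j<K (λ eq → cl≢lab u≢v (trans eq (lab-sym v u)))
    ; g-cross  = λ {u} {v} {w} {j} {t} _ _ _ t<K j<t → shade-depth {u} {cl u v} {lab u w} {j} {t} (<-trans j<t t<K) (<⇒≢ j<t)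
    ; g-far    = far
    ; g-along  = λ {u} {v} {j} {j′} _ j<j′ j′<K → shade-depth {u} {cl u v} {cl u v} {j} {j′} (<-trans j<j′ j′<K) (<⇒≢ j<j′)
    ; g-across = λ {u} {v} {j} {j′} u≢v j<K _ → shade-label {u} {v} {t = j} {j′} j<K (cl-anti u≢v)
    }
    where
    open Painted lab o lab-row K K ≤-refl
    facing : ∀ {u v t t′} → u ≢ v → t < K → t′ ≤ K → suc (t + t′ + r) ≤ K + K → a u v t ≢ a v u t′
    facing {u} {v} {t} {t′} u≢v t<K _ close eq =
      -- In opposite orders a colour recurs at depths of sum `K ∸ 1`, that is at distance
      -- `K + r > 2K`.
      arith 4 (λ t t′ K r → con 1 ⊕ (t ⊕ t′) ≋ K ⇒ con 1 ⊕ (t ⊕ t′ ⊕ r) ≼ K ⊕ K ⇒ K ≺ r ⇒ ⊢⊥) t t′ K r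
        (reflect-meet-opposite (o-ends u≢v) t<K (proj₂ (shade-meet {u} {v} {t = t} {t′} t<K eq))) close K<r
    far : ∀ {u v w j j′ t} → u ≢ v → u ≢ w → w ≢ v → t < K → j < t → j′ < t → r ≤ suc (j + j′) → shade v (cl v u) j′ ≢ a u w t
    far {u} {v} {w} {j} {j′} {t} _ _ _ t<K j<t j′<t r≤ eq
      with reflect-meet (o (cl v u) v) (o (lab u w) u) (<-trans j′<t t<K) (proj₂ (shade-meet {v} {u} {t = j′} {t} (<-trans j′<t t<K) eq))
    ... | inj₁ j′≡t = <⇒≢ j′<t j′≡t
    ... | inj₂ sum  = arith 5 (λ j j′ t K r → con 1 ⊕ (j′ ⊕ t) ≋ K ⇒ K ≺ r ⇒ r ≼ con 1 ⊕ (j ⊕ j′) ⇒ j ≺ t ⇒ ⊢⊥) j j′ t K r sum K<r r≤ j<t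

-- K₄: the third label c of an edge uv is absent from only two edges, so its order can be reversed between u and v.
module _ where

  private
    lab c : Fin 4 → Fin 4 → Fin 3
    lab = label
    c = table
      ( (# 0 ∷ # 2 ∷ # 0 ∷ # 1 ∷ [])
      ∷ (# 2 ∷ # 0 ∷ # 1 ∷ # 2 ∷ [])
      ∷ (# 0 ∷ # 1 ∷ # 0 ∷ # 0 ∷ [])
      ∷ (# 1 ∷ # 2 ∷ # 0 ∷ # 0 ∷ [])
      ∷ [])
    o : Fin 3 → Fin 4 → Bool
    o = table
      ( (false ∷ false ∷ true  ∷ false ∷ [])
      ∷ (true  ∷ true  ∷ false ∷ false ∷ [])
      ∷ (false ∷ true  ∷ false ∷ false ∷ [])
      ∷ [])

    c≢lab : ∀ {u v} → u ≢ v → c u v ≢ lab u v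
    c≢lab {u} {v} = from-yes (all? λ u → all? λ v → ¬? (u ≟ v) →-dec ¬? (c u v ≟ lab u v)) u v

    c-sym : ∀ u v → c u v ≡ c v u
    c-sym = from-yes (all? λ u → all? λ v → c u v ≟ c v u)

    o-ends : ∀ {u v} → u ≢ v → o (c u v) u ≢ o (c u v) v
    o-ends {u} {v} = from-yes (all? λ u → all? λ v → ¬? (u ≟ v) →-dec ¬? (o (c u v) u Bool.≟ o (c u v) v)) u v

  layers₄ : ∀ {K r} → r ≤ K → ∀ B → Layers (Maybe (Fin 3 × Fin K)) 4 K r B
  layers₄ {K} {r} r≤K B = record
    { centre   = nothing
    ; a        = a
    ; y        = y
    ; a-centre = a-centre
    ; a-own    = a-own
    ; a-cross  = a-cross
    ; a-facing = λ {u} {v} {t} {t′} u≢v t<K _ _ → shade-label {u} {v} {t = t} {t′} t<K (label-anti u≢v)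
    ; a-far    = far
    ; y-free   = λ {u} {v} {j} {j′} u≢v eq → free {j′ = j′} u≢v (first eq) ,
        subst (Free K a v u j′) (sym (y-sym u≢v eq)) (free {j′ = j} (≢-sym u≢v) (first (trans (cong suc (+-comm j′ j)) eq)))
    ; y-own    = λ {u} {v} {i} {i′} {j} {j′} _ eq _ i<j → shade-depth {u} {t = i} {j} (<-≤-trans (first eq) r≤K) (<⇒≢ i<j)
    }
    where
    open Painted lab o label-row K r r≤K
    y : Fin 4 → Fin 4 → ℕ → ℕ → Maybe (Fin 3 × Fin K)
    y u v j _ = shade u (c u v) j
    first : ∀ {j j′} → suc (j + j′) ≡ r → j < r
    first {j} {j′} eq = ≤-trans (s≤s (m≤m+n j j′)) (≤-reflexive eq)
    -- The orders at `u` and `v` are opposite on the first `r` colours of the class, so filling the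
    -- middle outermost first from either end gives the same string.
    y-sym : ∀ {u v j j′} → u ≢ v → suc (j + j′) ≡ r → y u v j j′ ≡ y v u j′ j
    y-sym {u} {v} {j} {j′} u≢v eq = trans (cong (tint K (c u v)) (reflect-opposite (o-ends u≢v) eq))
                                         (cong (λ ℓ → shade v ℓ j′) (c-sym u v))
    free : ∀ {u v j j′} → u ≢ v → j < r → Free K a u v j (y u v j j′)
    free {u} {v} {j} u≢v j<r =
      (λ {t} _ → shade-label {u} {u} {t = j} {t} j<K (c≢lab u≢v)) ,
      (λ {w} {t} _ _ _ j<t → shade-depth {u} {c u v} {lab u w} {j} {t} j<K (<⇒≢ j<t))
      where j<K = <-≤-trans j<r r≤K
    far : ∀ {u v w t t′} → u ≢ v → u ≢ w → v ≢ w → t < K → t′ < K → suc (r + t′) ≤ t → a u v t ≢ a w u t′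
    far {u} {v} {w} {t} {t′} _ _ _ t<K t′<K r+t′<t eq with ≤-<-connex r t′
    ... | inj₁ r≤t′ = <⇒≢ (≤-trans (s≤s (m≤n+m t′ r)) r+t′<t) (trans (sym (reflect-≥ (o (lab w u) w) r≤t′)) (trans (sym (proj₂ meet)) (reflect-≥ (o (lab u v) u) r≤t)))
      where
      r≤t = m+n≤o⇒m≤o r (<⇒≤ r+t′<t)
      meet = shade-meet {u} {w} {t = t} {t′} t<K eq
    ... | inj₂ t′<r = <⇒≢ (<-≤-trans (reflect-< (o (lab w u) w) t′<r) r≤t) (trans (sym (proj₂ meet)) (reflect-≥ (o (lab u v) u) r≤t))
      where
      r≤t = m+n≤o⇒m≤o r (<⇒≤ r+t′<t)
      meet = shade-meet {u} {w} {t = t} {t′} t<K eq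

edge₄ : Fin 4 → Fin 4 → Fin 6
edge₄ = table
  ( (# 0 ∷ # 0 ∷ # 1 ∷ # 2 ∷ [])
  ∷ (# 0 ∷ # 0 ∷ # 3 ∷ # 4 ∷ [])
  ∷ (# 1 ∷ # 3 ∷ # 0 ∷ # 5 ∷ [])
  ∷ (# 2 ∷ # 4 ∷ # 5 ∷ # 0 ∷ [])
  ∷ [])

-- K₄ with one middle colour more than layers: six extra colours, one per edge.  Towards v, the extra
-- colours near u are those of the edge uv (last) and of the edge from v to rotate u v (first).
module _ where

  private
    head : Fin 4 → Fin 4 → Fin 6
    head u v = edge₄ v (rotate u v)

    -- Put `x = rotate u v` and `y = rotate v u`. The half-edges of `uv` use the edges `vx`, `uy`
    -- and `uv`; these are the other three, `vy`, `xy` and `ux`. The one placed next to the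
    -- half-edge of `u` avoids `u`, and the two placed at the side of `v` avoid `v`, so they miss
    -- the colours next to those branch vertices.
    start′ middle′ end′ : Fin 4 → Fin 4 → Fin 6
    start′ u v  = edge₄ v (rotate v u)
    middle′ u v = edge₄ (rotate u v) (rotate v u)
    end′ u v    = edge₄ u (rotate u v)

    head-row : ∀ {u v w} → u ≢ v → u ≢ w → v ≢ w → head u v ≢ head u w
    head-row {u} {v} {w} = from-yes (all? λ u → all? λ v → all? λ w →
      ¬? (u ≟ v) →-dec ¬? (u ≟ w) →-dec ¬? (v ≟ w) →-dec ¬? (head u v ≟ head u w)) u v w

    head≢last : ∀ {u v w} → u ≢ v → u ≢ w → head u v ≢ edge₄ u w
    head≢last {u} {v} {w} = from-yes (all? λ u → all? λ v → all? λ w →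
      ¬? (u ≟ v) →-dec ¬? (u ≟ w) →-dec ¬? (head u v ≟ edge₄ u w)) u v w

    last-row : ∀ {u v w} → u ≢ v → u ≢ w → v ≢ w → edge₄ u v ≢ edge₄ u w
    last-row {u} {v} {w} = from-yes (all? λ u → all? λ v → all? λ w →
      ¬? (u ≟ v) →-dec ¬? (u ≟ w) →-dec ¬? (v ≟ w) →-dec ¬? (edge₄ u v ≟ edge₄ u w)) u v w

    head-facing : ∀ {u v} → u ≢ v → head u v ≢ head v u × head u v ≢ edge₄ v u
    head-facing {u} {v} = from-yes (all? λ u → all? λ v → ¬? (u ≟ v) →-dec ¬? (head u v ≟ head v u) ×-dec ¬? (head u v ≟ edge₄ v u)) u v

    Unused : Fin 4 → Fin 4 → Fin 6 → Set
    Unused u v x = x ≢ head u v × x ≢ edge₄ u v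

    unused? : ∀ u v x → Dec (Unused u v x)
    unused? u v x = ¬? (x ≟ head u v) ×-dec ¬? (x ≟ edge₄ u v)

    start-unused : ∀ {u v} → u ≢ v → Unused u v (start′ u v) × Unused v u (start′ u v)
    start-unused {u} {v} = from-yes (all? λ u → all? λ v → ¬? (u ≟ v) →-dec unused? u v (start′ u v) ×-dec unused? v u (start′ u v)) u v

    middle-unused : ∀ {u v} → u ≢ v → Unused u v (middle′ u v) × Unused v u (middle′ u v)
    middle-unused {u} {v} = from-yes (all? λ u → all? λ v → ¬? (u ≟ v) →-dec unused? u v (middle′ u v) ×-dec unused? v u (middle′ u v)) u v

    end-unused : ∀ {u v} → u ≢ v → Unused u v (end′ u v) × Unused v u (end′ u v)
    end-unused {u} {v} = from-yes (all? λ u → all? λ v → ¬? (u ≟ v) →-dec unused? u v (end′ u v) ×-dec unused? v u (end′ u v)) u v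

    start-cross : ∀ {u v w} → u ≢ v → u ≢ w → w ≢ v → start′ u v ≢ edge₄ u w
    start-cross {u} {v} {w} = from-yes (all? λ u → all? λ v → all? λ w →
      ¬? (u ≟ v) →-dec ¬? (u ≟ w) →-dec ¬? (w ≟ v) →-dec ¬? (start′ u v ≟ edge₄ u w)) u v w

    later-cross : ∀ {u v w} → u ≢ v → v ≢ w → w ≢ u → middle′ u v ≢ edge₄ v w × end′ u v ≢ edge₄ v w
    later-cross {u} {v} {w} = from-yes (all? λ u → all? λ v → all? λ w →
      ¬? (u ≟ v) →-dec ¬? (v ≟ w) →-dec ¬? (w ≟ u) →-dec ¬? (middle′ u v ≟ edge₄ v w) ×-dec ¬? (end′ u v ≟ edge₄ v w)) u v w

    distinct : ∀ {u v} → u ≢ v → start′ u v ≢ middle′ u v × start′ u v ≢ end′ u v × middle′ u v ≢ end′ u v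
    distinct {u} {v} = from-yes (all? λ u → all? λ v → ¬? (u ≟ v) →-dec
      ¬? (start′ u v ≟ middle′ u v) ×-dec ¬? (start′ u v ≟ end′ u v) ×-dec ¬? (middle′ u v ≟ end′ u v)) u v

  -- The bound `3k + 1` admits all pairs of depths up to `k`: facing half-edges of `L` share no
  -- colour but the centre.
  module _ {C : Set} {k : ℕ} (L : Layers C 4 k k (suc (k + k + k))) where
    open Layers L

    private
      K r : ℕ
      K = suc (suc k)
      r = suc K

      data Slot (t : ℕ) : Set where
        first : t ≡ 0 → Slot t
        layer : ∀ s → t ≡ suc s → s < k → Slot t
        last  : t ≡ suc k → Slot t
        hub   : suc k < t → Slot t

      slot : ∀ t → Slot t
      slot zero = first refl
      slot (suc t) with <-cmp t k
      ... | tri< t<k _ _ = layer t refl t<k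
      ... | tri≈ _ t≡k _ = last (cong suc t≡k)
      ... | tri> _ _ k<t = hub (s≤s k<t)

      value : ∀ {t} → Fin 4 → Fin 4 → Slot t → Fin 6 ⊎ C
      value u v (first _)     = inj₁ (head u v)
      value u v (layer s _ _) = inj₂ (a u v s)
      value u v (last _)      = inj₁ (edge₄ u v)
      value u v (hub _)       = inj₂ (a u v k)

      value-own : ∀ {u v t t′} (x : Slot t) (x′ : Slot t′) → u ≢ v → t < t′ → t′ ≤ K → value u v x ≢ value u v x′
      value-own (first refl) (first refl) u≢v () _
      value-own (first _) (layer _ _ _) _ _ _ ()
      value-own (first _) (last _) u≢v _ _ = head≢last u≢v u≢v ∘ inj₁-injective
      value-own (first _) (hub _) _ _ _ ()
      value-own (layer _ _ _) (first _) _ _ _ ()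
      value-own (layer _ refl _) (layer _ refl s′<k) u≢v t<t′ _ = a-own u≢v (s≤s⁻¹ t<t′) (<⇒≤ s′<k) ∘ inj₂-injective
      value-own (layer _ _ _) (last _) _ _ _ ()
      value-own (layer _ _ s<k) (hub _) u≢v _ _ = a-own u≢v s<k ≤-refl ∘ inj₂-injective
      value-own (last _) (first refl) _ () _
      value-own (last _) (layer _ _ _) _ _ _ ()
      value-own (last refl) (last refl) _ t<t′ _ = contradiction t<t′ (<-irrefl refl)
      value-own (last _) (hub _) _ _ _ ()
      value-own (hub k<t) _ _ t<t′ t′≤K = contradiction t′≤K (<⇒≱ (≤-<-trans k<t t<t′))

      value-cross : ∀ {u v w t t′} (x : Slot t) (x′ : Slot t′) → u ≢ v → u ≢ w → v ≢ w → t < K → t′ < K →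
                    value u v x ≢ value u w x′
      value-cross (hub k<t) _ _ _ _ t<K _ = contradiction t<K (≤⇒≯ k<t)
      value-cross _ (hub k<t) _ _ _ _ t<K = contradiction t<K (≤⇒≯ k<t)
      value-cross (first _) (first _) u≢v u≢w v≢w _ _ = head-row u≢v u≢w v≢w ∘ inj₁-injective
      value-cross (first _) (layer _ _ _) _ _ _ _ _ ()
      value-cross (first _) (last _) u≢v u≢w _ _ _ = head≢last u≢v u≢w ∘ inj₁-injective
      value-cross (layer _ _ _) (first _) _ _ _ _ _ ()
      value-cross (layer _ _ s<k) (layer _ _ s′<k) u≢v u≢w v≢w _ _ = a-cross u≢v u≢w v≢w s<k s′<k ∘ inj₂-injective
      value-cross (layer _ _ _) (last _) _ _ _ _ _ ()
      value-cross (last _) (first _) u≢v u≢w _ _ _ = ≢-sym (head≢last u≢w u≢v) ∘ inj₁-injective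
      value-cross (last _) (layer _ _ _) _ _ _ _ _ ()
      value-cross (last _) (last _) u≢v u≢w v≢w _ _ = last-row u≢v u≢w v≢w ∘ inj₁-injective

      value-facing : ∀ {u v t t′} (x : Slot t) (x′ : Slot t′) → u ≢ v → suc (t + t′ + r) ≤ suc (K + K) → value u v x ≢ value v u x′
      value-facing {t = t} {t′} x x′ u≢v close = go x x′
        where
        t+t′≤ : t + t′ ≤ suc k
        t+t′≤ = arith 3 (λ t t′ k → con 1 ⊕ (t ⊕ t′ ⊕ (con 3 ⊕ k)) ≼ con 1 ⊕ (con 2 ⊕ k ⊕ (con 2 ⊕ k)) ⇒ ⊢ t ⊕ t′ ≼ con 1 ⊕ k) t t′ k close
        go : (x : Slot t) (x′ : Slot t′) → value _ _ x ≢ value _ _ x′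
        go (hub k<t) _ = contradiction (m+n≤o⇒m≤o t t+t′≤) (<⇒≱ k<t)
        go _ (hub k<t′) = contradiction (m+n≤o⇒n≤o t t+t′≤) (<⇒≱ k<t′)
        go (first _) (first _) = proj₁ (head-facing u≢v) ∘ inj₁-injective
        go (first _) (layer _ _ _) ()
        go (first _) (last _) = proj₂ (head-facing u≢v) ∘ inj₁-injective
        go (layer _ _ _) (first _) ()
        go (layer s refl s<k) (layer s′ refl s′<k) = a-facing u≢v s<k (<⇒≤ s′<k)
          (arith 3 (λ s s′ k → s ≺ k ⇒ s′ ≺ k ⇒ ⊢ con 1 ⊕ (s ⊕ s′ ⊕ k) ≼ con 1 ⊕ (k ⊕ k ⊕ k)) s s′ k s<k s′<k) ∘ inj₂-injective
        go (layer _ _ _) (last _) ()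
        go (last _) (first _) = ≢-sym (proj₂ (head-facing (≢-sym u≢v))) ∘ inj₁-injective
        go (last _) (layer _ _ _) ()
        go (last refl) (last refl) = ⊥-elim (arith 1 (λ k → con 1 ⊕ k ⊕ (con 1 ⊕ k) ≼ con 1 ⊕ k ⇒ ⊢⊥) k t+t′≤)

      A : Fin 4 → Fin 4 → ℕ → Fin 6 ⊎ C
      A u v t = value u v (slot t)

      Y : Fin 4 → Fin 4 → ℕ → ℕ → Fin 6 ⊎ C
      -- Of the `k + 3` middle points, one extra point precedes the `k` points of `L` and two follow
      -- them.
      Y u v zero    _             = inj₁ (start′ u v)
      Y u v (suc i) (suc (suc i′)) = inj₂ (y u v i i′)
      Y u v (suc i) 1             = inj₁ (middle′ u v)
      Y u v (suc i) 0             = inj₁ (end′ u v)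

      unused-own : ∀ {u v x t} → Unused u v x → (s : Slot t) → inj₁ x ≢ value u v s
      unused-own (x≢head , _) (first _) = x≢head ∘ inj₁-injective
      unused-own _ (layer _ _ _) ()
      unused-own (_ , x≢last) (last _) = x≢last ∘ inj₁-injective
      unused-own _ (hub _) ()

      late : ∀ {t j} → suc k ≤ j → t < K → j < t → ⊥
      late k<j t<K j<t = <⇒≱ t<K (≤-<-trans k<j j<t)

      extra-cross : ∀ {u w x t j} → x ≢ edge₄ u w → (s : Slot t) → t < K → j < t → inj₁ x ≢ value u w s
      extra-cross x≢ (first refl) _ ()
      extra-cross x≢ (layer _ _ _) _ _ ()
      extra-cross x≢ (last _) _ _ = x≢ ∘ inj₁-injective
      extra-cross x≢ (hub k<t) t<K _ = contradiction t<K (≤⇒≯ k<t)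

      layer-free : ∀ {u v i j c} → suc i ≤ j → Free k a u v i c → Free K A u v j (inj₂ c)
      layer-free {u} {v} {i} {j} {c} i<j (own , cross) = (λ {t} _ → free-own (slot t)) , λ {w} {t} → free-cross (slot t)
        where
        free-own : ∀ {t} (s : Slot t) → inj₂ c ≢ value u v s
        free-own (first _) ()
        free-own (layer _ _ s<k) = own (<⇒≤ s<k) ∘ inj₂-injective
        free-own (last _) ()
        free-own (hub _) = own ≤-refl ∘ inj₂-injective
        free-cross : ∀ {w t} (s : Slot t) → u ≢ w → w ≢ v → t < K → j < t → inj₂ c ≢ value u w s
        free-cross (first _) _ _ _ _ ()
        free-cross (layer _ refl s<k) u≢w w≢v _ j<t = cross u≢w w≢v s<k (s≤s⁻¹ (≤-<-trans i<j j<t)) ∘ inj₂-injective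
        free-cross (last _) _ _ _ _ ()
        free-cross (hub k<t) _ _ t<K _ = contradiction t<K (≤⇒≯ k<t)

      Y-free : ∀ {u v j j′} → u ≢ v → suc (j + j′) ≡ r → Free K A u v j (Y u v j j′) × Free K A v u j′ (Y u v j j′)
      Y-free {j = zero} u≢v refl =
        ((λ {t} _ → unused-own (proj₁ (start-unused u≢v)) (slot t)) ,
         λ {_} {t} u≢w w≢v → extra-cross (start-cross u≢v u≢w w≢v) (slot t)) ,
        ((λ {t} _ → unused-own (proj₂ (start-unused u≢v)) (slot t)) , λ _ _ t<K j<t → ⊥-elim (late (n≤1+n _) t<K j<t))
      Y-free {j = suc i} {suc (suc i′)} u≢v eq =
        layer-free ≤-refl (proj₁ free) , layer-free (n≤1+n _) (proj₂ free)
        where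
        free = y-free u≢v (arith 3 (λ i i′ k → con 2 ⊕ i ⊕ (con 2 ⊕ i′) ≋ con 3 ⊕ k ⇒ ⊢ con 1 ⊕ (i ⊕ i′) ≋ k) i i′ k eq)
      Y-free {j = suc i} {1} u≢v eq =
        ((λ {t} _ → unused-own (proj₁ (middle-unused u≢v)) (slot t)) , λ _ _ t<K j<t → ⊥-elim (late k<j t<K j<t)) ,
        ((λ {t} _ → unused-own (proj₂ (middle-unused u≢v)) (slot t)) ,
         λ {_} {t} v≢w w≢u → extra-cross (proj₁ (later-cross u≢v v≢w w≢u)) (slot t))
        where
        k<j : suc k ≤ suc i
        k<j = arith 2 (λ i k → con 2 ⊕ i ⊕ con 1 ≋ con 3 ⊕ k ⇒ ⊢ con 1 ⊕ k ≼ con 1 ⊕ i) i k eq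
      Y-free {j = suc i} {0} u≢v eq =
        ((λ {t} _ → unused-own (proj₁ (end-unused u≢v)) (slot t)) , λ _ _ t<K j<t → ⊥-elim (late k<j t<K j<t)) ,
        ((λ {t} _ → unused-own (proj₂ (end-unused u≢v)) (slot t)) ,
         λ {_} {t} v≢w w≢u → extra-cross (proj₂ (later-cross u≢v v≢w w≢u)) (slot t))
        where
        k<j : suc k ≤ suc i
        k<j = arith 2 (λ i k → con 2 ⊕ i ⊕ con 0 ≋ con 3 ⊕ k ⇒ ⊢ con 1 ⊕ k ≼ con 1 ⊕ i) i k eq

      Y-own : ∀ {u v i i′ j j′} → u ≢ v → suc (i + i′) ≡ r → suc (j + j′) ≡ r → i < j → Y u v i i′ ≢ Y u v j j′
      Y-own {i = zero} {j = suc j} {suc (suc _)} _ _ _ _ ()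
      Y-own {i = zero} {j = suc j} {1} u≢v _ _ _ = proj₁ (distinct u≢v) ∘ inj₁-injective
      Y-own {i = zero} {j = suc j} {0} u≢v _ _ _ = proj₁ (proj₂ (distinct u≢v)) ∘ inj₁-injective
      Y-own {i = suc i} {suc (suc i′)} {suc j} {suc (suc j′)} u≢v eq eq′ i<j = y-own u≢v
        (arith 3 (λ i i′ k → con 2 ⊕ i ⊕ (con 2 ⊕ i′) ≋ con 3 ⊕ k ⇒ ⊢ con 1 ⊕ (i ⊕ i′) ≋ k) i i′ k eq)
        (arith 3 (λ i i′ k → con 2 ⊕ i ⊕ (con 2 ⊕ i′) ≋ con 3 ⊕ k ⇒ ⊢ con 1 ⊕ (i ⊕ i′) ≋ k) j j′ k eq′)
        (s≤s⁻¹ i<j) ∘ inj₂-injective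
      Y-own {i = suc i} {suc (suc i′)} {suc j} {1} _ _ _ _ ()
      Y-own {i = suc i} {suc (suc i′)} {suc j} {0} _ _ _ _ ()
      Y-own {i = suc i} {1} {suc j} {suc (suc _)} _ _ _ _ ()
      Y-own {i = suc i} {1} {suc j} {0} u≢v _ _ _ = proj₂ (proj₂ (distinct u≢v)) ∘ inj₁-injective
      Y-own {i = suc i} {1} {suc j} {1} _ eq eq′ i<j = ⊥-elim
        (arith 3 (λ i j r → con 1 ⊕ (i ⊕ con 1) ≋ r ⇒ con 1 ⊕ (j ⊕ con 1) ≋ r ⇒ i ≺ j ⇒ ⊢⊥) (suc i) (suc j) r eq eq′ i<j)
      Y-own {i = suc i} {0} {suc j} {j′} _ eq eq′ i<j = ⊥-elim
        (arith 4 (λ i j j′ r → con 1 ⊕ (i ⊕ con 0) ≋ r ⇒ con 1 ⊕ (j ⊕ j′) ≋ r ⇒ i ≺ j ⇒ ⊢⊥) (suc i) (suc j) j′ r eq eq′ i<j)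

    extend-layers : Layers (Fin 6 ⊎ C) 4 K r (suc (K + K))
    extend-layers = record
      { centre   = inj₂ centre
      ; a        = A
      ; y        = Y
      ; a-centre = λ u v → value-centre (slot K)
      ; a-own    = λ {_} {_} {t} {t′} → value-own (slot t) (slot t′)
      ; a-cross  = λ {_} {_} {_} {t} {t′} → value-cross (slot t) (slot t′)
      ; a-facing = λ {_} {_} {t} {t′} u≢v _ _ → value-facing (slot t) (slot t′) u≢v
      ; a-far    = λ {t′ = t′} _ _ _ t<K _ far → contradiction (≤-trans (m≤n⇒m≤n+o t′ (n≤1+n K)) (<⇒≤ far)) (<⇒≱ t<K)
      ; y-free   = Y-free
      ; y-own    = λ {_} {_} {i} {i′} {j} {j′} → Y-own {i = i} {i′} {j} {j′}
      }
      where
      value-centre : ∀ {u v} (x : Slot K) → value u v x ≡ inj₂ centre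
      value-centre (layer _ refl s<k) = contradiction s<k (≤⇒≯ (n≤1+n _))
      value-centre (last ())
      value-centre {u} {v} (hub _) = cong inj₂ (a-centre u v)

-- Two small colourings of K₄, checked by evaluation.

module Tabulated {c : ℕ} (m n : ℕ) (rows : Vec (List (Fin (suc c))) 6) where

  nth : List (Fin (suc c)) → ℕ → Fin (suc c)
  -- A default for positions past the end; the rows below have `n + 1` entries.
  nth [] _ = zero
  nth (x ∷ _) zero = x
  nth (_ ∷ xs) (suc i) = nth xs i

  strand : Fin 4 → Fin 4 → List (Fin (suc c))
  strand u v with u Fin.<? v
  ... | yes _ = Vec.lookup rows (edge₄ u v)
  ... | no _  = List.reverse (Vec.lookup rows (edge₄ u v))

  hue : Fin 4 → Fin 4 → ℕ → Fin (suc c)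
  hue u v = nth (strand u v)

  hub : Fin 4 → Fin (suc c)
  hub zero    = hue zero (suc zero) 0
  hub (suc u) = hue (suc u) zero 0

  begins? : Dec (∀ u v → u ≢ v → hue u v 0 ≡ hub u)
  begins? = all? λ u → all? λ v → ¬? (u ≟ v) →-dec hue u v 0 ≟ hub u

  reverse? : Dec (∀ u v → u ≢ v → ∀ {i} → i < suc n → hue u v i ≡ hue v u (n ∸ i))
  reverse? = all? λ u → all? λ v → ¬? (u ≟ v) →-dec allUpTo? (λ i → hue u v i ≟ hue v u (n ∸ i)) (suc n)

  along? : Dec (∀ u v → u ≢ v → ∀ {j} → j < suc n → ∀ {i} → i < j → j ≤ m + i → hue u v i ≢ hue u v j)
  along? = all? λ u → all? λ v → ¬? (u ≟ v) →-dec
    allUpTo? (λ j → allUpTo? (λ i → j ≤? m + i →-dec ¬? (hue u v i ≟ hue u v j)) j) (suc n)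

  across? : Dec (∀ u v w → u ≢ v → u ≢ w → v ≢ w → ∀ {i} → i < suc m → ∀ {j} → j < suc m →
                 0 < i → 0 < j → i + j ≤ m → hue u v i ≢ hue u w j)
  across? = all? λ u → all? λ v → all? λ w → ¬? (u ≟ v) →-dec ¬? (u ≟ w) →-dec ¬? (v ≟ w) →-dec
    allUpTo? (λ i → allUpTo? (λ j → 0 <? i →-dec 0 <? j →-dec i + j ≤? m →-dec ¬? (hue u v i ≟ hue u w j)) (suc m)) (suc m)

  tabulated : True begins? → True reverse? → True along? → True across? → Strings (Fin (suc c)) 4 m n
  tabulated begins reverses alongs acrosses = record
    { centre  = hub
    ; colour  = hue
    ; begins  = λ {u} {v} → toWitness begins u v
    ; reverse = λ {u} {v} {i} {j} u≢v i+j → trans (toWitness reverses u v u≢v (s≤s (m+n≤o⇒m≤o i (≤-reflexive i+j))))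
        (cong (hue v u) (trans (cong (_∸ i) (sym i+j)) (m+n∸m≡n i j)))
    ; along   = λ {u} {v} u≢v i<j j≤n → toWitness alongs u v u≢v (s≤s j≤n) i<j
    ; across  = λ {u} {v} {w} {i} {j} u≢v u≢w v≢w 0<i 0<j i+j → toWitness acrosses u v w u≢v u≢w v≢w
        (s≤s (m+n≤o⇒m≤o i i+j)) (s≤s (m+n≤o⇒n≤o i i+j)) 0<i 0<j i+j
    }

-- The rows are the edges 01, 02, 03, 12, 13, 23 of K₄; both colourings were found by computer search.
strings-3-6 : Strings (Fin 5) 4 3 6
strings-3-6 = Tabulated.tabulated 3 6
  ( (# 3 ∷ # 0 ∷ # 1 ∷ # 4 ∷ # 2 ∷ # 3 ∷ # 1 ∷ [])
  ∷ (# 3 ∷ # 4 ∷ # 1 ∷ # 2 ∷ # 3 ∷ # 0 ∷ # 1 ∷ [])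
  ∷ (# 3 ∷ # 2 ∷ # 1 ∷ # 0 ∷ # 4 ∷ # 3 ∷ # 1 ∷ [])
  ∷ (# 1 ∷ # 4 ∷ # 2 ∷ # 0 ∷ # 3 ∷ # 4 ∷ # 1 ∷ [])
  ∷ (# 1 ∷ # 0 ∷ # 2 ∷ # 3 ∷ # 4 ∷ # 0 ∷ # 1 ∷ [])
  ∷ (# 1 ∷ # 2 ∷ # 3 ∷ # 0 ∷ # 4 ∷ # 2 ∷ # 1 ∷ [])
  ∷ [])
  tt tt tt tt

strings-5-9 : Strings (Fin 8) 4 5 9
strings-5-9 = Tabulated.tabulated 5 9
  ( (# 0 ∷ # 5 ∷ # 6 ∷ # 1 ∷ # 4 ∷ # 7 ∷ # 2 ∷ # 5 ∷ # 3 ∷ # 0 ∷ [])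
  ∷ (# 0 ∷ # 2 ∷ # 4 ∷ # 1 ∷ # 6 ∷ # 5 ∷ # 3 ∷ # 7 ∷ # 4 ∷ # 0 ∷ [])
  ∷ (# 0 ∷ # 3 ∷ # 7 ∷ # 1 ∷ # 6 ∷ # 2 ∷ # 4 ∷ # 3 ∷ # 7 ∷ # 0 ∷ [])
  ∷ (# 0 ∷ # 4 ∷ # 1 ∷ # 2 ∷ # 5 ∷ # 7 ∷ # 3 ∷ # 6 ∷ # 1 ∷ # 0 ∷ [])
  ∷ (# 0 ∷ # 6 ∷ # 7 ∷ # 2 ∷ # 1 ∷ # 3 ∷ # 4 ∷ # 6 ∷ # 5 ∷ # 0 ∷ [])
  ∷ (# 0 ∷ # 2 ∷ # 5 ∷ # 3 ∷ # 7 ∷ # 6 ∷ # 4 ∷ # 2 ∷ # 1 ∷ # 0 ∷ [])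
  ∷ [])
  tt tt tt tt

-- Counting the colours and assembling the cases.

maybe-↣ : ∀ {A : Set} {c} → A ↣ Fin c → Maybe A ↣ Fin (suc c)
maybe-↣ A↣c = mk↣ {to = Maybe.maybe (suc ∘ Injection.to A↣c) zero} λ {x} {y} → inj x y
  where
  inj : ∀ x y → Maybe.maybe (suc ∘ Injection.to A↣c) zero x ≡ Maybe.maybe (suc ∘ Injection.to A↣c) zero y → x ≡ y
  inj nothing  nothing  _  = refl
  inj nothing  (just _) ()
  inj (just _) nothing  ()
  inj (just x) (just y) eq = cong just (Injection.injective A↣c (Fin.suc-injective eq))

pair-↣ : ∀ {a b} → (Fin a × Fin b) ↣ Fin (a * b)
pair-↣ = ↔⇒↣ (↔-sym Fin.*↔×)

sum-↣ : ∀ {a b} {B : Set} → B ↣ Fin b → (Fin a ⊎ B) ↣ Fin (a + b)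
sum-↣ B↣b = ↔⇒↣ (↔-sym Fin.+↔⊎) ↣-∘ (↣-id _ ⊎-↣ B↣b)

-- The colour type stays free, so every construction keeps its own shape of colours and is counted
-- only at the end.
record Coloured (N m n c : ℕ) : Set₁ where
  constructor coloured
  field
    {Colour} : Set
    colours  : Strings Colour N m n
    finite   : Colour ↣ Fin c

recount : ∀ {N m n c c′} → c ≡ c′ → Coloured N m n c → Coloured N m n c′
recount refl S = S

stretch : ∀ {N m n c} q → m < n → Coloured N m n c → Coloured N m (n + q * suc m) c
stretch {N} {m} {n} {c} zero m<n S = subst (λ n → Coloured N m n c) (sym (+-identityʳ n)) S
stretch {N} {m} {n} {c} (suc q) m<n S = subst (λ n → Coloured N m n c)
  (arith 3 (λ n m x → ⊢ n ⊕ x ⊕ (con 1 ⊕ m) ≋ n ⊕ (con 1 ⊕ m ⊕ x)) n m (q * suc m))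
  (coloured (lengthen (<-≤-trans m<n (m≤m+n n _)) (Coloured.colours S′)) (Coloured.finite S′))
  where S′ = stretch q m<n S

Tints : ℕ → ℕ → Set
Tints D K = Maybe (Fin D × Fin K)

tints-↣ : ∀ {D K} → Tints D K ↣ Fin (suc (D * K))
tints-↣ = maybe-↣ pair-↣

module _ (d : ℕ) where

  private
    D N : ℕ
    D = 3 + d
    N = suc D

  -- The `N = D + 1` vertex colours take the place of one layer and of the extra colour.
  odd-count : ∀ K → N + suc (D * K) ≡ 2 + D * suc K
  odd-count K = trans (arith 2 (λ D x → ⊢ con 1 ⊕ D ⊕ (con 1 ⊕ x) ≋ con 2 ⊕ (D ⊕ x)) D (D * K)) (cong (2 +_) (sym (*-suc D K)))

  spare : Spare N
  -- With `u` itself as the value at `u v`, the two further values are vertices outside the edge.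
  spare = record { spare = more ; spare≢u = more≢ ; spare≢v = more≢-other ; spare-anti = more-anti }
    where open TwoMore (two-more {N} (λ u _ → u) (s≤s (s≤s (s≤s (s≤s z≤n)))))

few-layers : ∀ d {K r} B → r ≤ K → Layers (Tints (3 + d) K) (4 + d) K r B
few-layers zero    B r≤K = layers₄ r≤K B
few-layers (suc d) {K} {r} B r≤K = rays⇒layers (≤-trans r≤K (m≤m+n K K)) (rays (s≤s (s≤s (s≤s (s≤s z≤n)))) K r B)

many-rays : ∀ d {K r} → K < r → Rays (Tints (3 + d) K) (4 + d) K r (K + K)
many-rays zero    K<r = rays₄ K<r
many-rays (suc d) {K} {r} K<r = rays (s≤s (s≤s (s≤s (s≤s z≤n)))) K r (K + K)

even-colouring : ∀ d k {r} → r ≤ k + k → Coloured (4 + d) (k + k) (suc (k + k + r)) (suc ((3 + d) * k))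
even-colouring d k {r} r≤2k with ≤-<-connex r k
... | inj₁ r≤k = coloured (strings (even-layout {k = k} (few-layers d (k + k) r≤k))) tints-↣
... | inj₂ k<r = coloured (strings (even-layout {k = k} (rays⇒layers r≤2k (many-rays d k<r)))) tints-↣

tight-odd-colouring : ∀ d k → Coloured (4 + d) (suc (k + k)) (suc (k + k + 1)) (2 + (3 + d) * k)
tight-odd-colouring d k = coloured (strings (tight-odd-layout {k = k} (few-layers d (k + k) z≤n))) (maybe-↣ tints-↣)

-- For r = K + 1 neither odd-layout with few-layers nor long-odd-layout applies.
critical-colouring : ∀ d K → Coloured (4 + d) (suc K + suc (suc K)) (suc (suc (suc K) + suc (suc K) + suc K)) (2 + (3 + d) * suc K)
-- `extend-layers` adds two layers to a smaller system, so it starts at `K = 2`; `K = 0` and `K = 1`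
-- are the tables.
critical-colouring zero zero = coloured strings-3-6 (mk↣ id)
critical-colouring zero (suc zero) = coloured strings-5-9 (mk↣ id)
critical-colouring zero (suc (suc k)) = recount
  (arith 2 (λ x k → x ≋ k ⊕ (k ⊕ k) ⇒ ⊢ con 4 ⊕ (con 6 ⊕ (con 1 ⊕ x)) ≋ con 2 ⊕ (con 3 ⊕ k ⊕ (con 3 ⊕ k ⊕ (con 3 ⊕ k ⊕ con 0))))
    (3 * k) k (cong (λ x → k + (k + x)) (+-identityʳ k)))
  (coloured (strings (odd-layout (extend-layers (layers₄ ≤-refl _)) (twist 0) (suc (suc k)) (n≤1+n _) ≤-refl λ K≤t t<K → contradiction K≤t (<⇒≱ t<K)))
            (sum-↣ (sum-↣ tints-↣)))
-- For `K = 0` the rays are empty and cannot fill the one middle point.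
critical-colouring (suc d) zero = recount
  (cong (2 +_) (sym (*-identityʳ (4 + d))))
  (coloured (strings (short-odd-layout (twist (suc d)) λ u v → fresh _ (s≤s (s≤s (s≤s (s≤s (s≤s z≤n)))))))
            (maybe-↣ (mk↣ id)))
critical-colouring (suc d) (suc K) = recount (odd-count (suc d) (suc K))
  (coloured (strings (odd-layout (rays⇒layers (s≤s (m≤n+m (suc K) K)) (rays (s≤s (s≤s (s≤s (s≤s z≤n)))) (suc K) (suc (suc K)) _))
                       (twist (suc d)) (suc K) (n≤1+n _) ≤-refl λ K≤t t<K → contradiction K≤t (<⇒≱ t<K)))
            (sum-↣ tints-↣))

odd-colouring : ∀ d K {r} → r ≤ suc K + suc K →
                Coloured (4 + d) (suc K + suc (suc K)) (suc (suc (suc K) + suc (suc K) + r)) (2 + (3 + d) * suc K)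
odd-colouring d K {r} r≤ with <-cmp r (suc K)
... | tri< (s≤s r≤K) _ _ = recount (odd-count d K)
  (coloured (strings (odd-layout (few-layers d _ r≤K) (twist d) r ≤-refl r≤K λ r≤t _ → r≤t)) (sum-↣ tints-↣))
... | tri≈ _ refl _ = critical-colouring d K
... | tri> _ _ (s≤s {n = r′} K<r′) = recount (odd-count d K)
  (coloured (strings (long-odd-layout (many-rays d K<r′) K<r′
              (arith 2 (λ r K → con 1 ⊕ r ≼ con 1 ⊕ K ⊕ (con 1 ⊕ K) ⇒ ⊢ r ≼ con 1 ⊕ (K ⊕ K)) r′ K r≤) (spare d)))
            (sum-↣ tints-↣))

data Half : ℕ → Set where
  even : ∀ k → Half (k + k)
  odd  : ∀ k → Half (suc (k + k))

half : ∀ m → Half m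
half zero = even 0
half (suc m) with half m
... | even k = odd k
... | odd k  = subst Half (cong suc (+-suc k k)) (even (suc k))

reduce : ∀ {N m n c} → m < n → (∀ {ρ} → ρ ≤ m → Coloured N m (suc m + ρ) c) → Coloured N m n c
reduce {N} {m} {n} {c} m<n colour = subst (λ n → Coloured N m n c)
  (trans (+-assoc (suc m) ρ (q * suc m)) (trans (cong (suc m +_) (sym (m≡m%n+[m/n]*n (n ∸ suc m) (suc m)))) (m+[n∸m]≡n m<n)))
  (stretch q (m≤m+n (suc m) ρ) (colour (s≤s⁻¹ (m%n<n (n ∸ suc m) (suc m)))))
  where
  ρ = (n ∸ suc m) % suc m
  q = (n ∸ suc m) / suc m

FracNumbers : ∀ {N} → SimpleGraph N → ℕ → ℕ → Set
FracNumbers G m n = Σ ℕ λ c → IsChromaticNumber (FracPower G m n) c × IsCliqueNumber (FracPower G m n) c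

numbers : ∀ {d m n c} (G : SimpleGraph (4 + d)) → 1 < m → m < n → Coloured (4 + d) m n c →
          HasClique (FracPower G m n) c → FracNumbers G m n
numbers G 1<m m<n (coloured S finite) clique =
  _ , equal-numbers (colorable G S finite (<-trans 1<m m<n) m<n) clique

complete-numbers : ∀ d (G : SimpleGraph (4 + d)) → IsComplete G → ∀ m n → 1 < m → m < n → FracNumbers G m n
complete-numbers d G complete m n 1<m m<n with half m
... | even k = numbers G 1<m m<n (reduce m<n (even-colouring d k))
                 (even-clique G complete n k ≤-refl (≤-<-trans (m≤m+n k k) m<n))
... | odd zero = contradiction 1<m (<-irrefl refl)
... | odd (suc K) = numbers G 1<m m<n (reduce m<n colouring)
                      (odd-clique G complete n (suc K) (≤-reflexive (+-suc (suc K) (suc K))) (≤-<-trans (s≤s (m≤m+n (suc K) (suc K))) m<n) zero)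
  where
  colouring : ∀ {ρ} → ρ ≤ suc (suc K + suc K) → Coloured (4 + d) (suc (suc K + suc K)) (suc (suc (suc K + suc K)) + ρ) (2 + (3 + d) * suc K)
  colouring {zero} _ = subst (λ n → Coloured (4 + d) (suc (suc K + suc K)) n (2 + (3 + d) * suc K))
    (arith 1 (λ K → ⊢ con 1 ⊕ (con 1 ⊕ K ⊕ (con 1 ⊕ K) ⊕ con 1) ≋ con 2 ⊕ (con 1 ⊕ K ⊕ (con 1 ⊕ K)) ⊕ con 0) K)
    (tight-odd-colouring d (suc K))
  -- Half-edges with `p = k + 1`, one more than in the tight case, leave `ρ ∸ 1` middle points.
  colouring {suc r} (s≤s r≤) = subst₂ (λ m n → Coloured (4 + d) m n (2 + (3 + d) * suc K))
    (arith 1 (λ K → ⊢ con 1 ⊕ K ⊕ (con 2 ⊕ K) ≋ con 2 ⊕ (K ⊕ (con 1 ⊕ K))) K)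
    (arith 2 (λ K r → ⊢ con 1 ⊕ (con 2 ⊕ K ⊕ (con 2 ⊕ K) ⊕ r) ≋ con 2 ⊕ (con 1 ⊕ K ⊕ (con 1 ⊕ K)) ⊕ (con 1 ⊕ r)) K r)
    (odd-colouring d K r≤)

theorem6p2 : ∀ (N : ℕ) (G : SimpleGraph N) → IsComplete G → MaxDegree≥ G 3 →
    ∀ (m n : ℕ) → 1 < m → m < n →
    Σ ℕ (λ c → IsChromaticNumber (FracPower G m n) c × IsCliqueNumber (FracPower G m n) c)
-- No vertex is its own neighbour, so degree 3 forces `N ≥ 4`.
theorem6p2 N G complete (v , 3≤deg) with ≤-trans (s≤s 3≤deg) (degree<order G v)
... | s≤s (s≤s (s≤s (s≤s {n = d} _))) = complete-numbers d G complete
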